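{- In the Fock representation (multiplication convention) of the affine Yangian of $\mathfrak{gl}_1$ with parameters $(h_1,h_2,h_3)=(\alpha,-1,1-\alpha)$ on $\Lambda=\mathbb Q(\alpha)[p_1,p_2,\dots]$, the first Yangian modes act as $$e_0=p_1,\qquad f_0=-\frac1\alpha D_1,\qquad \psi_0=\frac1\alpha,\qquad \psi_1=0,$$ $$\psi_2=2E,\qquad \psi_3=3\Delta_2(\alpha)+2(\alpha-1)E,$$ $$e_1=\sum_{j\ge1}p_{j+1}D_j,\qquad f_1=-\sum_{j\ge1}p_jD_{j+1}.$$ Equivalently (for $\psi_3$), on the basis $Q'_\lambda$ diagonalizing the deformed class product, the eigenvalue of $\psi_3$ is $6C_1^{(\alpha)}(\lambda)+2(\alpha-1)|\lambda|$. On the spectral side, the Hall adjoint of $\psi_3$ is $3\mathcal H_2(\alpha)+2(\alpha-1)E$.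
   Context: $\alpha$ is an indeterminate, $D_k=k\,\partial/\partial p_k$, $E=\sum_{k\ge1}p_kD_k$. The Hall scalar product is $\langle p_\lambda,p_\mu\rangle_{\mathrm{Hall}}=\delta_{\lambda\mu}z_\lambda$. $P^{(\alpha)}_\lambda$ is the monic Jack function (orthogonal for $\langle p_\lambda,p_\mu\rangle_\alpha=\delta_{\lambda\mu}z_\lambda\alpha^{\ell(\lambda)}$), and $(Q'_\lambda)$ is the Hall-dual basis. For a box $\square=(i,j)$ (row $i$, column $j$), $c_\alpha(\square)=\alpha(j-1)-(i-1)$, $C_1^{(\alpha)}(\lambda)=\sum_{\square\in\lambda}c_\alpha(\square)$. The Jack cut-and-join operator is $$\Delta_2(\alpha)=\alpha\sum_{i,j\ge1}p_ip_jD_{i+j}+\sum_{i,j\ge1}p_{i+j}D_iD_j+(\alpha-1)\sum_{k\ge1}(k-1)p_kD_k,$$ which satisfies $\Delta_2(\alpha)Q'_\lambda=2C_1^{(\alpha)}(\lambda)Q'_\lambda$, and $\mathcal H_2(\alpha)$ is its Hall adjoint, with $\mathcal H_2(\alpha)P_\lambda^{(\alpha)}=2C_1^{(\alpha)}(\lambda)P_\lambda^{(\alpha)}$. Affine Yangian of $\mathfrak{gl}_1$ with parameters $h_1+h_2+h_3=0$, $\sigma_2=h_1h_2+h_1h_3+h_2h_3$, $\sigma_3=h_1h_2h_3$ (here $\sigma_3=\alpha(\alpha-1)$): generators $e_r,f_r,\psi_r$ ($r\ge0$), with $\psi(z)=1+\sigma_3\sum_{r\ge0}\psi_rz^{ -r-1}$,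 and relations $[\psi_r,\psi_s]=0$; $[e_r,f_s]=\psi_{r+s}$; $[\psi_0,e_j]=[\psi_1,e_j]=0$, $[\psi_2,e_j]=2e_j$; $[\psi_0,f_j]=[\psi_1,f_j]=0$, $[\psi_2,f_j]=-2f_j$; for $(x,y)=(e,e),(\psi,e)$ with sign $+$ and $(x,y)=(f,f),(\psi,f)$ with sign $-$, $$[x_{i+3},y_j]-3[x_{i+2},y_{j+1}]+3[x_{i+1},y_{j+2}]-[x_i,y_{j+3}]+\sigma_2\bigl([x_{i+1},y_j]-[x_i,y_{j+1}]\bigr)=\pm\sigma_3(x_iy_j+y_jx_i);$$ and the Serre relations $\mathrm{Sym}_{i_1,i_2,i_3}[e_{i_1},[e_{i_2},e_{i_3+1}]]=0$, likewise for $f$. In particular $[\psi_3,e_j]=6e_{j+1}+2\sigma_3\psi_0e_j$ and $[\psi_3,f_j]=-6f_{j+1}-2\sigma_3\psi_0f_j$. Fock representation: put $b_{ -k}=p_k$, $b_k=\frac1\alpha D_k$ ($k\ge1$), so that $[b_k,b_{ -l}]=\frac k\alpha\delta_{kl}=-\frac{k}{h_1h_2}\delta_{kl}$. In the one-boson Fock representation on $\Lambda$, $e_0$ acts as $b_{ -1}$ and $f_0$ as $-b_1$, and $\psi(z)$ acts diagonally; in the multiplication convention the eigenbasis is $(Q'_\lambda)$, with eigenvalue $$\Bigl(1+\frac{\sigma_3\psi_0}{z}\Bigr)\prod_{\square\in\lambda}\varphi\bigl(z-c_\alpha(\square)\bigr),\qquad \varphi(z)=\frac{(z+h_1)(z+h_2)(z+h_3)}{(z-h_1)(z-h_2)(z-h_3)},\qquad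 \psi_0=-\frac1{h_1h_2}.$$ -}

module Defs where

open import Algebra.Bundles.Raw using (RawRing)
open import Algebra.Module.Bundles.Raw using (RawLeftModule)
open import Algebra.Module.Morphism.Structures using (module LeftModuleMorphisms)
open import Data.Bool.Base using (if_then_else_)
open import Data.Integer.Base as ℤ using (ℤ; 0ℤ; 1ℤ; -1ℤ)
import Data.Integer.Properties as ℤ
open import Data.List.Base using (List; []; _∷_; [_]; _++_; map; concatMap; foldr; length; take; upTo; filter)
open import Data.List.Properties using (≡-dec)
open import Data.List.Relation.Unary.All as All using (All; []; _∷_)
open import Data.List.Relation.Unary.Linked using (Linked)
open import Data.List.Relation.Unary.Unique.Propositional using (Unique)
open import Data.Nat.Base as ℕ using (ℕ; zero; suc; _≤_; _<_; _≥_; _∸_)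
open import Data.Nat.ListAction using (sum)
import Data.Nat.Properties as ℕ
open import Data.Product.Base using (∃; _×_; _,_; proj₁; proj₂; map₁; map₂)
open import Data.Sum.Base using (inj₁; inj₂)
open import Function.Base using (_∘_; id)
open import Level using (0ℓ)
open import Relation.Binary.Definitions using (Decidable)
open import Relation.Binary.PropositionalEquality using (_≡_; _≢_; refl; sym; trans; cong; subst)
open import Relation.Nullary using (¬_; yes; no; does; contradiction)
import Data.List.Sort.InsertionSort.Base ℕ.≤-decTotalOrder as Sort

------------------------------------------------------------------------
-- Polynomials in α over ℤ: coefficient lists, constant term first.
-- Trailing zeros are allowed.

Poly : Set
Poly = List ℤ

infixl 6 _+ᴾ_
infixl 7 _*ᴾ_

_+ᴾ_ : Poly → Poly → Poly
[]       +ᴾ q        = q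
p@(_ ∷ _) +ᴾ []      = p
(a ∷ p)  +ᴾ (b ∷ q)  = a ℤ.+ b ∷ p +ᴾ q

-ᴾ_ : Poly → Poly
-ᴾ_ = map (λ a → ℤ.- a)

_*ᴾ_ : Poly → Poly → Poly
[]      *ᴾ q = []
(a ∷ p) *ᴾ q = map (a ℤ.*_) q +ᴾ (0ℤ ∷ p *ᴾ q)

IsZero : Poly → Set
IsZero = All (_≡ 0ℤ)

private
  +-cancelˡ-zero : ∀ p q → IsZero p → IsZero (p +ᴾ q) → IsZero q
  +-cancelˡ-zero []      q       _          zs       = zs
  +-cancelˡ-zero (a ∷ p) []      _          _        = []
  +-cancelˡ-zero (a ∷ p) (b ∷ q) (a≡0 ∷ zp) (z ∷ zs) =
    trans (sym (trans (cong (ℤ._+ b) a≡0) (ℤ.+-identityˡ b))) z ∷ +-cancelˡ-zero p q zp zs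

  map-zero : ∀ {a} → a ≡ 0ℤ → ∀ q → IsZero (map (a ℤ.*_) q)
  map-zero a≡0 []      = []
  map-zero a≡0 (b ∷ q) = trans (cong (ℤ._* b) a≡0) (ℤ.*-zeroˡ b) ∷ map-zero a≡0 q

  +ᴾ-identityʳ : ∀ p → p +ᴾ [] ≡ p
  +ᴾ-identityʳ []      = refl
  +ᴾ-identityʳ (_ ∷ _) = refl

  +ᴾ-assoc : ∀ p q r → p +ᴾ q +ᴾ r ≡ p +ᴾ (q +ᴾ r)
  +ᴾ-assoc []      q       r       = refl
  +ᴾ-assoc (a ∷ p) []      r       = refl
  +ᴾ-assoc (a ∷ p) (b ∷ q) []      = refl
  +ᴾ-assoc (a ∷ p) (b ∷ q) (c ∷ r) rewrite ℤ.+-assoc a b c | +ᴾ-assoc p q r = refl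

  -- p · (α q) = α (p · q), in the form that survives trailing zeros.
  *-shift : ∀ p {b} → b ≡ 0ℤ → ∀ q r → IsZero (r +ᴾ p *ᴾ (b ∷ q)) → IsZero (r +ᴾ (0ℤ ∷ p *ᴾ q))
  *-shift []          b≡0 q []      _        = refl ∷ []
  *-shift []          b≡0 q (c ∷ r) (z ∷ zs) =
    trans (ℤ.+-identityʳ c) z ∷ subst IsZero (sym (+ᴾ-identityʳ r)) zs
  *-shift (a ∷ p)     b≡0 q []      (_ ∷ zs) =
    refl ∷ *-shift p b≡0 q (map (a ℤ.*_) q) zs
  *-shift (a ∷ p) {b} b≡0 q (c ∷ r) (z ∷ zs) =
    trans (cong (ℤ._+_ c) (sym ab+0≡0)) z ∷
    subst IsZero (+ᴾ-assoc r _ _)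
      (*-shift p b≡0 q (r +ᴾ map (a ℤ.*_) q) (subst IsZero (sym (+ᴾ-assoc r _ _)) zs))
    where
    ab+0≡0 : a ℤ.* b ℤ.+ 0ℤ ≡ 0ℤ
    ab+0≡0 = trans (ℤ.+-identityʳ (a ℤ.* b)) (trans (cong (ℤ._*_ a) b≡0) (ℤ.*-zeroʳ a))

*ᴾ-nonzero : ∀ p q → ¬ IsZero p → ¬ IsZero q → ¬ IsZero (p *ᴾ q)
*ᴾ-nonzero []      q p≢0 q≢0 _ = p≢0 []
*ᴾ-nonzero (a ∷ p) q p≢0 q≢0 pq≡0 with a ℤ.≟ 0ℤ
... | yes a≡0 = *ᴾ-nonzero p q (λ p≡0 → p≢0 (a≡0 ∷ p≡0)) q≢0
                  (All.tail (+-cancelˡ-zero (map (a ℤ.*_) q) (0ℤ ∷ p *ᴾ q) (map-zero a≡0 q) pq≡0))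
... | no a≢0 = q≢0 (lowest q pq≡0)
  where
  lowest : ∀ q → IsZero ((a ∷ p) *ᴾ q) → IsZero q
  lowest []      _ = []
  lowest (b ∷ q) zs@(z ∷ _) with ℤ.i*j≡0⇒i≡0∨j≡0 a (trans (sym (ℤ.+-identityʳ (a ℤ.* b))) z)
  ... | inj₁ a≡0 = contradiction a≡0 a≢0
  ... | inj₂ b≡0 = b≡0 ∷ lowest q (All.tail (*-shift (a ∷ p) b≡0 q [] zs))

------------------------------------------------------------------------
-- ℚ(α), as the field of fractions of ℤ[α]

infix 4 _≈_
infix 8 -_
infixl 6 _+_ _-_
infixl 7 _*_

record ℚ⟨α⟩ : Set where
  constructor fraction
  field
    num   : Poly
    den   : Poly
    den≢0 : ¬ IsZero den

open ℚ⟨α⟩ public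

record _≈_ (x y : ℚ⟨α⟩) : Set where
  constructor cross-multiplied
  field
    difference≡0 : IsZero (num x *ᴾ den y +ᴾ -ᴾ (num y *ᴾ den x))

-- Opaque only to keep normalisation from expanding large fractions
opaque
  -_ : ℚ⟨α⟩ → ℚ⟨α⟩
  - x = fraction (-ᴾ num x) (den x) (den≢0 x)

  _+_ _*_ : ℚ⟨α⟩ → ℚ⟨α⟩ → ℚ⟨α⟩

  x + y = fraction (num x *ᴾ den y +ᴾ num y *ᴾ den x) (den x *ᴾ den y)
                   (*ᴾ-nonzero (den x) (den y) (den≢0 x) (den≢0 y))

  x * y = fraction (num x *ᴾ num y) (den x *ᴾ den y)
                   (*ᴾ-nonzero (den x) (den y) (den≢0 x) (den≢0 y))

_-_ : ℚ⟨α⟩ → ℚ⟨α⟩ → ℚ⟨α⟩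
x - y = x + - y

polynomial : Poly → ℚ⟨α⟩
polynomial p = fraction p [ 1ℤ ] λ { (() ∷ _) }

fromℕ : ℕ → ℚ⟨α⟩
fromℕ n = polynomial [ ℤ.+ n ]

0# 1# α : ℚ⟨α⟩
0# = fromℕ 0
1# = fromℕ 1
α  = polynomial (0ℤ ∷ 1ℤ ∷ [])

inverse : (x : ℚ⟨α⟩) → ¬ IsZero (num x) → ℚ⟨α⟩
inverse x x≢0 = fraction (den x) (num x) x≢0

α⁻¹ : ℚ⟨α⟩
α⁻¹ = inverse α λ { (_ ∷ () ∷ _) }

infixr 8 _^_
_^_ : ℚ⟨α⟩ → ℕ → ℚ⟨α⟩
x ^ zero  = 1#
x ^ suc n = x * x ^ n

Σᴷ : List ℚ⟨α⟩ → ℚ⟨α⟩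
Σᴷ = foldr _+_ 0#

------------------------------------------------------------------------
-- Λ = ℚ(α)[p₁, p₂, …]

-- A monomial is a word in the variables, the letter i standing for
-- p_{i+1}; words that are permutations of each other are the same
-- monomial.  The empty word is 1.
Monomial : Set
Monomial = List ℕ

SameMonomial : Monomial → Monomial → Set
SameMonomial u v = Sort.sort u ≡ Sort.sort v

sameMonomial? : Decidable SameMonomial
sameMonomial? u v = ≡-dec ℕ._≟_ (Sort.sort u) (Sort.sort v)

degree : Monomial → ℕ
degree = sum ∘ map suc

-- Formal sums of terms; equality compares all coefficients.
Λ : Set
Λ = List (ℚ⟨α⟩ × Monomial)

coefficient : Monomial → Λ → ℚ⟨α⟩
coefficient u f = Σᴷ (map (λ (c , v) → if does (sameMonomial? u v) then c else 0#) f)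

infix 4 _≈ᴸ_
infixl 6 _+ᴸ_
infixr 7 _·ᴸ_

_≈ᴸ_ : Λ → Λ → Set
f ≈ᴸ g = ∀ u → coefficient u f ≈ coefficient u g

_+ᴸ_ : Λ → Λ → Λ
_+ᴸ_ = _++_

_·ᴸ_ : ℚ⟨α⟩ → Λ → Λ
c ·ᴸ f = map (map₁ (c *_)) f

-ᴸ_ : Λ → Λ
-ᴸ_ = map (map₁ (λ c → - c))

0ᴸ : Λ
0ᴸ = []

monomial : Monomial → Λ
monomial u = [ (1# , u) ]

Λ-rawLeftModule : RawLeftModule ℚ⟨α⟩ 0ℓ 0ℓ
Λ-rawLeftModule = record
  { _≈ᴹ_ = _≈ᴸ_ ; _+ᴹ_ = _+ᴸ_ ; _*ₗ_ = _·ᴸ_ ; 0ᴹ = 0ᴸ ; -ᴹ_ = -ᴸ_ }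

------------------------------------------------------------------------

Operator : Set
Operator = Λ → Λ

open LeftModuleMorphisms Λ-rawLeftModule Λ-rawLeftModule public
  using () renaming (IsLeftModuleHomomorphism to IsLinear)

infix 4 _≗_
infixl 6 _⊕_ _⊖_
infixr 7 _⊙_

_≗_ : Operator → Operator → Set
A ≗ B = ∀ f → A f ≈ᴸ B f

_⊕_ _⊖_ ⟦_,_⟧ : Operator → Operator → Operator
(A ⊕ B) f = A f +ᴸ B f
(A ⊖ B) f = A f +ᴸ -ᴸ B f
⟦ A , B ⟧ = A ∘ B ⊖ B ∘ A

_⊙_ : ℚ⟨α⟩ → Operator → Operator
(c ⊙ A) f = c ·ᴸ A f

𝟘 : Operator
𝟘 _ = 0ᴸ

linearExtension : (Monomial → Λ) → Operator
linearExtension F = concatMap (λ (c , u) → c ·ᴸ F u)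

-- Multiplication by p_k.  There is no variable p₀; p 0 is a dummy.
p : ℕ → Operator
p zero    = 𝟘
p (suc i) = map (map₂ (i ∷_))

-- ∂/∂p_k, by the Leibniz rule along the word
∂ : ℕ → Operator
∂ k = linearExtension ∂-word
  where
  ∂-word : Monomial → Λ
  ∂-word []      = 0ᴸ
  ∂-word (i ∷ u) = (if does (k ℕ.≟ suc i) then monomial u else 0ᴸ) +ᴸ p (suc i) (∂-word u)

D : ℕ → Operator
D k = fromℕ k ⊙ ∂ k

-- ∑ A is the locally finite sum Σ_{k≥1} A k, for operators A k that
-- vanish on monomials of degree < k.  This holds for every sum below,
-- because A k contains a derivation D_l with l ≥ k.
∑ : (ℕ → Operator) → Operator
∑ A = linearExtension λ u → concatMap (λ i → A (suc i) (monomial u)) (upTo (degree u))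

E : Operator
E = ∑ λ k → p k ∘ D k

Δ₂ : Operator
Δ₂ = α ⊙ (∑ λ i → ∑ λ j → p i ∘ p j ∘ D (i ℕ.+ j))
   ⊕ (∑ λ i → ∑ λ j → p (i ℕ.+ j) ∘ D i ∘ D j)
   ⊕ (α - 1#) ⊙ (∑ λ k → fromℕ (k ∸ 1) ⊙ p k ∘ D k)

------------------------------------------------------------------------

-- z = ∏ k^{m_k} m_k!, built up one part at a time: adjoining a part k
-- whose new multiplicity is m multiplies z by k · m.
z : Monomial → ℕ
z []      = 1
z (i ∷ u) = suc i ℕ.* suc (length (filter (i ℕ.≟_) u)) ℕ.* z u

-- The bilinear form with ⟨u , v⟩ = δ_{uv} w(u) on monomials
bilinear : (Monomial → ℚ⟨α⟩) → Λ → Λ → ℚ⟨α⟩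
bilinear w f g =
  Σᴷ (map (λ (c , u) →
    Σᴷ (map (λ (d , v) → if does (sameMonomial? u v) then c * d * w u else 0#) g)) f)

⟨_,_⟩Hall ⟨_,_⟩α : Λ → Λ → ℚ⟨α⟩
⟨ f , g ⟩Hall = bilinear (λ u → fromℕ (z u)) f g
⟨ f , g ⟩α    = bilinear (λ u → fromℕ (z u) * α ^ length u) f g

IsHallAdjoint : Operator → Operator → Set
IsHallAdjoint A A† = ∀ f g → ⟨ A f , g ⟩Hall ≈ ⟨ f , A† g ⟩Hall

------------------------------------------------------------------------

record Partition : Set where
  constructor partition
  field
    parts       : List ℕ
    .positive   : All (0 <_) parts
    .decreasing : Linked _≥_ parts

open Partition public

∣_∣ : Partition → ℕ
∣ lam ∣ = sum (parts lam)

infix 4 _⊴_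
_⊴_ : Partition → Partition → Set
mu ⊴ lam = ∣ mu ∣ ≡ ∣ lam ∣ × (∀ n → sum (take n (parts mu)) ≤ sum (take n (parts lam)))

-- Boxes are (row , column) pairs counted from 0, so that
-- c_α(i , j) = α j − i.
Box : Set
Box = ℕ × ℕ

boxes : Partition → List Box
boxes lam = rows 0 (parts lam)
  where
  rows : ℕ → List ℕ → List Box
  rows i []       = []
  rows i (l ∷ ls) = map (i ,_) (upTo l) ++ rows (suc i) ls

content : Box → ℚ⟨α⟩
content (i , j) = α * fromℕ j - fromℕ i

C₁ : Partition → ℚ⟨α⟩
C₁ lam = Σᴷ (map content (boxes lam))

------------------------------------------------------------------------

-- Under p_k = x₁^k + ⋯ + x_n^k, multiplying by p_k contributes to the
-- coefficient of x^β the coefficients of x^{β − k ε_j} with β_j ≥ k.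
lower : ℕ → List ℕ → List (List ℕ)
lower k []      = []
lower k (b ∷ β) = (if does (k ℕ.≤? b) then [ b ∸ k ∷ β ] else []) ++ map (b ∷_) (lower k β)

-- The coefficient of x^β in a product of power sums in n = length β
-- variables
xCoefficient : Monomial → List ℕ → ℕ
xCoefficient []      β = if does (All.all? (ℕ._≟ 0) β) then 1 else 0
xCoefficient (i ∷ u) β = sum (map (xCoefficient u) (lower (suc i) β))

-- The coefficient of the monomial symmetric function m_λ, which is the
-- coefficient of x₁^λ₁ ⋯ x_n^λ_n
mCoefficient : Partition → Λ → ℚ⟨α⟩
mCoefficient lam f = Σᴷ (map (λ (c , u) → c * fromℕ (xCoefficient u (parts lam))) f)

-- P_λ = m_λ + Σ_{μ < λ} a_{λμ} m_μ, orthogonal for ⟨ , ⟩_α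
record IsMonicJack (P : Partition → Λ) : Set where
  field
    monic      : ∀ lam → mCoefficient lam (P lam) ≈ 1#
    triangular : ∀ lam mu → ¬ mu ⊴ lam → mCoefficient mu (P lam) ≈ 0#
    orthogonal : ∀ lam mu → lam ≢ mu → ⟨ P lam , P mu ⟩α ≈ 0#

combination : (Partition → Λ) → List (ℚ⟨α⟩ × Partition) → Λ
combination v = concatMap (λ (c , lam) → c ·ᴸ v lam)

record IsBasis (v : Partition → Λ) : Set where
  field
    spanning    : ∀ f → ∃ λ cs → f ≈ᴸ combination v cs
    independent : ∀ cs → Unique (map proj₂ cs) → combination v cs ≈ᴸ 0ᴸ → All (λ (c , _) → c ≈ 0#) cs

record IsHallDualBasis (P Q : Partition → Λ) : Set where
  field
    isBasis  : IsBasis Q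
    dual-one : ∀ lam → ⟨ P lam , Q lam ⟩Hall ≈ 1#
    dual-off : ∀ lam mu → lam ≢ mu → ⟨ P lam , Q mu ⟩Hall ≈ 0#

------------------------------------------------------------------------

record Parameters : Set where
  field
    h₁ h₂ h₃ : ℚ⟨α⟩
    h-sum    : h₁ + h₂ + h₃ ≈ 0#

  σ₂ σ₃ : ℚ⟨α⟩
  σ₂ = h₁ * h₂ + h₁ * h₃ + h₂ * h₃
  σ₃ = h₁ * h₂ * h₃

cubic : ℚ⟨α⟩ → (x y : ℕ → Operator) → ℕ → ℕ → Operator
cubic σ₂ x y i j =
    ⟦ x (3 ℕ.+ i) , y j ⟧
  ⊖ fromℕ 3 ⊙ ⟦ x (2 ℕ.+ i) , y (1 ℕ.+ j) ⟧
  ⊕ fromℕ 3 ⊙ ⟦ x (1 ℕ.+ i) , y (2 ℕ.+ j) ⟧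
  ⊖ ⟦ x i , y (3 ℕ.+ j) ⟧
  ⊕ σ₂ ⊙ (⟦ x (1 ℕ.+ i) , y j ⟧ ⊖ ⟦ x i , y (1 ℕ.+ j) ⟧)

anticommutator : (x y : ℕ → Operator) → ℕ → ℕ → Operator
anticommutator x y i j = x i ∘ y j ⊕ y j ∘ x i

serre : (ℕ → Operator) → ℕ → ℕ → ℕ → Operator
serre x i₁ i₂ i₃ = s i₁ i₂ i₃ ⊕ s i₁ i₃ i₂ ⊕ s i₂ i₁ i₃ ⊕ s i₂ i₃ i₁ ⊕ s i₃ i₁ i₂ ⊕ s i₃ i₂ i₁
  where
  s : ℕ → ℕ → ℕ → Operator
  s a b c = ⟦ x a , ⟦ x b , x (suc c) ⟧ ⟧

-- The operators e r, f r, ψ r on Λ satisfy the defining relations of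
-- the affine Yangian, i.e. define a representation of it.
record IsYangianRepresentation (h : Parameters) (e f ψ : ℕ → Operator) : Set where
  open Parameters h

  field
    e-linear : ∀ r → IsLinear (e r)
    f-linear : ∀ r → IsLinear (f r)
    ψ-linear : ∀ r → IsLinear (ψ r)

    ψψ : ∀ r s → ⟦ ψ r , ψ s ⟧ ≗ 𝟘
    ef : ∀ r s → ⟦ e r , f s ⟧ ≗ ψ (r ℕ.+ s)

    ψ₀e : ∀ j → ⟦ ψ 0 , e j ⟧ ≗ 𝟘
    ψ₁e : ∀ j → ⟦ ψ 1 , e j ⟧ ≗ 𝟘
    ψ₂e : ∀ j → ⟦ ψ 2 , e j ⟧ ≗ fromℕ 2 ⊙ e j
    ψ₀f : ∀ j → ⟦ ψ 0 , f j ⟧ ≗ 𝟘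
    ψ₁f : ∀ j → ⟦ ψ 1 , f j ⟧ ≗ 𝟘
    ψ₂f : ∀ j → ⟦ ψ 2 , f j ⟧ ≗ - fromℕ 2 ⊙ f j

    cubic-ee : ∀ i j → cubic σ₂ e e i j ≗ σ₃ ⊙ anticommutator e e i j
    cubic-ψe : ∀ i j → cubic σ₂ ψ e i j ≗ σ₃ ⊙ anticommutator ψ e i j
    cubic-ff : ∀ i j → cubic σ₂ f f i j ≗ - σ₃ ⊙ anticommutator f f i j
    cubic-ψf : ∀ i j → cubic σ₂ ψ f i j ≗ - σ₃ ⊙ anticommutator ψ f i j

    serre-e : ∀ i₁ i₂ i₃ → serre e i₁ i₂ i₃ ≗ 𝟘
    serre-f : ∀ i₁ i₂ i₃ → serre f i₁ i₂ i₃ ≗ 𝟘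

------------------------------------------------------------------------
-- Formal power series in z⁻¹: F n is the coefficient of z⁻ⁿ.

Series : Set
Series = ℕ → ℚ⟨α⟩

infixl 7 _⊛_
_⊛_ : Series → Series → Series
(F ⊛ G) n = Σᴷ (map (λ k → F k * G (n ∸ k)) (upTo (suc n)))

1ˢ : Series
1ˢ zero    = 1#
1ˢ (suc _) = 0#

1+_/z : ℚ⟨α⟩ → Series
(1+ a /z) zero          = 1#
(1+ a /z) (suc zero)    = a
(1+ a /z) (suc (suc _)) = 0#

-- 1 / (1 − a z⁻¹)
1/1-_/z : ℚ⟨α⟩ → Series
(1/1- a /z) n = a ^ n

-- (z + a) / (z − b), expanded at z = ∞
[z+_]/[z-_] : ℚ⟨α⟩ → ℚ⟨α⟩ → Series
[z+ a ]/[z- b ] = 1+ a /z ⊛ 1/1- b /z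

------------------------------------------------------------------------

private
  opaque
    unfolding _+_

    h-sum≈0 : α + - 1# + (1# - α) ≈ 0#
    h-sum≈0 = cross-multiplied (refl ∷ refl ∷ [])

    h₁h₂≢0 : ¬ IsZero (num (α * - 1#))
    h₁h₂≢0 (_ ∷ () ∷ _)

fockParameters : Parameters
fockParameters = record
  { h₁ = α ; h₂ = - 1# ; h₃ = 1# - α ; h-sum = h-sum≈0 }

open Parameters fockParameters public

-- ψ₀ = −1/(h₁h₂)
vacuumCharge : ℚ⟨α⟩
vacuumCharge = - inverse (h₁ * h₂) h₁h₂≢0

φ-shifted : ℚ⟨α⟩ → Series
φ-shifted c = factor h₁ ⊛ factor h₂ ⊛ factor h₃
  where
  factor : ℚ⟨α⟩ → Series
  factor h = [z+ h - c ]/[z- h + c ]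

-- (1 + σ₃ψ₀/z) ∏_{□ ∈ λ} φ(z − c_α(□))
ψ-eigenvalue : Partition → Series
ψ-eigenvalue lam =
  1+ σ₃ * vacuumCharge /z ⊛ foldr _⊛_ 1ˢ (map (φ-shifted ∘ content) (boxes lam))

-- The coefficient of z⁻ⁿ in ψ(z) = 1 + σ₃ Σ_{r≥0} ψ_r z^{−r−1}
ψ-series : (ℕ → Operator) → ℕ → Operator
ψ-series ψ zero    = id
ψ-series ψ (suc r) = σ₃ ⊙ ψ r

b₋ b₊ : ℕ → Operator
b₋ k = p k
b₊ k = α⁻¹ ⊙ D k

record IsFockRepresentation (Q′ : Partition → Λ) (e f ψ : ℕ → Operator) : Set where
  field
    isRepresentation : IsYangianRepresentation fockParameters e f ψ
    e₀-action        : e 0 ≗ b₋ 1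
    f₀-action        : f 0 ≗ - 1# ⊙ b₊ 1
    ψ-action         : ∀ lam n → ψ-series ψ n (Q′ lam) ≈ᴸ ψ-eigenvalue lam n ·ᴸ Q′ lam

{-# OPTIONS --safe #-}
module Submission where

-- The eigenvalues of ψ₀, …, ψ₃ on Q′_λ are read off the expansion of ψ(z),
-- so ψ₂ = 2E and the formula for ψ₃ follow once E and Δ₂ are known to be
-- diagonal on Q′.  Let M_{κλ} be the coefficient of m_κ in P_λ.  As
-- the coefficient of m_κ in f is ⟨f , h_κ⟩, h_κ = Σ_λ M_{κλ} Q′_λ is
-- unitriangular for dominance.  Applying the second order operator Δ₂ to
-- the product h_κ gives 2C₁(κ) h_κ plus multiples of h_γ with γ obtained
-- from κ by moving boxes upwards, because Γ(h_m , h_n) = Σ p_{i+j} h_{m−i} h_{n−j}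
-- satisfies
--   Γ(h_m , h_{n+1}) = Γ(h_{m+1} , h_n) + (m+1) h_{m+1} h_n − (n+1) h_m h_{n+1}.
-- Hence Δ₂ is triangular on Q′.  If θ multiplies p_μ by α^{ℓ(μ)}, then
-- ⟨f , g⟩_α = ⟨f , θ g⟩, so θ P_λ is a nonzero multiple of Q′_λ, and
-- ⟨f , Δ₂ θ g⟩ is symmetric in f and g; a triangular operator with a
-- symmetric matrix is diagonal.  Finally e₁ and f₁ are obtained from
-- [ψ₃ , e₀] and [ψ₃ , f₀] by the cubic relations at i = j = 0.

open import Data.Nat.Base using (ℕ; suc)
open import Data.Product.Base using (_×_)
open import Function.Base using (_∘_; id)
open import Defs

open import Algebra.Bundles using (CommutativeRing)
open import Algebra.Module.Morphism.Structures using (module LeftModuleMorphisms)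
import Algebra.Solver.Ring
open import Algebra.Solver.Ring.AlmostCommutativeRing using (fromCommutativeRing; _-Raw-AlmostCommutative⟶_)
open import Algebra.Structures using (IsCommutativeRing)
open import Data.Bool.Base using (true; false; if_then_else_)
open import Data.Integer.Base as ℤ using (ℤ; 0ℤ; 1ℤ; -1ℤ)
import Data.Integer.Properties as ℤ
open import Data.List.Base using (List; []; _∷_; [_]; map; _++_; concatMap; length; filter; foldr; take; upTo; applyUpTo)
import Data.List.Properties as List
open import Data.List.Relation.Binary.Permutation.Propositional as ↭ using (_↭_; ↭-sym; ↭-trans; prep; swap)
import Data.List.Relation.Binary.Permutation.Propositional.Properties as ↭ₚ
open import Data.List.Relation.Binary.Pointwise using (Pointwise-≡⇒≡)
open import Data.List.Relation.Unary.All as All using (All; []; _∷_)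
import Data.List.Relation.Unary.All.Properties as All
open import Data.List.Relation.Unary.Sorted.TotalOrder.Properties using (↗↭↗⇒≋)
import Data.List.Sort.InsertionSort.Base
import Data.List.Sort.InsertionSort.Properties
open import Data.Maybe.Base using (Maybe; just; nothing)
open import Data.Nat.Base as ℕ using (zero; _≤_; _<_; z≤n; s≤s; _∸_)
open import Data.Nat.Induction using (<-wellFounded)
open import Data.Nat.ListAction using (sum)
open import Data.Nat.ListAction.Properties using (sum-↭)
import Data.Nat.Properties as ℕ
open import Data.Product.Base using (∃; _,_; map₁; map₂)
open import Data.Sum.Base using (_⊎_; inj₁; inj₂)
open import Induction.WellFounded using (Acc; acc)
open import Level using (0ℓ)
open import Relation.Binary.Bundles using (DecTotalOrder)
import Relation.Binary.Construct.Flip.EqAndOrd as Flip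
open import Relation.Binary.PropositionalEquality as ≡ using (_≡_; _≢_; cong; cong₂; module ≡-Reasoning)
import Relation.Binary.Reasoning.Setoid as SetoidReasoning
open import Relation.Binary.Structures using (IsEquivalence)
open import Relation.Nullary using (¬_; yes; no; contradiction; recompute; Dec; does)
open import Relation.Nullary.Decidable using (map′; dec-true; dec-false; decidable-stable)

-- The field ℚ(α)

-- `IsFockRepresentation` prescribes only the eigenvalues of ψ(z), so that Δ₂ is diagonal on Q′ has
-- to be derived from the orthogonality and triangularity that define Jack functions.
--
-- The obstacle is to state triangularity without carrying expansion coefficients and index sets. It
-- is expressed by linear functionals: T h_κ is d(κ) h_κ modulo certain h_γ when F (T h_κ) = d(κ) F
-- (h_κ) for every linear F that kills those h_γ. Composing F with multiplication by some h_n gives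
-- again such a functional, so induction over the rows of κ goes through, and F = ⟨P_μ , -⟩ turns
-- the result into a statement about matrix entries.
--
-- Iterating the relation for Γ moves boxes in one direction only, and this gives the part -(i-1) of
-- the content; the part α(j-1) comes from a single row.
--
-- Dominance is a partial order. The entry ⟨P_μ , T Q′_λ⟩ vanishes unless λ ⊴ μ, and by symmetry
-- unless μ ⊴ λ, so incomparable pairs cause no trouble.
--
-- The sums over all k ≥ 1 are handled by truncation at a level N that is common to all elements in
-- an identity.

coeff : Poly → ℕ → ℤ
coeff []      n       = 0ℤ
coeff (a ∷ p) zero    = a
coeff (a ∷ p) (suc n) = coeff p n

-- Trailing zeros give one polynomial many lists, so equality is tested on coefficients. The record
-- keeps both lists recoverable by unification.
infix 4 _≃_
record _≃_ (p q : Poly) : Set where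
  constructor coefficientwise
  field
    at : ∀ n → coeff p n ≡ coeff q n
open _≃_

coeff-+ : ∀ p q n → coeff (p +ᴾ q) n ≡ coeff p n ℤ.+ coeff q n
coeff-+ []      q       n       = ≡.sym (ℤ.+-identityˡ _)
coeff-+ (a ∷ p) []      n       = ≡.sym (ℤ.+-identityʳ _)
coeff-+ (a ∷ p) (b ∷ q) zero    = ≡.refl
coeff-+ (a ∷ p) (b ∷ q) (suc n) = coeff-+ p q n

coeff-neg : ∀ p n → coeff (-ᴾ p) n ≡ ℤ.- coeff p n
coeff-neg []      n       = ≡.refl
coeff-neg (a ∷ p) zero    = ≡.refl
coeff-neg (a ∷ p) (suc n) = coeff-neg p n

coeff-scale : ∀ a p n → coeff (map (a ℤ.*_) p) n ≡ a ℤ.* coeff p n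
coeff-scale a []      n       = ≡.sym (ℤ.*-zeroʳ a)
coeff-scale a (b ∷ p) zero    = ≡.refl
coeff-scale a (b ∷ p) (suc n) = coeff-scale a p n

IsZero⇒≃ : ∀ {p} → IsZero p → p ≃ []
IsZero⇒≃ z = coefficientwise (go z)
  where
  go : ∀ {p} → IsZero p → ∀ n → coeff p n ≡ 0ℤ
  go []       n       = ≡.refl
  go (e ∷ _)  zero    = e
  go (_ ∷ zs) (suc n) = go zs n

≃⇒IsZero : ∀ {p} → p ≃ [] → IsZero p
≃⇒IsZero {[]}    e = []
≃⇒IsZero {a ∷ p} e = at e 0 ∷ ≃⇒IsZero (coefficientwise (at e ∘ suc))

+ᴾ-cong : ∀ {p p′ q q′} → p ≃ p′ → q ≃ q′ → p +ᴾ q ≃ p′ +ᴾ q′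
+ᴾ-cong {p} {p′} {q} {q′} e f = coefficientwise λ n →
  ≡.trans (coeff-+ p q n) (≡.trans (cong₂ ℤ._+_ (at e n) (at f n)) (≡.sym (coeff-+ p′ q′ n)))

-ᴾ-cong : ∀ {p p′} → p ≃ p′ → -ᴾ p ≃ -ᴾ p′
-ᴾ-cong {p} {p′} e = coefficientwise λ n →
  ≡.trans (coeff-neg p n) (≡.trans (cong ℤ.-_ (at e n)) (≡.sym (coeff-neg p′ n)))

private
  interchange : ∀ a b c d → (a ℤ.+ b) ℤ.+ (c ℤ.+ d) ≡ (a ℤ.+ c) ℤ.+ (b ℤ.+ d)
  interchange a b c d = begin
    (a ℤ.+ b) ℤ.+ (c ℤ.+ d)  ≡⟨ ℤ.+-assoc a b _ ⟩
    a ℤ.+ (b ℤ.+ (c ℤ.+ d))  ≡⟨ cong (ℤ._+_ a) (≡.sym (ℤ.+-assoc b c d)) ⟩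
    a ℤ.+ ((b ℤ.+ c) ℤ.+ d)  ≡⟨ cong (λ x → a ℤ.+ (x ℤ.+ d)) (ℤ.+-comm b c) ⟩
    a ℤ.+ ((c ℤ.+ b) ℤ.+ d)  ≡⟨ cong (ℤ._+_ a) (ℤ.+-assoc c b d) ⟩
    a ℤ.+ (c ℤ.+ (b ℤ.+ d))  ≡⟨ ℤ.+-assoc a c _ ⟨
    (a ℤ.+ c) ℤ.+ (b ℤ.+ d)  ∎
    where open ≡-Reasoning

-- The shifted product stays one list under `coeff`, so most ring laws follow without a case split
-- on n.
coeff-* : ∀ a p q n → coeff ((a ∷ p) *ᴾ q) n ≡ a ℤ.* coeff q n ℤ.+ coeff (0ℤ ∷ p *ᴾ q) n
coeff-* a p q n = ≡.trans (coeff-+ (map (a ℤ.*_) q) _ n) (cong (ℤ._+ _) (coeff-scale a q n))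

coeff-shift-+ : ∀ p q n → coeff (0ℤ ∷ p +ᴾ q) n ≡ coeff (0ℤ ∷ p) n ℤ.+ coeff (0ℤ ∷ q) n
coeff-shift-+ p q zero    = ≡.refl
coeff-shift-+ p q (suc n) = coeff-+ p q n

shift-cong : ∀ {p q} → p ≃ q → 0ℤ ∷ p ≃ 0ℤ ∷ q
shift-cong e = coefficientwise λ { zero → ≡.refl ; (suc n) → at e n }

*ᴾ-congʳ : ∀ p {q q′} → q ≃ q′ → p *ᴾ q ≃ p *ᴾ q′
*ᴾ-congʳ []      e = coefficientwise λ _ → ≡.refl
*ᴾ-congʳ (a ∷ p) {q} {q′} e = coefficientwise λ n →
  ≡.trans (coeff-* a p q n)
    (≡.trans (cong₂ ℤ._+_ (cong (a ℤ.*_) (at e n)) (at (shift-cong (*ᴾ-congʳ p e)) n))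
             (≡.sym (coeff-* a p q′ n)))

*ᴾ-zeroʳ : ∀ p → p *ᴾ [] ≃ []
*ᴾ-zeroʳ []      = coefficientwise λ _ → ≡.refl
*ᴾ-zeroʳ (a ∷ p) = coefficientwise λ { zero → ≡.refl ; (suc n) → at (*ᴾ-zeroʳ p) n }

-- The product recurses on its left factor. This is the mirrored recursion, from which commutativity
-- follows by induction on the right factor.
*ᴾ-consʳ : ∀ p b q n → coeff (p *ᴾ (b ∷ q)) n ≡ b ℤ.* coeff p n ℤ.+ coeff (0ℤ ∷ p *ᴾ q) n
*ᴾ-consʳ []      b q zero    = ≡.sym (≡.trans (ℤ.+-identityʳ _) (ℤ.*-zeroʳ b))
*ᴾ-consʳ []      b q (suc n) = ≡.sym (≡.trans (ℤ.+-identityʳ _) (ℤ.*-zeroʳ b))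
*ᴾ-consʳ (a ∷ p) b q zero    = cong (ℤ._+ 0ℤ) (ℤ.*-comm a b)
*ᴾ-consʳ (a ∷ p) b q (suc n) = begin
  coeff (map (a ℤ.*_) q +ᴾ p *ᴾ (b ∷ q)) n            ≡⟨ coeff-+ (map (a ℤ.*_) q) _ n ⟩
  coeff (map (a ℤ.*_) q) n ℤ.+ coeff (p *ᴾ (b ∷ q)) n ≡⟨ cong₂ ℤ._+_ (coeff-scale a q n) (*ᴾ-consʳ p b q n) ⟩
  a ℤ.* coeff q n ℤ.+ (b ℤ.* coeff p n ℤ.+ r)         ≡⟨ ℤ.+-assoc (a ℤ.* coeff q n) _ r ⟨
  (a ℤ.* coeff q n ℤ.+ b ℤ.* coeff p n) ℤ.+ r         ≡⟨ cong (ℤ._+ r) (ℤ.+-comm (a ℤ.* coeff q n) _) ⟩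
  (b ℤ.* coeff p n ℤ.+ a ℤ.* coeff q n) ℤ.+ r         ≡⟨ ℤ.+-assoc (b ℤ.* coeff p n) _ r ⟩
  b ℤ.* coeff p n ℤ.+ (a ℤ.* coeff q n ℤ.+ r)         ≡⟨ cong (ℤ._+_ (b ℤ.* coeff p n)) (coeff-* a p q n) ⟨
  b ℤ.* coeff p n ℤ.+ coeff ((a ∷ p) *ᴾ q) n          ∎
  where
  open ≡-Reasoning
  r = coeff (0ℤ ∷ p *ᴾ q) n

*ᴾ-comm : ∀ p q → p *ᴾ q ≃ q *ᴾ p
*ᴾ-comm p []      = *ᴾ-zeroʳ p
*ᴾ-comm p (b ∷ q) = coefficientwise λ n →
  ≡.trans (*ᴾ-consʳ p b q n)
    (≡.trans (cong (ℤ._+_ (b ℤ.* coeff p n)) (at (shift-cong (*ᴾ-comm p q)) n)) (≡.sym (coeff-* b q p n)))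

≃-trans : ∀ {p q r} → p ≃ q → q ≃ r → p ≃ r
≃-trans e f = coefficientwise λ n → ≡.trans (at e n) (at f n)

≃-sym : ∀ {p q} → p ≃ q → q ≃ p
≃-sym e = coefficientwise λ n → ≡.sym (at e n)

≃-refl : ∀ {p} → p ≃ p
≃-refl = coefficientwise λ _ → ≡.refl

*ᴾ-cong : ∀ {p p′ q q′} → p ≃ p′ → q ≃ q′ → p *ᴾ q ≃ p′ *ᴾ q′
*ᴾ-cong {p} {p′} {q} {q′} e f =
  ≃-trans (*ᴾ-congʳ p f) (≃-trans (*ᴾ-comm p q′) (≃-trans (*ᴾ-congʳ q′ e) (*ᴾ-comm q′ p′)))

*ᴾ-distribˡ : ∀ p q r → p *ᴾ (q +ᴾ r) ≃ p *ᴾ q +ᴾ p *ᴾ r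
*ᴾ-distribˡ []      q r = ≃-refl
*ᴾ-distribˡ (a ∷ p) q r = coefficientwise λ n → begin
  coeff ((a ∷ p) *ᴾ (q +ᴾ r)) n
    ≡⟨ coeff-* a p (q +ᴾ r) n ⟩
  a ℤ.* coeff (q +ᴾ r) n ℤ.+ coeff (0ℤ ∷ p *ᴾ (q +ᴾ r)) n
    ≡⟨ cong₂ ℤ._+_ (≡.trans (cong (a ℤ.*_) (coeff-+ q r n)) (ℤ.*-distribˡ-+ a (coeff q n) (coeff r n)))
         (≡.trans (at (shift-cong (*ᴾ-distribˡ p q r)) n) (coeff-shift-+ (p *ᴾ q) (p *ᴾ r) n)) ⟩
  (a ℤ.* coeff q n ℤ.+ a ℤ.* coeff r n) ℤ.+ (coeff (0ℤ ∷ p *ᴾ q) n ℤ.+ coeff (0ℤ ∷ p *ᴾ r) n)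
    ≡⟨ interchange (a ℤ.* coeff q n) _ _ _ ⟩
  (a ℤ.* coeff q n ℤ.+ coeff (0ℤ ∷ p *ᴾ q) n) ℤ.+ (a ℤ.* coeff r n ℤ.+ coeff (0ℤ ∷ p *ᴾ r) n)
    ≡⟨ cong₂ ℤ._+_ (coeff-* a p q n) (coeff-* a p r n) ⟨
  coeff ((a ∷ p) *ᴾ q) n ℤ.+ coeff ((a ∷ p) *ᴾ r) n
    ≡⟨ coeff-+ ((a ∷ p) *ᴾ q) _ n ⟨
  coeff ((a ∷ p) *ᴾ q +ᴾ (a ∷ p) *ᴾ r) n ∎
  where open ≡-Reasoning

*ᴾ-distribʳ : ∀ r p q → (p +ᴾ q) *ᴾ r ≃ p *ᴾ r +ᴾ q *ᴾ r
*ᴾ-distribʳ r p q = ≃-trans (*ᴾ-comm (p +ᴾ q) r)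
  (≃-trans (*ᴾ-distribˡ r p q) (+ᴾ-cong (*ᴾ-comm r p) (*ᴾ-comm r q)))

scale-*ᴾ : ∀ a q r → map (a ℤ.*_) q *ᴾ r ≃ map (a ℤ.*_) (q *ᴾ r)
scale-*ᴾ a []      r = ≃-refl
scale-*ᴾ a (b ∷ q) r = coefficientwise λ n → begin
  coeff ((a ℤ.* b ∷ map (a ℤ.*_) q) *ᴾ r) n
    ≡⟨ coeff-* (a ℤ.* b) (map (a ℤ.*_) q) r n ⟩
  a ℤ.* b ℤ.* coeff r n ℤ.+ coeff (0ℤ ∷ map (a ℤ.*_) q *ᴾ r) n
    ≡⟨ cong₂ ℤ._+_ (ℤ.*-assoc a b (coeff r n)) (≡.trans (at (shift-cong (scale-*ᴾ a q r)) n) (shifted n)) ⟩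
  a ℤ.* (b ℤ.* coeff r n) ℤ.+ a ℤ.* coeff (0ℤ ∷ q *ᴾ r) n
    ≡⟨ ℤ.*-distribˡ-+ a (b ℤ.* coeff r n) _ ⟨
  a ℤ.* (b ℤ.* coeff r n ℤ.+ coeff (0ℤ ∷ q *ᴾ r) n)
    ≡⟨ cong (a ℤ.*_) (coeff-* b q r n) ⟨
  a ℤ.* coeff ((b ∷ q) *ᴾ r) n
    ≡⟨ coeff-scale a ((b ∷ q) *ᴾ r) n ⟨
  coeff (map (a ℤ.*_) ((b ∷ q) *ᴾ r)) n ∎
  where
  open ≡-Reasoning
  shifted : ∀ n → coeff (0ℤ ∷ map (a ℤ.*_) (q *ᴾ r)) n ≡ a ℤ.* coeff (0ℤ ∷ q *ᴾ r) n
  shifted zero    = ≡.sym (ℤ.*-zeroʳ a)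
  shifted (suc n) = coeff-scale a (q *ᴾ r) n

shift-*ᴾ : ∀ p q → (0ℤ ∷ p) *ᴾ q ≃ 0ℤ ∷ p *ᴾ q
shift-*ᴾ p q = coefficientwise λ n →
  ≡.trans (coeff-* 0ℤ p q n) (≡.trans (cong (ℤ._+ coeff (0ℤ ∷ p *ᴾ q) n) (ℤ.*-zeroˡ (coeff q n))) (ℤ.+-identityˡ _))

*ᴾ-assoc : ∀ p q r → (p *ᴾ q) *ᴾ r ≃ p *ᴾ (q *ᴾ r)
*ᴾ-assoc []      q r = ≃-refl
*ᴾ-assoc (a ∷ p) q r = ≃-trans (*ᴾ-distribʳ r (map (a ℤ.*_) q) (0ℤ ∷ p *ᴾ q))
  (+ᴾ-cong (scale-*ᴾ a q r) (≃-trans (shift-*ᴾ (p *ᴾ q) r) (shift-cong (*ᴾ-assoc p q r))))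

*ᴾ-identityˡ : ∀ p → [ 1ℤ ] *ᴾ p ≃ p
*ᴾ-identityˡ p = coefficientwise λ n → ≡.trans (coeff-* 1ℤ [] p n)
  (≡.trans (cong₂ ℤ._+_ (ℤ.*-identityˡ (coeff p n)) (zeros n)) (ℤ.+-identityʳ _))
  where
  zeros : ∀ n → coeff (0ℤ ∷ []) n ≡ 0ℤ
  zeros zero    = ≡.refl
  zeros (suc n) = ≡.refl

Poly-isCommutativeRing : IsCommutativeRing _≃_ _+ᴾ_ _*ᴾ_ -ᴾ_ [] [ 1ℤ ]
Poly-isCommutativeRing = record
  { isRing = record
    { +-isAbelianGroup = record
      { isGroup = record
        { isMonoid = record
          { isSemigroup = record
            { isMagma = record
              { isEquivalence = record { refl = ≃-refl ; sym = ≃-sym ; trans = ≃-trans }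
              ; ∙-cong = +ᴾ-cong
              }
            ; assoc = λ p q r → coefficientwise λ n → begin
                coeff (p +ᴾ q +ᴾ r) n                       ≡⟨ coeff-+ (p +ᴾ q) r n ⟩
                coeff (p +ᴾ q) n ℤ.+ coeff r n              ≡⟨ cong (ℤ._+ _) (coeff-+ p q n) ⟩
                coeff p n ℤ.+ coeff q n ℤ.+ coeff r n       ≡⟨ ℤ.+-assoc (coeff p n) _ _ ⟩
                coeff p n ℤ.+ (coeff q n ℤ.+ coeff r n)     ≡⟨ cong (ℤ._+_ (coeff p n)) (coeff-+ q r n) ⟨
                coeff p n ℤ.+ coeff (q +ᴾ r) n              ≡⟨ coeff-+ p (q +ᴾ r) n ⟨
                coeff (p +ᴾ (q +ᴾ r)) n                     ∎
            }
          ; identity = (λ _ → ≃-refl) , λ p → coefficientwise λ n → ≡.trans (coeff-+ p [] n) (ℤ.+-identityʳ _)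
          }
        ; inverse = (λ p → coefficientwise λ n → ≡.trans (coeff-+ (-ᴾ p) p n)
                       (≡.trans (cong (ℤ._+ coeff p n) (coeff-neg p n)) (ℤ.+-inverseˡ (coeff p n))))
                  , (λ p → coefficientwise λ n → ≡.trans (coeff-+ p (-ᴾ p) n)
                       (≡.trans (cong (ℤ._+_ (coeff p n)) (coeff-neg p n)) (ℤ.+-inverseʳ (coeff p n))))
        ; ⁻¹-cong = -ᴾ-cong
        }
      ; comm = λ p q → coefficientwise λ n → ≡.trans (coeff-+ p q n)
          (≡.trans (ℤ.+-comm (coeff p n) _) (≡.sym (coeff-+ q p n)))
      }
    ; *-cong = *ᴾ-cong
    ; *-assoc = *ᴾ-assoc
    ; *-identity = *ᴾ-identityˡ , λ p → ≃-trans (*ᴾ-comm p [ 1ℤ ]) (*ᴾ-identityˡ p)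
    ; distrib = *ᴾ-distribˡ , *ᴾ-distribʳ
    }
  ; *-comm = *ᴾ-comm
  }
  where open ≡-Reasoning

Poly-commutativeRing : CommutativeRing 0ℓ 0ℓ
Poly-commutativeRing = record { isCommutativeRing = Poly-isCommutativeRing }

-- Numerals in an equation are integers mapped into R, so constants are compared in ℤ rather than in
-- R. The instances are ℤ[α], ℚ(α) and Λ.
module ℤSolver (R : CommutativeRing 0ℓ 0ℓ)
  (morphism : CommutativeRing.rawRing ℤ.+-*-commutativeRing -Raw-AlmostCommutative⟶ fromCommutativeRing R) where
  open _-Raw-AlmostCommutative⟶_ morphism
  open CommutativeRing R using (reflexive)

  decideImage : ∀ i j → Maybe (CommutativeRing._≈_ R ⟦ i ⟧ ⟦ j ⟧)
  decideImage i j with i ℤ.≟ j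
  ... | yes i≡j = just (reflexive (cong ⟦_⟧ i≡j))
  ... | no  _   = nothing

  open Algebra.Solver.Ring _ (fromCommutativeRing R) morphism decideImage public

constant-morphism : CommutativeRing.rawRing ℤ.+-*-commutativeRing -Raw-AlmostCommutative⟶ fromCommutativeRing Poly-commutativeRing
constant-morphism = record
  { ⟦_⟧    = [_]
  ; +-homo = λ _ _ → ≃-refl
  ; *-homo = λ i j → coefficientwise λ { zero → ≡.sym (ℤ.+-identityʳ (i ℤ.* j)) ; (suc n) → ≡.refl }
  ; -‿homo = λ _ → ≃-refl
  ; 0-homo = IsZero⇒≃ (≡.refl ∷ [])
  ; 1-homo = ≃-refl
  }

module PolySolver = ℤSolver Poly-commutativeRing constant-morphism

-- Fractions over the domain ℤ[α]

cross : ∀ {x y} → x ≈ y → num x *ᴾ den y ≃ num y *ᴾ den x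
cross {x} {y} (cross-multiplied d) = x∙y⁻¹≈ε⇒x≈y _ _ (IsZero⇒≃ d)
  where
  open CommutativeRing Poly-commutativeRing using (+-group)
  open import Algebra.Properties.Group +-group using (x∙y⁻¹≈ε⇒x≈y)

uncross : ∀ {x y} → num x *ᴾ den y ≃ num y *ᴾ den x → x ≈ y
uncross {x} {y} e = cross-multiplied (≃⇒IsZero (x≈y⇒x∙y⁻¹≈ε e))
  where
  open CommutativeRing Poly-commutativeRing using (+-group)
  open import Algebra.Properties.Group +-group using (x≈y⇒x∙y⁻¹≈ε)

-- `*ᴾ-nonzero` yields only a negation; deciding whether q - r is zero turns it into an equality.
*ᴾ-cancelˡ : ∀ p {q r} → ¬ IsZero p → p *ᴾ q ≃ p *ᴾ r → q ≃ r
*ᴾ-cancelˡ p {q} {r} p≢0 e with All.all? (ℤ._≟ 0ℤ) (q +ᴾ -ᴾ r)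
... | yes z = x∙y⁻¹≈ε⇒x≈y _ _ (IsZero⇒≃ z)
  where
  open CommutativeRing Poly-commutativeRing using (+-group)
  open import Algebra.Properties.Group +-group using (x∙y⁻¹≈ε⇒x≈y)
... | no ¬z = contradiction (≃⇒IsZero pz) (*ᴾ-nonzero p (q +ᴾ -ᴾ r) p≢0 ¬z)
  where
  open PolySolver
  open SetoidReasoning (CommutativeRing.setoid Poly-commutativeRing)
  pz : p *ᴾ (q +ᴾ -ᴾ r) ≃ []
  pz = begin
    p *ᴾ (q +ᴾ -ᴾ r)      ≈⟨ solve 3 (λ p q r → p :* (q :- r) := p :* q :- p :* r) ≃-refl p q r ⟩
    p *ᴾ q +ᴾ -ᴾ (p *ᴾ r) ≈⟨ +ᴾ-cong e ≃-refl ⟩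
    p *ᴾ r +ᴾ -ᴾ (p *ᴾ r) ≈⟨ CommutativeRing.-‿inverseʳ Poly-commutativeRing (p *ᴾ r) ⟩
    []                    ∎

≈-refl : ∀ {x} → x ≈ x
≈-refl = uncross ≃-refl

≈-sym : ∀ {x y} → x ≈ y → y ≈ x
≈-sym e = uncross (≃-sym (cross e))

-- Comparing x with z through y leaves the common factor `den y`, which cancels because ℤ[α] is a
-- domain.
≈-trans : ∀ {x y z} → x ≈ y → y ≈ z → x ≈ z
≈-trans {x} {y} {z} e f = uncross (*ᴾ-cancelˡ (den y) (den≢0 y) (begin
  den y *ᴾ (num x *ᴾ den z)  ≈⟨ solve 3 (λ a b c → a :* (b :* c) := b :* a :* c) ≃-refl (den y) (num x) (den z) ⟩
  num x *ᴾ den y *ᴾ den z    ≈⟨ *ᴾ-cong (cross e) ≃-refl ⟩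
  num y *ᴾ den x *ᴾ den z    ≈⟨ solve 3 (λ a b c → a :* b :* c := b :* (a :* c)) ≃-refl (num y) (den x) (den z) ⟩
  den x *ᴾ (num y *ᴾ den z)  ≈⟨ *ᴾ-congʳ (den x) (cross f) ⟩
  den x *ᴾ (num z *ᴾ den y)  ≈⟨ solve 3 (λ a b c → a :* (b :* c) := c :* (b :* a)) ≃-refl (den x) (num z) (den y) ⟩
  den y *ᴾ (num z *ᴾ den x)  ∎))
  where
  open PolySolver
  open SetoidReasoning (CommutativeRing.setoid Poly-commutativeRing)

opaque
  unfolding _+_

  +-cong : ∀ {x x′ y y′} → x ≈ x′ → y ≈ y′ → x + y ≈ x′ + y′
  +-cong {x} {x′} {y} {y′} e f = uncross (begin
    (num x *ᴾ den y +ᴾ num y *ᴾ den x) *ᴾ (den x′ *ᴾ den y′)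
      ≈⟨ solve 6 (λ a b c d b′ d′ → (a :* d :+ c :* b) :* (b′ :* d′) := (a :* b′) :* (d :* d′) :+ (c :* d′) :* (b :* b′)) ≃-refl
           (num x) (den x) (num y) (den y) (den x′) (den y′) ⟩
    (num x *ᴾ den x′) *ᴾ (den y *ᴾ den y′) +ᴾ (num y *ᴾ den y′) *ᴾ (den x *ᴾ den x′)
      ≈⟨ +ᴾ-cong (*ᴾ-cong (cross e) ≃-refl) (*ᴾ-cong (cross f) ≃-refl) ⟩
    (num x′ *ᴾ den x) *ᴾ (den y *ᴾ den y′) +ᴾ (num y′ *ᴾ den y) *ᴾ (den x *ᴾ den x′)
      ≈⟨ solve 6 (λ a b c d b′ d′ → (a :* b′) :* (d′ :* d) :+ (c :* d′) :* (b′ :* b) := (a :* d :+ c :* b) :* (b′ :* d′)) ≃-refl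
           (num x′) (den x′) (num y′) (den y′) (den x) (den y) ⟩
    (num x′ *ᴾ den y′ +ᴾ num y′ *ᴾ den x′) *ᴾ (den x *ᴾ den y) ∎)
    where
    open PolySolver
    open SetoidReasoning (CommutativeRing.setoid Poly-commutativeRing)

  *-cong : ∀ {x x′ y y′} → x ≈ x′ → y ≈ y′ → x * y ≈ x′ * y′
  *-cong {x} {x′} {y} {y′} e f = uncross (begin
    (num x *ᴾ num y) *ᴾ (den x′ *ᴾ den y′)
      ≈⟨ solve 4 (λ a b c d → (a :* b) :* (c :* d) := (a :* c) :* (b :* d)) ≃-refl (num x) (num y) (den x′) (den y′) ⟩
    (num x *ᴾ den x′) *ᴾ (num y *ᴾ den y′)
      ≈⟨ *ᴾ-cong (cross e) (cross f) ⟩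
    (num x′ *ᴾ den x) *ᴾ (num y′ *ᴾ den y)
      ≈⟨ solve 4 (λ a b c d → (a :* b) :* (c :* d) := (a :* c) :* (b :* d)) ≃-refl (num x′) (den x) (num y′) (den y) ⟩
    (num x′ *ᴾ num y′) *ᴾ (den x *ᴾ den y) ∎)
    where
    open PolySolver
    open SetoidReasoning (CommutativeRing.setoid Poly-commutativeRing)

  neg-cong : ∀ {x x′} → x ≈ x′ → - x ≈ - x′
  neg-cong {x} {x′} e = uncross (begin
    -ᴾ num x *ᴾ den x′     ≈⟨ solve 2 (λ a b → :- a :* b := :- (a :* b)) ≃-refl (num x) (den x′) ⟩
    -ᴾ (num x *ᴾ den x′)   ≈⟨ -ᴾ-cong (cross e) ⟩
    -ᴾ (num x′ *ᴾ den x)   ≈⟨ solve 2 (λ a b → :- (a :* b) := :- a :* b) ≃-refl (num x′) (den x) ⟩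
    -ᴾ num x′ *ᴾ den x     ∎)
    where
    open PolySolver
    open SetoidReasoning (CommutativeRing.setoid Poly-commutativeRing)

  ℚ⟨α⟩-isCommutativeRing : IsCommutativeRing _≈_ _+_ _*_ -_ 0# 1#
  ℚ⟨α⟩-isCommutativeRing = record
    { isRing = record
      { +-isAbelianGroup = record
        { isGroup = record
          { isMonoid = record
            { isSemigroup = record
              { isMagma = record
                { isEquivalence = record { refl = ≈-refl ; sym = ≈-sym ; trans = ≈-trans }
                ; ∙-cong = +-cong
                }
              ; assoc = λ x y z → uncross (solve 6 (λ a b c d e f →
                  ((a :* d :+ c :* b) :* f :+ e :* (b :* d)) :* (b :* (d :* f))
                    := (a :* (d :* f) :+ (c :* f :+ e :* d) :* b) :* (b :* d :* f)) ≃-refl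
                  (num x) (den x) (num y) (den y) (num z) (den z))
              }
            ; identity =
                (λ x → uncross (solve 2 (λ a b → (con 0ℤ :* b :+ a :* con 1ℤ) :* b := a :* (con 1ℤ :* b)) ≃-refl (num x) (den x)))
              , (λ x → uncross (solve 2 (λ a b → (a :* con 1ℤ :+ con 0ℤ :* b) :* b := a :* (b :* con 1ℤ)) ≃-refl (num x) (den x)))
            }
          ; inverse =
              (λ x → uncross (solve 2 (λ a b → (:- a :* b :+ a :* b) :* con 1ℤ := con 0ℤ :* (b :* b)) ≃-refl (num x) (den x)))
            , (λ x → uncross (solve 2 (λ a b → (a :* b :+ :- a :* b) :* con 1ℤ := con 0ℤ :* (b :* b)) ≃-refl (num x) (den x)))
          ; ⁻¹-cong = neg-cong
          }
        ; comm = λ x y → uncross (solve 4 (λ a b c d →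
            (a :* d :+ c :* b) :* (d :* b) := (c :* b :+ a :* d) :* (b :* d)) ≃-refl (num x) (den x) (num y) (den y))
        }
      ; *-cong = *-cong
      ; *-assoc = λ x y z → uncross (solve 6 (λ a b c d e f →
          a :* c :* e :* (b :* (d :* f)) := a :* (c :* e) :* (b :* d :* f)) ≃-refl
          (num x) (den x) (num y) (den y) (num z) (den z))
      ; *-identity =
          (λ x → uncross (solve 2 (λ a b → con 1ℤ :* a :* b := a :* (con 1ℤ :* b)) ≃-refl (num x) (den x)))
        , (λ x → uncross (solve 2 (λ a b → a :* con 1ℤ :* b := a :* (b :* con 1ℤ)) ≃-refl (num x) (den x)))
      ; distrib =
          (λ x y z → uncross (solve 6 (λ a b c d e f →
            a :* (c :* f :+ e :* d) :* (b :* d :* (b :* f)) := (a :* c :* (b :* f) :+ a :* e :* (b :* d)) :* (b :* (d :* f))) ≃-refl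
            (num x) (den x) (num y) (den y) (num z) (den z)))
        , (λ x y z → uncross (solve 6 (λ a b c d e f →
            (c :* f :+ e :* d) :* a :* (d :* b :* (f :* b)) := (c :* a :* (f :* b) :+ e :* a :* (d :* b)) :* (d :* f :* b)) ≃-refl
            (num x) (den x) (num y) (den y) (num z) (den z)))
      }
    ; *-comm = λ x y → uncross (solve 4 (λ a b c d →
        a :* c :* (d :* b) := c :* a :* (b :* d)) ≃-refl (num x) (den x) (num y) (den y))
    }
    where open PolySolver

  fromℤ-+ : ∀ i j → polynomial [ i ℤ.+ j ] ≈ polynomial [ i ] + polynomial [ j ]
  fromℤ-+ i j = uncross (coefficientwise λ { zero → cong (λ k → k ℤ.* 1ℤ ℤ.+ 0ℤ) (cong₂ ℤ._+_ (unit i) (unit j)) ; (suc _) → ≡.refl })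
    where
    unit : ∀ i → i ≡ i ℤ.* 1ℤ ℤ.+ 0ℤ
    unit i = ≡.sym (≡.trans (ℤ.+-identityʳ _) (ℤ.*-identityʳ i))

  fromℤ-* : ∀ i j → polynomial [ i ℤ.* j ] ≈ polynomial [ i ] * polynomial [ j ]
  fromℤ-* i j = uncross (coefficientwise λ { zero → cong (λ k → k ℤ.* 1ℤ ℤ.+ 0ℤ) (≡.sym (ℤ.+-identityʳ (i ℤ.* j))) ; (suc _) → ≡.refl })

  fromℤ-neg : ∀ i → polynomial [ ℤ.- i ] ≈ - polynomial [ i ]
  fromℤ-neg i = ≈-refl

  inverse-*ˡ : ∀ x x≢0 → inverse x x≢0 * x ≈ 1#
  inverse-*ˡ x x≢0 = uncross (solve 2 (λ a b → b :* a :* con 1ℤ := con 1ℤ :* (a :* b)) ≃-refl (num x) (den x))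
    where open PolySolver

ℚ⟨α⟩-commutativeRing : CommutativeRing 0ℓ 0ℓ
ℚ⟨α⟩-commutativeRing = record { isCommutativeRing = ℚ⟨α⟩-isCommutativeRing }

fromℤ-morphism : CommutativeRing.rawRing ℤ.+-*-commutativeRing -Raw-AlmostCommutative⟶ fromCommutativeRing ℚ⟨α⟩-commutativeRing
fromℤ-morphism = record
  { ⟦_⟧    = λ i → polynomial [ i ]
  ; +-homo = fromℤ-+
  ; *-homo = fromℤ-*
  ; -‿homo = fromℤ-neg
  ; 0-homo = ≈-refl
  ; 1-homo = ≈-refl
  }

module Kˢ = ℤSolver ℚ⟨α⟩-commutativeRing fromℤ-morphism
open Kˢ public using (Polynomial; solve; _:=_; _:+_; _:*_; _:-_; :-_; con)
module K = CommutativeRing ℚ⟨α⟩-commutativeRing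
module K-Reasoning = SetoidReasoning K.setoid

zero-num : ∀ {x} → IsZero (num x) → x ≈ 0#
zero-num {x} z = uncross (begin
  num x *ᴾ [ 1ℤ ]  ≈⟨ *ᴾ-cong (IsZero⇒≃ z) ≃-refl ⟩
  []               ≈⟨ *ᴾ-cong (IsZero⇒≃ {[ 0ℤ ]} (≡.refl ∷ [])) (≃-refl {den x}) ⟨
  [ 0ℤ ] *ᴾ den x  ∎)
  where open SetoidReasoning (CommutativeRing.setoid Poly-commutativeRing)

num-zero : ∀ {x} → x ≈ 0# → IsZero (num x)
num-zero {x} e = ≃⇒IsZero (begin
  num x            ≈⟨ CommutativeRing.*-identityʳ Poly-commutativeRing (num x) ⟨
  num x *ᴾ [ 1ℤ ]  ≈⟨ cross e ⟩
  [ 0ℤ ] *ᴾ den x  ≈⟨ *ᴾ-cong (IsZero⇒≃ {[ 0ℤ ]} (≡.refl ∷ [])) (≃-refl {den x}) ⟩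
  []               ∎)
  where open SetoidReasoning (CommutativeRing.setoid Poly-commutativeRing)

-- With `decidable-stable` this shows that a matrix entry vanishes by refuting the opposite, without
-- deciding the dominance order, whose definition quantifies over all n.
_≈0? : ∀ x → Dec (x ≈ 0#)
x ≈0? with All.all? (ℤ._≟ 0ℤ) (num x)
... | yes z = yes (zero-num z)
... | no ¬z = no (λ e → ¬z (num-zero e))

*-cancelˡ : ∀ x {y z} → ¬ x ≈ 0# → x * y ≈ x * z → y ≈ z
*-cancelˡ x {y} {z} x≉0 e = begin
  y            ≈⟨ unit y ⟩
  x⁻¹ * x * y  ≈⟨ K.*-assoc x⁻¹ x y ⟩
  x⁻¹ * (x * y) ≈⟨ K.*-congˡ e ⟩
  x⁻¹ * (x * z) ≈⟨ K.*-assoc x⁻¹ x z ⟨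
  x⁻¹ * x * z  ≈⟨ unit z ⟨
  z            ∎
  where
  open K-Reasoning
  x≢0 : ¬ IsZero (num x)
  x≢0 n = x≉0 (zero-num n)
  x⁻¹ = inverse x x≢0
  unit : ∀ y → y ≈ x⁻¹ * x * y
  unit y = K.trans (K.sym (K.*-identityˡ y)) (K.*-congʳ (K.sym (inverse-*ˡ x x≢0)))

fromℕ-+ : ∀ m n → fromℕ (m ℕ.+ n) ≈ fromℕ m + fromℕ n
fromℕ-+ m n = fromℤ-+ (ℤ.+ m) (ℤ.+ n)

fromℕ-* : ∀ m n → fromℕ (m ℕ.* n) ≈ fromℕ m * fromℕ n
fromℕ-* m n = K.trans (K.reflexive (cong (λ i → polynomial [ i ]) (ℤ.pos-* m n))) (fromℤ-* (ℤ.+ m) (ℤ.+ n))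

fromℕ-suc≉0 : ∀ n → ¬ fromℕ (suc n) ≈ 0#
fromℕ-suc≉0 n e with num-zero e
... | () ∷ _

α≉0 : ¬ α ≈ 0#
α≉0 e with num-zero e
... | _ ∷ () ∷ _

α⁻¹-*ˡ : α⁻¹ * α ≈ 1#
α⁻¹-*ˡ = inverse-*ˡ α _

*≉0 : ∀ {x y} → ¬ x ≈ 0# → ¬ y ≈ 0# → ¬ x * y ≈ 0#
*≉0 {x} {y} x≉0 y≉0 e = y≉0 (*-cancelˡ x x≉0 (K.trans e (K.sym (K.zeroʳ x))))

α^n≉0 : ∀ n → ¬ α ^ n ≈ 0#
α^n≉0 zero    = fromℕ-suc≉0 0
α^n≉0 (suc n) = *≉0 α≉0 (α^n≉0 n)

1/suc : ℕ → ℚ⟨α⟩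
1/suc n = inverse (fromℕ (suc n)) λ { (() ∷ _) }

1/suc-* : ∀ n → 1/suc n * fromℕ (suc n) ≈ 1#
1/suc-* n = inverse-*ˡ (fromℕ (suc n)) _

-- The ring Λ

private
  variable
    A B : Set

-- The linear extension of G to formal sums. Elements of Λ are compared through it, because the list
-- representing an element depends on the order of letters and terms.
eval : (A → ℚ⟨α⟩) → List (ℚ⟨α⟩ × A) → ℚ⟨α⟩
eval G = foldr (λ (c , u) s → c * G u + s) 0#

indicator : {P : Set} → Dec P → ℚ⟨α⟩
indicator d = if does d then 1# else 0#

indicator-yes : ∀ {P} (d : Dec P) → P → 1# ≈ indicator d
indicator-yes d x = K.reflexive (cong (λ b → if b then 1# else 0#) (≡.sym (dec-true d x)))

indicator-no : ∀ {P} (d : Dec P) → ¬ P → 0# ≈ indicator d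
indicator-no d ¬x = K.reflexive (cong (λ b → if b then 1# else 0#) (≡.sym (dec-false d ¬x)))

scale : ℚ⟨α⟩ → List (ℚ⟨α⟩ × A) → List (ℚ⟨α⟩ × A)
scale c = map (map₁ (c *_))

eval-cong : ∀ {G H : A → ℚ⟨α⟩} → (∀ u → G u ≈ H u) → ∀ f → eval G f ≈ eval H f
eval-cong e []            = K.refl
eval-cong e ((c , u) ∷ f) = K.+-cong (K.*-congˡ (e u)) (eval-cong e f)

eval-++ : ∀ (G : A → ℚ⟨α⟩) f g → eval G (f ++ g) ≈ eval G f + eval G g
eval-++ G []            g = K.sym (K.+-identityˡ _)
eval-++ G ((c , u) ∷ f) g = K.trans (K.+-congˡ (eval-++ G f g)) (K.sym (K.+-assoc _ _ _))

eval-scale : ∀ (G : A → ℚ⟨α⟩) a f → eval G (scale a f) ≈ a * eval G f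
eval-scale G a []            = K.sym (K.zeroʳ a)
eval-scale G a ((c , u) ∷ f) = begin
  a * c * G u + eval G (scale a f) ≈⟨ K.+-cong (K.*-assoc a c _) (eval-scale G a f) ⟩
  a * (c * G u) + a * eval G f     ≈⟨ K.distribˡ a _ _ ⟨
  a * (c * G u + eval G f)         ∎
  where open K-Reasoning

eval-neg : ∀ (G : A → ℚ⟨α⟩) f → eval G (map (map₁ (λ c → - c)) f) ≈ - eval G f
eval-neg G []            = solve 0 (con 0ℤ := :- con 0ℤ) K.refl
eval-neg G ((c , u) ∷ f) = K.trans (K.+-congˡ (eval-neg G f))
  (solve 3 (λ c g s → :- c :* g :+ :- s := :- (c :* g :+ s)) K.refl c (G u) (eval G f))

eval-0 : ∀ (f : List (ℚ⟨α⟩ × A)) → eval (λ _ → 0#) f ≈ 0#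
eval-0 []            = K.refl
eval-0 ((c , u) ∷ f) = K.trans (K.+-cong (K.zeroʳ c) (eval-0 f)) (K.+-identityˡ 0#)

eval-+ : ∀ (G H : A → ℚ⟨α⟩) f → eval (λ u → G u + H u) f ≈ eval G f + eval H f
eval-+ G H []            = K.sym (K.+-identityˡ 0#)
eval-+ G H ((c , u) ∷ f) = K.trans (K.+-congˡ (eval-+ G H f))
  (solve 5 (λ c g h s t → c :* (g :+ h) :+ (s :+ t) := (c :* g :+ s) :+ (c :* h :+ t)) K.refl
     c (G u) (H u) (eval G f) (eval H f))

eval-* : ∀ a (G : A → ℚ⟨α⟩) f → eval (λ u → a * G u) f ≈ a * eval G f
eval-* a G []            = K.sym (K.zeroʳ a)
eval-* a G ((c , u) ∷ f) = K.trans (K.+-congˡ (eval-* a G f))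
  (solve 4 (λ a c g s → c :* (a :* g) :+ a :* s := a :* (c :* g :+ s)) K.refl a c (G u) (eval G f))

eval-swap : ∀ (G : A → B → ℚ⟨α⟩) f g →
  eval (λ u → eval (G u) g) f ≈ eval (λ v → eval (λ u → G u v) f) g
eval-swap G []            g = K.sym (eval-0 g)
eval-swap G ((c , u) ∷ f) g = begin
  c * eval (G u) g + eval (λ u → eval (G u) g) f             ≈⟨ K.+-cong (K.sym (eval-* c (G u) g)) (eval-swap G f g) ⟩
  eval (λ v → c * G u v) g + eval (λ v → eval (λ u → G u v) f) g ≈⟨ eval-+ _ _ g ⟨
  eval (λ v → c * G u v + eval (λ u → G u v) f) g            ∎
  where open K-Reasoning

eval-concatMap : ∀ (G : B → ℚ⟨α⟩) (F : A → List (ℚ⟨α⟩ × B)) f →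
  eval G (concatMap (λ (c , u) → scale c (F u)) f) ≈ eval (λ u → eval G (F u)) f
eval-concatMap G F []            = K.refl
eval-concatMap G F ((c , u) ∷ f) =
  K.trans (eval-++ G (scale c (F u)) _) (K.+-cong (eval-scale G c (F u)) (eval-concatMap G F f))

eval-map₂ : ∀ (G : B → ℚ⟨α⟩) (h : A → B) f → eval G (map (map₂ h) f) ≈ eval (G ∘ h) f
eval-map₂ G h []            = K.refl
eval-map₂ G h ((c , u) ∷ f) = K.+-congˡ (eval-map₂ G h f)

-- Collects the terms of a formal sum whose indices are equivalent. It serves words up to
-- permutation, for equality in Λ, and partitions up to equality, for expansions in a basis.
module Grouping {_~_ : A → A → Set} (~-equiv : IsEquivalence _~_) (_~?_ : ∀ u v → Dec (u ~ v)) where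
  private module ~ = IsEquivalence ~-equiv

  total : A → List (ℚ⟨α⟩ × A) → ℚ⟨α⟩
  total u = eval (λ v → indicator (u ~? v))

  Respects : (A → ℚ⟨α⟩) → Set
  Respects G = ∀ {u v} → u ~ v → G u ≈ G v

  indicator-respects : ∀ u → Respects (λ v → indicator (u ~? v))
  indicator-respects u {v} {w} v~w with u ~? v | u ~? w
  ... | yes _   | yes _   = K.refl
  ... | no _    | no _    = K.refl
  ... | yes u~v | no u≁w  = contradiction (~.trans u~v v~w) u≁w
  ... | no u≁v  | yes u~w = contradiction (~.trans u~w (~.sym v~w)) u≁v

  private
    remove : A → List (ℚ⟨α⟩ × A) → List (ℚ⟨α⟩ × A)
    remove u []            = []
    remove u ((c , v) ∷ f) = if does (u ~? v) then remove u f else (c , v) ∷ remove u f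

    length-remove : ∀ u f → length (remove u f) ≤ length f
    length-remove u []            = z≤n
    length-remove u ((c , v) ∷ f) with does (u ~? v)
    ... | true  = ℕ.m≤n⇒m≤1+n (length-remove u f)
    ... | false = s≤s (length-remove u f)

    eval-remove : ∀ {G} → Respects G → ∀ u f → eval G f ≈ total u f * G u + eval G (remove u f)
    eval-remove {G} resp u [] = solve 1 (λ g → con 0ℤ := con 0ℤ :* g :+ con 0ℤ) K.refl (G u)
    eval-remove {G} resp u ((c , v) ∷ f) with u ~? v
    ... | yes u~v = K.trans (K.+-cong (K.*-congˡ (resp (~.sym u~v))) (eval-remove resp u f))
      (solve 4 (λ c g t r → c :* g :+ (t :* g :+ r) := (c :* con 1ℤ :+ t) :* g :+ r) K.refl
         c (G u) (total u f) (eval G (remove u f)))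
    ... | no _ = K.trans (K.+-congˡ (eval-remove resp u f))
      (solve 5 (λ c h g t r → c :* h :+ (t :* g :+ r) := (c :* con 0ℤ :+ t) :* g :+ (c :* h :+ r)) K.refl
         c (G v) (G u) (total u f) (eval G (remove u f)))

    -- `remove` does not return a subterm, hence the induction on a bound n for the length.
    group : ∀ n f → length f ≤ n → ∀ {G} → Respects G → (∀ u → total u f * G u ≈ 0#) → eval G f ≈ 0#
    group n       []                      _         resp z = K.refl
    group (suc n) f@((c , u) ∷ g) (s≤s |g|≤n) {G} resp z = begin
      eval G f                                   ≈⟨ split resp ⟩
      total u f * G u + eval G (remove u g)      ≈⟨ K.+-cong (z u) (group n (remove u g) (ℕ.≤-trans (length-remove u g) |g|≤n) resp rest) ⟩
      0# + 0#                                    ≈⟨ K.+-identityˡ 0# ⟩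
      0#                                         ∎
      where
      open K-Reasoning
      split : ∀ {H} → Respects H → eval H f ≈ total u f * H u + eval H (remove u g)
      split {H} resp = K.trans (K.+-congˡ (eval-remove resp u g))
        (K.trans (solve 4 (λ c h t r → c :* h :+ (t :* h :+ r) := (c :* con 1ℤ :+ t) :* h :+ r) K.refl
                    c (H u) (total u g) (eval H (remove u g)))
                 (K.+-congʳ (K.*-congʳ (K.+-congʳ (K.*-congˡ (indicator-yes (u ~? u) ~.refl))))))
      -- Removing the class of u makes its own total zero and leaves the totals of the other classes
      -- unchanged.
      rest : ∀ v → total v (remove u g) * G v ≈ 0#
      rest v with v ~? u
      ... | yes v~u = begin
        total v (remove u g) * G v  ≈⟨ K.*-congʳ (∙-cancelˡ (total u f * 1#) _ _ (begin
            total u f * 1# + total v (remove u g)  ≈⟨ K.trans (split (indicator-respects v)) (K.+-congʳ (K.*-congˡ (K.sym (indicator-yes (v ~? u) v~u)))) ⟨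
            total v f                              ≈⟨ eval-cong same f ⟩
            total u f                              ≈⟨ solve 1 (λ t → t := t :* con 1ℤ :+ con 0ℤ) K.refl (total u f) ⟩
            total u f * 1# + 0#                    ∎)) ⟩
        0# * G v                    ≈⟨ K.zeroˡ (G v) ⟩
        0#                          ∎
        where
        open import Algebra.Properties.Group K.+-group using (∙-cancelˡ)
        same : ∀ w → indicator (v ~? w) ≈ indicator (u ~? w)
        same w with v ~? w | u ~? w
        ... | yes _   | yes _   = K.refl
        ... | no _    | no _    = K.refl
        ... | yes v~w | no u≁w  = contradiction (~.trans (~.sym v~u) v~w) u≁w
        ... | no v≁w  | yes u~w = contradiction (~.trans v~u u~w) v≁w
      ... | no v≁u = begin
        total v (remove u g) * G v                      ≈⟨ solve 3 (λ t r g → r :* g := (t :* con 0ℤ :+ r) :* g) K.refl (total u f) (total v (remove u g)) (G v) ⟩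
        (total u f * 0# + total v (remove u g)) * G v   ≈⟨ K.*-congʳ (K.trans (split (indicator-respects v)) (K.+-congʳ (K.*-congˡ (K.sym (indicator-no (v ~? u) v≁u))))) ⟨
        total v f * G v                                 ≈⟨ z v ⟩
        0#                                              ∎

  -- The hypothesis is a product because a class may contribute nothing for either of two reasons:
  -- its total vanishes, or G does. The triangularity argument uses both.
  eval-vanishes : ∀ f {G} → Respects G → (∀ u → total u f * G u ≈ 0#) → eval G f ≈ 0#
  eval-vanishes f = group (length f) f ℕ.≤-refl

private
  module Sort  = Data.List.Sort.InsertionSort.Base ℕ.≤-decTotalOrder
  module Sortₚ = Data.List.Sort.InsertionSort.Properties ℕ.≤-decTotalOrder

same⇒↭ : ∀ u v → SameMonomial u v → u ↭ v
same⇒↭ u v e = ↭-trans (↭-sym (Sortₚ.sort-↭ u)) (≡.subst (_↭ v) (≡.sym e) (Sortₚ.sort-↭ v))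

↭⇒same : ∀ {u v} → u ↭ v → SameMonomial u v
↭⇒same {u} {v} e = Pointwise-≡⇒≡ (↗↭↗⇒≋ ℕ.≤-totalOrder (Sortₚ.sort-↗ u) (Sortₚ.sort-↗ v)
  (↭.↭⇒↭ₛ (↭-trans (Sortₚ.sort-↭ u) (↭-trans e (↭-sym (Sortₚ.sort-↭ v))))))

-- `map′` keeps the Boolean of `sameMonomial?`, so a `coefficient` matches `wordTotal` term by term
-- with no conversion between decisions.
_↭?_ : ∀ u v → Dec (u ↭ v)
u ↭? v = map′ (same⇒↭ u v) ↭⇒same (sameMonomial? u v)

open Grouping ↭.↭-isEquivalence _↭?_ public
  renaming (Respects to Invariant; total to wordTotal; eval-vanishes to word-eval-vanishes; indicator-respects to indicator-invariant)

if-scale : ∀ b c → (if b then c else 0#) ≈ c * (if b then 1# else 0#)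
if-scale true  c = K.sym (K.*-identityʳ c)
if-scale false c = K.sym (K.zeroʳ c)

coefficient≈total : ∀ u f → coefficient u f ≈ wordTotal u f
coefficient≈total u []            = K.refl
coefficient≈total u ((c , v) ∷ f) = K.+-cong (if-scale (does (sameMonomial? u v)) c) (coefficient≈total u f)

-- A record, because _≈ᴸ_ unfolds to a function type that determines neither side.
infix 4 _≋_
record _≋_ (f g : Λ) : Set where
  constructor fromᴸ
  field
    toᴸ : f ≈ᴸ g
open _≋_ public

-- All class totals of f - g are zero, so grouping applies. Together with `eval⇒≋` this makes `_≋_`
-- the equality seen by all permutation-invariant functions.
≋⇒eval : ∀ {f g} → f ≋ g → ∀ {G} → Invariant G → eval G f ≈ eval G g
≋⇒eval {f} {g} (fromᴸ e) {G} inv = x∙y⁻¹≈ε⇒x≈y _ _ (begin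
  eval G f + - eval G g   ≈⟨ K.+-congˡ (eval-neg G g) ⟨
  eval G f + eval G (-ᴸ g)  ≈⟨ eval-++ G f (-ᴸ g) ⟨
  eval G (f ++ -ᴸ g)      ≈⟨ word-eval-vanishes (f ++ -ᴸ g) inv (λ u → K.trans (K.*-congʳ (difference u)) (K.zeroˡ (G u))) ⟩
  0#                      ∎)
  where
  open K-Reasoning
  open import Algebra.Properties.Group K.+-group using (x∙y⁻¹≈ε⇒x≈y; x≈y⇒x∙y⁻¹≈ε)
  difference : ∀ u → wordTotal u (f ++ -ᴸ g) ≈ 0#
  difference u = begin
    wordTotal u (f ++ -ᴸ g)           ≈⟨ eval-++ _ f (-ᴸ g) ⟩
    wordTotal u f + wordTotal u (-ᴸ g) ≈⟨ K.+-congˡ (eval-neg _ g) ⟩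
    wordTotal u f + - wordTotal u g   ≈⟨ x≈y⇒x∙y⁻¹≈ε (K.trans (K.sym (coefficient≈total u f)) (K.trans (e u) (coefficient≈total u g))) ⟩
    0#                                ∎

eval⇒≋ : ∀ {f g} → (∀ {G} → Invariant G → eval G f ≈ eval G g) → f ≋ g
eval⇒≋ {f} {g} e = fromᴸ λ u →
  K.trans (coefficient≈total u f) (K.trans (e (indicator-invariant u)) (K.sym (coefficient≈total u g)))

infixl 8 _*ᴸ_
-- Opaque so that unification can decompose products.
opaque
  _*ᴸ_ : Λ → Λ → Λ
  f *ᴸ g = linearExtension (λ u → map (map₂ (u ++_)) g) f

  eval-product : ∀ G f g → eval G (f *ᴸ g) ≈ eval (λ u → eval (λ v → G (u ++ v)) g) f
  eval-product G f g = K.trans (eval-concatMap G _ f) (eval-cong (λ u → eval-map₂ G (u ++_) g) f)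

const : ℚ⟨α⟩ → Λ
const c = [ (c , []) ]

1ᴸ : Λ
1ᴸ = const 1#

++-invariantˡ : ∀ {G} → Invariant G → ∀ u → Invariant (λ v → G (u ++ v))
++-invariantˡ inv u e = inv (↭ₚ.++⁺ˡ u e)

++-invariantʳ : ∀ {G} → Invariant G → ∀ g → Invariant (λ u → eval (λ v → G (u ++ v)) g)
++-invariantʳ inv g e = eval-cong (λ v → inv (↭ₚ.++⁺ʳ v e)) g

≋-isEquivalence : IsEquivalence _≋_
≋-isEquivalence = record
  { refl  = fromᴸ λ _ → K.refl
  ; sym   = λ (fromᴸ e) → fromᴸ λ u → K.sym (e u)
  ; trans = λ (fromᴸ e) (fromᴸ f) → fromᴸ λ u → K.trans (e u) (f u)
  }

-- Under `eval G` a product becomes an iterated sum. Commutativity is then the exchange of the two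
-- sums together with the invariance of G.
Λ-isCommutativeRing : IsCommutativeRing _≋_ _+ᴸ_ _*ᴸ_ -ᴸ_ 0ᴸ 1ᴸ
Λ-isCommutativeRing = record
  { isRing = record
    { +-isAbelianGroup = record
      { isGroup = record
        { isMonoid = record
          { isSemigroup = record
            { isMagma = record
              { isEquivalence = ≋-isEquivalence
              ; ∙-cong = +-cong′
              }
            ; assoc = λ f g h → ≡⇒≋ (List.++-assoc f g h)
            }
          ; identity = (λ _ → ≡⇒≋ ≡.refl) , (λ f → ≡⇒≋ (List.++-identityʳ f))
          }
        ; inverse = (λ f → eval⇒≋ λ {G} _ → K.trans (eval-++ G (-ᴸ f) f) (K.trans (K.+-congʳ (eval-neg G f)) (K.-‿inverseˡ _)))
                  , (λ f → eval⇒≋ λ {G} _ → K.trans (eval-++ G f (-ᴸ f)) (K.trans (K.+-congˡ (eval-neg G f)) (K.-‿inverseʳ _)))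
        ; ⁻¹-cong = λ {f} {g} e → eval⇒≋ λ {G} inv →
            K.trans (eval-neg G f) (K.trans (K.-‿cong (≋⇒eval e inv)) (K.sym (eval-neg G g)))
        }
      ; comm = λ f g → eval⇒≋ λ {G} _ → K.trans (eval-++ G f g) (K.trans (K.+-comm _ _) (K.sym (eval-++ G g f)))
      }
    ; *-cong = λ {f} {f′} {g} {g′} e e′ → eval⇒≋ λ {G} inv → begin
        eval G (f *ᴸ g)                                 ≈⟨ eval-product G f g ⟩
        eval (λ u → eval (λ v → G (u ++ v)) g) f        ≈⟨ eval-cong (λ u → ≋⇒eval e′ (++-invariantˡ inv u)) f ⟩
        eval (λ u → eval (λ v → G (u ++ v)) g′) f       ≈⟨ ≋⇒eval e (++-invariantʳ inv g′) ⟩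
        eval (λ u → eval (λ v → G (u ++ v)) g′) f′      ≈⟨ eval-product G f′ g′ ⟨
        eval G (f′ *ᴸ g′)                               ∎
    ; *-assoc = λ f g h → eval⇒≋ λ {G} inv → begin
        eval G (f *ᴸ g *ᴸ h)                                              ≈⟨ eval-product G (f *ᴸ g) h ⟩
        eval (λ u → eval (λ w → G (u ++ w)) h) (f *ᴸ g)                   ≈⟨ eval-product _ f g ⟩
        eval (λ u → eval (λ v → eval (λ w → G ((u ++ v) ++ w)) h) g) f
          ≈⟨ eval-cong (λ u → eval-cong (λ v → eval-cong (λ w → K.reflexive (cong G (List.++-assoc u v w))) h) g) f ⟩
        eval (λ u → eval (λ v → eval (λ w → G (u ++ (v ++ w))) h) g) f    ≈⟨ eval-cong (λ u → eval-product (λ v → G (u ++ v)) g h) f ⟨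
        eval (λ u → eval (λ v → G (u ++ v)) (g *ᴸ h)) f                   ≈⟨ eval-product G f (g *ᴸ h) ⟨
        eval G (f *ᴸ (g *ᴸ h))                                            ∎
    ; *-identity = identityˡ , λ f → ≋-trans (comm f 1ᴸ) (identityˡ f)
    ; distrib = (λ f g h → ≋-trans (comm f (g ++ h)) (≋-trans (distribʳ f g h) (+-cong′ (comm g f) (comm h f)))) , distribʳ
    }
  ; *-comm = comm
  }
  where
  open K-Reasoning
  ≡⇒≋ : ∀ {f g} → f ≡ g → f ≋ g
  ≡⇒≋ ≡.refl = IsEquivalence.refl ≋-isEquivalence
  ≋-trans : ∀ {f g h} → f ≋ g → g ≋ h → f ≋ h
  ≋-trans = IsEquivalence.trans ≋-isEquivalence
  +-cong′ : ∀ {f f′ g g′} → f ≋ f′ → g ≋ g′ → f ++ g ≋ f′ ++ g′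
  +-cong′ {f} {f′} {g} {g′} e e′ = eval⇒≋ λ {G} inv →
    K.trans (eval-++ G f g) (K.trans (K.+-cong (≋⇒eval e inv) (≋⇒eval e′ inv)) (K.sym (eval-++ G f′ g′)))
  identityˡ : ∀ f → 1ᴸ *ᴸ f ≋ f
  identityˡ f = eval⇒≋ λ {G} _ → K.trans (eval-product G 1ᴸ f)
    (solve 1 (λ x → con 1ℤ :* x :+ con 0ℤ := x) K.refl (eval G f))
  comm : ∀ f g → f *ᴸ g ≋ g *ᴸ f
  comm f g = eval⇒≋ λ {G} inv → begin
    eval G (f *ᴸ g)                           ≈⟨ eval-product G f g ⟩
    eval (λ u → eval (λ v → G (u ++ v)) g) f  ≈⟨ eval-swap _ f g ⟩
    eval (λ v → eval (λ u → G (u ++ v)) f) g  ≈⟨ eval-cong (λ v → eval-cong (λ u → inv (↭ₚ.++-comm u v)) f) g ⟩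
    eval (λ v → eval (λ u → G (v ++ u)) f) g  ≈⟨ eval-product G g f ⟨
    eval G (g *ᴸ f)                           ∎
  distribʳ : ∀ h f g → (f ++ g) *ᴸ h ≋ f *ᴸ h ++ g *ᴸ h
  distribʳ h f g = eval⇒≋ λ {G} _ → begin
    eval G ((f ++ g) *ᴸ h)                  ≈⟨ eval-product G (f ++ g) h ⟩
    eval (λ u → eval (λ v → G (u ++ v)) h) (f ++ g) ≈⟨ eval-++ _ f g ⟩
    eval (λ u → eval (λ v → G (u ++ v)) h) f + eval (λ u → eval (λ v → G (u ++ v)) h) g
      ≈⟨ K.+-cong (eval-product G f h) (eval-product G g h) ⟨
    eval G (f *ᴸ h) + eval G (g *ᴸ h)       ≈⟨ eval-++ G (f *ᴸ h) (g *ᴸ h) ⟨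
    eval G (f *ᴸ h ++ g *ᴸ h)               ∎

Λ-commutativeRing : CommutativeRing 0ℓ 0ℓ
Λ-commutativeRing = record { isCommutativeRing = Λ-isCommutativeRing }

module L = CommutativeRing Λ-commutativeRing
module L-Reasoning = SetoidReasoning L.setoid

-- Turning scalars into constant elements of Λ makes them accessible to the ring solver.
·≋const : ∀ c f → c ·ᴸ f ≋ const c *ᴸ f
·≋const c f = eval⇒≋ λ {G} _ → K.trans (eval-scale G c f)
  (K.sym (K.trans (eval-product G (const c) f) (K.+-identityʳ _)))

const-cong : ∀ {c d} → c ≈ d → const c ≋ const d
const-cong e = eval⇒≋ λ _ → K.+-congʳ (K.*-congʳ e)

const-+ : ∀ c d → const (c + d) ≋ const c +ᴸ const d
const-+ c d = eval⇒≋ λ {G} _ →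
  solve 3 (λ c d g → (c :+ d) :* g :+ con 0ℤ := c :* g :+ (d :* g :+ con 0ℤ)) K.refl c d (G [])

const-* : ∀ c d → const (c * d) ≋ const c *ᴸ const d
const-* c d = eval⇒≋ λ {G} _ → K.trans
  (solve 3 (λ c d g → c :* d :* g :+ con 0ℤ := c :* (d :* g :+ con 0ℤ) :+ con 0ℤ) K.refl c d (G []))
  (K.sym (eval-product G (const c) (const d)))

const-neg : ∀ c → const (- c) ≋ -ᴸ const c
const-neg c = L.refl

const-0 : const 0# ≋ 0ᴸ
const-0 = eval⇒≋ λ {G} _ → solve 1 (λ g → con 0ℤ :* g :+ con 0ℤ := con 0ℤ) K.refl (G [])

constℤ-morphism : CommutativeRing.rawRing ℤ.+-*-commutativeRing -Raw-AlmostCommutative⟶ fromCommutativeRing Λ-commutativeRing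
constℤ-morphism = record
  { ⟦_⟧    = λ i → const (polynomial [ i ])
  ; +-homo = λ i j → L.trans (const-cong (fromℤ-+ i j)) (const-+ _ _)
  ; *-homo = λ i j → L.trans (const-cong (fromℤ-* i j)) (const-* _ _)
  ; -‿homo = λ i → const-cong (fromℤ-neg i)
  ; 0-homo = const-0
  ; 1-homo = L.refl
  }

module Lˢ = ℤSolver Λ-commutativeRing constℤ-morphism
open Lˢ public using () renaming (solve to solveᴸ; _:=_ to _:=ᴸ_; _:+_ to _:+ᴸ_; _:*_ to _:*ᴸ_; _:-_ to _:-ᴸ_; :-_ to :-ᴸ_; con to conᴸ)

-- Linear operators on Λ

·-cong : ∀ {c d f g} → c ≈ d → f ≋ g → c ·ᴸ f ≋ d ·ᴸ g
·-cong {c} {d} {f} {g} e e′ = L.trans (·≋const c f) (L.trans (L.*-cong (const-cong e) e′) (L.sym (·≋const d g)))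

·-+ : ∀ c f g → c ·ᴸ (f +ᴸ g) ≋ c ·ᴸ f +ᴸ c ·ᴸ g
·-+ c f g = L.reflexive (List.map-++ (map₁ (c *_)) f g)

·-* : ∀ c f g → (c ·ᴸ f) *ᴸ g ≋ c ·ᴸ (f *ᴸ g)
·-* c f g = begin
  (c ·ᴸ f) *ᴸ g       ≈⟨ L.*-congʳ (·≋const c f) ⟩
  const c *ᴸ f *ᴸ g   ≈⟨ L.*-assoc (const c) f g ⟩
  const c *ᴸ (f *ᴸ g) ≈⟨ ·≋const c (f *ᴸ g) ⟨
  c ·ᴸ (f *ᴸ g)       ∎
  where open L-Reasoning

*-· : ∀ c f g → f *ᴸ (c ·ᴸ g) ≋ c ·ᴸ (f *ᴸ g)
*-· c f g = L.trans (L.*-comm f (c ·ᴸ g)) (L.trans (·-* c g f) (·-cong K.refl (L.*-comm g f)))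

·-· : ∀ c d f → c ·ᴸ d ·ᴸ f ≋ (c * d) ·ᴸ f
·-· c d f = begin
  c ·ᴸ d ·ᴸ f               ≈⟨ ·≋const c (d ·ᴸ f) ⟩
  const c *ᴸ (d ·ᴸ f)       ≈⟨ L.*-congˡ (·≋const d f) ⟩
  const c *ᴸ (const d *ᴸ f) ≈⟨ L.*-assoc (const c) (const d) f ⟨
  const c *ᴸ const d *ᴸ f   ≈⟨ L.*-congʳ (const-* c d) ⟨
  const (c * d) *ᴸ f        ≈⟨ ·≋const (c * d) f ⟨
  (c * d) ·ᴸ f              ∎
  where open L-Reasoning

1· : ∀ f → 1# ·ᴸ f ≋ f
1· f = L.trans (·≋const 1# f) (L.*-identityˡ f)

0· : ∀ f → 0# ·ᴸ f ≋ 0ᴸ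
0· f = L.trans (·≋const 0# f) (L.trans (L.*-congʳ const-0) (L.zeroˡ f))

·-zeroʳ : ∀ c {f} → f ≋ 0ᴸ → c ·ᴸ f ≋ 0ᴸ
·-zeroʳ c e = ·-cong K.refl e

record Linear (A : Operator) : Set where
  field
    ≋-cong : ∀ {f g} → f ≋ g → A f ≋ A g
    +-homo : ∀ f g → A (f +ᴸ g) ≋ A f +ᴸ A g
    ·-homo : ∀ c f → A (c ·ᴸ f) ≋ c ·ᴸ A f

  zero-homo : A 0ᴸ ≋ 0ᴸ
  zero-homo = L.trans (·-homo 0# 0ᴸ) (0· (A 0ᴸ))

  vanishes : ∀ {f} → f ≋ 0ᴸ → A f ≋ 0ᴸ
  vanishes e = L.trans (≋-cong e) zero-homo

  cons : ∀ c u f → A ((c , u) ∷ f) ≋ c ·ᴸ A (monomial u) +ᴸ A f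
  cons c u f = begin
    A ([ (c , u) ] +ᴸ f)         ≈⟨ +-homo [ (c , u) ] f ⟩
    A [ (c , u) ] +ᴸ A f         ≈⟨ L.+-congʳ (≋-cong (eval⇒≋ λ _ → K.+-congʳ (K.*-congʳ (K.sym (K.*-identityʳ c))))) ⟩
    A (c ·ᴸ monomial u) +ᴸ A f   ≈⟨ L.+-congʳ (·-homo c (monomial u)) ⟩
    c ·ᴸ A (monomial u) +ᴸ A f   ∎
    where open L-Reasoning

linear-ext : ∀ {A B} → Linear A → Linear B → (∀ u → A (monomial u) ≋ B (monomial u)) → ∀ f → A f ≋ B f
linear-ext a b e []            = L.trans (Linear.zero-homo a) (L.sym (Linear.zero-homo b))
linear-ext a b e ((c , u) ∷ f) = L.trans (Linear.cons a c u f)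
  (L.trans (L.+-cong (·-cong K.refl (e u)) (linear-ext a b e f)) (L.sym (Linear.cons b c u f)))

isLinear⇒linear : ∀ {A} → IsLinear A → Linear A
isLinear⇒linear lin = record
  { ≋-cong = λ e → fromᴸ (⟦⟧-cong (toᴸ e))
  ; +-homo = λ f g → fromᴸ (+ᴹ-homo f g)
  ; ·-homo = λ c f → fromᴸ (*ₗ-homo c f)
  }
  where open LeftModuleMorphisms.IsLeftModuleHomomorphism lin

id-linear : Linear id
id-linear = record { ≋-cong = id ; +-homo = λ _ _ → L.refl ; ·-homo = λ _ _ → L.refl }

∘-linear : ∀ {A B} → Linear A → Linear B → Linear (A ∘ B)
∘-linear a b = record
  { ≋-cong = a.≋-cong ∘ b.≋-cong
  ; +-homo = λ f g → L.trans (a.≋-cong (b.+-homo f g)) (a.+-homo _ _)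
  ; ·-homo = λ c f → L.trans (a.≋-cong (b.·-homo c f)) (a.·-homo c _)
  }
  where
  module a = Linear a
  module b = Linear b

⊕-linear : ∀ {A B} → Linear A → Linear B → Linear (A ⊕ B)
⊕-linear {A} {B} a b = record
  { ≋-cong = λ e → L.+-cong (a.≋-cong e) (b.≋-cong e)
  ; +-homo = λ f g → L.trans (L.+-cong (a.+-homo f g) (b.+-homo f g))
      (solveᴸ 4 (λ x y z w → (x :+ᴸ y) :+ᴸ (z :+ᴸ w) :=ᴸ (x :+ᴸ z) :+ᴸ (y :+ᴸ w)) L.refl (A f) (A g) (B f) (B g))
  ; ·-homo = λ c f → L.trans (L.+-cong (a.·-homo c f) (b.·-homo c f)) (L.sym (·-+ c (A f) (B f)))
  }
  where
  module a = Linear a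
  module b = Linear b

⊙-linear : ∀ {A} c → Linear A → Linear (c ⊙ A)
⊙-linear {A} c a = record
  { ≋-cong = λ e → ·-cong K.refl (a.≋-cong e)
  ; +-homo = λ f g → L.trans (·-cong K.refl (a.+-homo f g)) (·-+ c (A f) (A g))
  ; ·-homo = λ d f → L.trans (·-cong K.refl (a.·-homo d f))
      (L.trans (·-· c d (A f)) (L.trans (·-cong (K.*-comm c d) L.refl) (L.sym (·-· d c (A f)))))
  }
  where module a = Linear a

*-linearˡ : ∀ g → Linear (g *ᴸ_)
*-linearˡ g = record { ≋-cong = L.*-congˡ ; +-homo = L.distribˡ g ; ·-homo = λ c f → *-· c g f }

*-linearʳ : ∀ g → Linear (_*ᴸ g)
*-linearʳ g = record { ≋-cong = L.*-congʳ ; +-homo = L.distribʳ g ; ·-homo = λ c f → ·-* c f g }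

linear-≋ : ∀ {A B} → (∀ f → A f ≋ B f) → Linear A → Linear B
linear-≋ e a = record
  { ≋-cong = λ {f} {g} e′ → L.trans (L.sym (e f)) (L.trans (a.≋-cong e′) (e g))
  ; +-homo = λ f g → L.trans (L.sym (e (f +ᴸ g))) (L.trans (a.+-homo f g) (L.+-cong (e f) (e g)))
  ; ·-homo = λ c f → L.trans (L.sym (e (c ·ᴸ f))) (L.trans (a.·-homo c f) (·-cong K.refl (e f)))
  }
  where module a = Linear a

eval-linearExtension : ∀ G F f → eval G (linearExtension F f) ≈ eval (λ u → eval G (linearExtension F (monomial u))) f
eval-linearExtension G F f = K.trans (eval-concatMap G F f)
  (eval-cong (λ u → K.sym (K.trans (eval-concatMap G F (monomial u)) (solve 1 (λ x → con 1ℤ :* x :+ con 0ℤ := x) K.refl (eval G (F u))))) f)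

-- The condition ensures compatibility with `_≋_`, which identifies permuted words. It speaks of
-- `linearExtension F (monomial u)` instead of `F u` because the F of `∂` is a local function that
-- cannot be named.
linearExtension-linear : ∀ F → (∀ {u v} → u ↭ v → linearExtension F (monomial u) ≋ linearExtension F (monomial v)) →
  Linear (linearExtension F)
linearExtension-linear F e = record
  { ≋-cong = λ {f} {g} f≋g → eval⇒≋ λ {G} inv → K.trans (eval-linearExtension G F f)
      (K.trans (≋⇒eval f≋g (λ u↭v → ≋⇒eval (e u↭v) inv)) (K.sym (eval-linearExtension G F g)))
  ; +-homo = λ f g → eval⇒≋ λ {G} inv → begin
      eval G (linearExtension F (f +ᴸ g))       ≈⟨ eval-concatMap G F (f +ᴸ g) ⟩
      eval (eval G ∘ F) (f +ᴸ g)                ≈⟨ eval-++ _ f g ⟩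
      eval (eval G ∘ F) f + eval (eval G ∘ F) g ≈⟨ K.+-cong (eval-concatMap G F f) (eval-concatMap G F g) ⟨
      eval G (linearExtension F f) + eval G (linearExtension F g) ≈⟨ eval-++ G (linearExtension F f) _ ⟨
      eval G (linearExtension F f +ᴸ linearExtension F g) ∎
  ; ·-homo = λ c f → eval⇒≋ λ {G} inv → begin
      eval G (linearExtension F (c ·ᴸ f))       ≈⟨ eval-concatMap G F (c ·ᴸ f) ⟩
      eval (eval G ∘ F) (c ·ᴸ f)                ≈⟨ eval-scale _ c f ⟩
      c * eval (eval G ∘ F) f                   ≈⟨ K.*-congˡ (eval-concatMap G F f) ⟨
      c * eval G (linearExtension F f)          ≈⟨ eval-scale G c (linearExtension F f) ⟨
      eval G (c ·ᴸ linearExtension F f)         ∎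
  }
  where open K-Reasoning

linearExtension-monomial : ∀ F u → linearExtension F (monomial u) ≋ F u
linearExtension-monomial F u = L.trans (L.+-identityʳ _) (1· (F u))

monomial-↭ : ∀ {u v} → u ↭ v → monomial u ≋ monomial v
monomial-↭ u↭v = eval⇒≋ λ inv → K.+-congʳ (K.*-congˡ (inv u↭v))

-- Multiplication by power sums and partial derivatives

P : ℕ → Λ
P zero    = 0ᴸ
P (suc i) = monomial [ i ]

p≋* : ∀ k f → p k f ≋ P k *ᴸ f
p≋* zero    f = L.sym (L.zeroˡ f)
p≋* (suc i) f = eval⇒≋ λ {G} _ → K.trans (eval-map₂ G (i ∷_) f)
  (K.sym (K.trans (eval-product G (P (suc i)) f) (solve 1 (λ x → con 1ℤ :* x :+ con 0ℤ := x) K.refl (eval (λ v → G (i ∷ v)) f))))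

p-linear : ∀ k → Linear (p k)
p-linear k = linear-≋ (λ f → L.sym (p≋* k f)) (*-linearˡ (P k))

δ : ℕ → ℕ → Λ
δ k l = if does (k ℕ.≟ l) then 1ᴸ else 0ᴸ

private
  -- Stated for arbitrary f and g, since in `∂-∷` the value of the local `∂-word` is supplied by
  -- unification.
  ∂-word-step : ∀ i f g → 1# ·ᴸ (f +ᴸ p (suc i) g) +ᴸ 0ᴸ ≋ f +ᴸ p (suc i) (1# ·ᴸ g +ᴸ 0ᴸ)
  ∂-word-step i f g = L.trans (L.+-identityʳ _) (L.trans (1· _)
    (L.+-congˡ (Linear.≋-cong (p-linear (suc i)) (L.sym (L.trans (L.+-identityʳ _) (1· g))))))

∂-∷ : ∀ k i u → ∂ k (monomial (i ∷ u)) ≋ δ k (suc i) *ᴸ monomial u +ᴸ P (suc i) *ᴸ ∂ k (monomial u)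
∂-∷ k i u = L.trans (∂-word-step i (if does (k ℕ.≟ suc i) then monomial u else 0ᴸ) _) (L.+-cong lead (p≋* (suc i) _))
  where
  lead : (if does (k ℕ.≟ suc i) then monomial u else 0ᴸ) ≋ δ k (suc i) *ᴸ monomial u
  lead with does (k ℕ.≟ suc i)
  ... | true  = L.sym (L.*-identityˡ (monomial u))
  ... | false = L.sym (L.zeroˡ _)

∂-linear : ∀ k → Linear (∂ k)
∂-linear k = linearExtension-linear _ perm
  where
  open L-Reasoning
  perm : ∀ {u v} → u ↭ v → ∂ k (monomial u) ≋ ∂ k (monomial v)
  perm ↭.refl = L.refl
  perm (prep {u} {v} i e) = begin
    ∂ k (monomial (i ∷ u))                                        ≈⟨ ∂-∷ k i u ⟩
    δ k (suc i) *ᴸ monomial u +ᴸ P (suc i) *ᴸ ∂ k (monomial u)    ≈⟨ L.+-cong (L.*-congˡ (monomial-↭ e)) (L.*-congˡ (perm e)) ⟩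
    δ k (suc i) *ᴸ monomial v +ᴸ P (suc i) *ᴸ ∂ k (monomial v)    ≈⟨ ∂-∷ k i v ⟨
    ∂ k (monomial (i ∷ v))                                        ∎
  perm (swap {u} {v} i j e) = begin
    ∂ k (monomial (i ∷ j ∷ u))                                    ≈⟨ twice i j u ⟩
    δ k (suc i) *ᴸ (P (suc j) *ᴸ monomial u) +ᴸ P (suc i) *ᴸ (δ k (suc j) *ᴸ monomial u +ᴸ P (suc j) *ᴸ ∂ k (monomial u))
      ≈⟨ L.+-cong (L.*-congˡ (L.*-congˡ (monomial-↭ e))) (L.*-congˡ (L.+-cong (L.*-congˡ (monomial-↭ e)) (L.*-congˡ (perm e)))) ⟩
    δ k (suc i) *ᴸ (P (suc j) *ᴸ monomial v) +ᴸ P (suc i) *ᴸ (δ k (suc j) *ᴸ monomial v +ᴸ P (suc j) *ᴸ ∂ k (monomial v))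
      ≈⟨ solveᴸ 6 (λ di dj pi pj v d → di :*ᴸ (pj :*ᴸ v) :+ᴸ pi :*ᴸ (dj :*ᴸ v :+ᴸ pj :*ᴸ d)
           :=ᴸ dj :*ᴸ (pi :*ᴸ v) :+ᴸ pj :*ᴸ (di :*ᴸ v :+ᴸ pi :*ᴸ d)) L.refl
           (δ k (suc i)) (δ k (suc j)) (P (suc i)) (P (suc j)) (monomial v) (∂ k (monomial v)) ⟩
    δ k (suc j) *ᴸ (P (suc i) *ᴸ monomial v) +ᴸ P (suc j) *ᴸ (δ k (suc i) *ᴸ monomial v +ᴸ P (suc i) *ᴸ ∂ k (monomial v))
      ≈⟨ twice j i v ⟨
    ∂ k (monomial (j ∷ i ∷ v))                                    ∎
    where
    twice : ∀ i j u → ∂ k (monomial (i ∷ j ∷ u)) ≋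
      δ k (suc i) *ᴸ (P (suc j) *ᴸ monomial u) +ᴸ P (suc i) *ᴸ (δ k (suc j) *ᴸ monomial u +ᴸ P (suc j) *ᴸ ∂ k (monomial u))
    twice i j u = L.trans (∂-∷ k i (j ∷ u)) (L.+-cong (L.*-congˡ (p≋* (suc j) (monomial u))) (L.*-congˡ (∂-∷ k j u)))
  perm (↭.trans e f) = L.trans (perm e) (perm f)

∂-P* : ∀ k i f → ∂ k (P (suc i) *ᴸ f) ≋ δ k (suc i) *ᴸ f +ᴸ P (suc i) *ᴸ ∂ k f
∂-P* k i = linear-ext
  (∘-linear (∂-linear k) (*-linearˡ (P (suc i))))
  (⊕-linear (*-linearˡ (δ k (suc i))) (∘-linear (*-linearˡ (P (suc i))) (∂-linear k)))
  (λ u → L.trans (Linear.≋-cong (∂-linear k) (L.sym (p≋* (suc i) (monomial u)))) (∂-∷ k i u))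

∂-* : ∀ k f g → ∂ k (f *ᴸ g) ≋ ∂ k f *ᴸ g +ᴸ f *ᴸ ∂ k g
∂-* k f g = linear-ext
  (∘-linear (∂-linear k) (*-linearʳ g))
  (⊕-linear (∘-linear (*-linearʳ g) (∂-linear k)) (*-linearʳ (∂ k g)))
  word f
  where
  open L-Reasoning
  word : ∀ u → ∂ k (monomial u *ᴸ g) ≋ ∂ k (monomial u) *ᴸ g +ᴸ monomial u *ᴸ ∂ k g
  word [] = L.trans (Linear.≋-cong (∂-linear k) (L.*-identityˡ g)) (L.sym (L.+-cong (L.zeroˡ g) (L.*-identityˡ (∂ k g))))
  word (i ∷ u) = begin
    ∂ k (monomial (i ∷ u) *ᴸ g)
      ≈⟨ Linear.≋-cong (∂-linear k) (L.trans (L.*-congʳ (p≋* (suc i) (monomial u))) (L.*-assoc (P (suc i)) (monomial u) g)) ⟩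
    ∂ k (P (suc i) *ᴸ (monomial u *ᴸ g))
      ≈⟨ ∂-P* k i (monomial u *ᴸ g) ⟩
    δ k (suc i) *ᴸ (monomial u *ᴸ g) +ᴸ P (suc i) *ᴸ ∂ k (monomial u *ᴸ g)
      ≈⟨ L.+-congˡ (L.*-congˡ (word u)) ⟩
    δ k (suc i) *ᴸ (monomial u *ᴸ g) +ᴸ P (suc i) *ᴸ (∂ k (monomial u) *ᴸ g +ᴸ monomial u *ᴸ ∂ k g)
      ≈⟨ solveᴸ 6 (λ d u g p du dg → d :*ᴸ (u :*ᴸ g) :+ᴸ p :*ᴸ (du :*ᴸ g :+ᴸ u :*ᴸ dg)
           :=ᴸ (d :*ᴸ u :+ᴸ p :*ᴸ du) :*ᴸ g :+ᴸ (p :*ᴸ u) :*ᴸ dg) L.refl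
           (δ k (suc i)) (monomial u) g (P (suc i)) (∂ k (monomial u)) (∂ k g) ⟩
    (δ k (suc i) *ᴸ monomial u +ᴸ P (suc i) *ᴸ ∂ k (monomial u)) *ᴸ g +ᴸ (P (suc i) *ᴸ monomial u) *ᴸ ∂ k g
      ≈⟨ L.+-cong (L.*-congʳ (∂-∷ k i u)) (L.*-congʳ (p≋* (suc i) (monomial u))) ⟨
    ∂ k (monomial (i ∷ u)) *ᴸ g +ᴸ monomial (i ∷ u) *ᴸ ∂ k g ∎

∂-comm : ∀ k l f → ∂ k (∂ l f) ≋ ∂ l (∂ k f)
∂-comm k l = linear-ext (∘-linear (∂-linear k) (∂-linear l)) (∘-linear (∂-linear l) (∂-linear k)) word
  where
  open L-Reasoning
  const-∂ : ∀ k l i f → ∂ k (δ l (suc i) *ᴸ f) ≋ δ l (suc i) *ᴸ ∂ k f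
  const-∂ k l i f with does (l ℕ.≟ suc i)
  ... | true  = L.trans (Linear.≋-cong (∂-linear k) (L.*-identityˡ f)) (L.sym (L.*-identityˡ (∂ k f)))
  ... | false = L.trans (Linear.vanishes (∂-linear k) (L.zeroˡ f)) (L.sym (L.zeroˡ (∂ k f)))
  expand : ∀ k l i u → ∂ k (∂ l (monomial (i ∷ u))) ≋
    δ l (suc i) *ᴸ ∂ k (monomial u) +ᴸ (δ k (suc i) *ᴸ ∂ l (monomial u) +ᴸ P (suc i) *ᴸ ∂ k (∂ l (monomial u)))
  expand k l i u = L.trans (Linear.≋-cong (∂-linear k) (∂-∷ l i u))
    (L.trans (Linear.+-homo (∂-linear k) (δ l (suc i) *ᴸ monomial u) _) (L.+-cong (const-∂ k l i (monomial u)) (∂-P* k i _)))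
  word : ∀ u → ∂ k (∂ l (monomial u)) ≋ ∂ l (∂ k (monomial u))
  word []      = L.refl
  word (i ∷ u) = begin
    ∂ k (∂ l (monomial (i ∷ u)))  ≈⟨ expand k l i u ⟩
    δ l (suc i) *ᴸ ∂ k (monomial u) +ᴸ (δ k (suc i) *ᴸ ∂ l (monomial u) +ᴸ P (suc i) *ᴸ ∂ k (∂ l (monomial u)))
      ≈⟨ L.+-congˡ {δ l (suc i) *ᴸ ∂ k (monomial u)} (L.+-congˡ {δ k (suc i) *ᴸ ∂ l (monomial u)} (L.*-congˡ (word u))) ⟩
    δ l (suc i) *ᴸ ∂ k (monomial u) +ᴸ (δ k (suc i) *ᴸ ∂ l (monomial u) +ᴸ P (suc i) *ᴸ ∂ l (∂ k (monomial u)))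
      ≈⟨ solveᴸ 3 (λ a b c → a :+ᴸ (b :+ᴸ c) :=ᴸ b :+ᴸ (a :+ᴸ c)) L.refl
           (δ l (suc i) *ᴸ ∂ k (monomial u)) (δ k (suc i) *ᴸ ∂ l (monomial u)) _ ⟩
    δ k (suc i) *ᴸ ∂ l (monomial u) +ᴸ (δ l (suc i) *ᴸ ∂ k (monomial u) +ᴸ P (suc i) *ᴸ ∂ l (∂ k (monomial u)))
      ≈⟨ expand l k i u ⟨
    ∂ l (∂ k (monomial (i ∷ u)))  ∎

∂-vanishes : ∀ k u → degree u < k → ∂ k (monomial u) ≋ 0ᴸ
∂-vanishes k []      _ = L.refl
∂-vanishes k (i ∷ u) d<k = begin
  ∂ k (monomial (i ∷ u))                                      ≈⟨ ∂-∷ k i u ⟩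
  δ k (suc i) *ᴸ monomial u +ᴸ P (suc i) *ᴸ ∂ k (monomial u)
    ≈⟨ L.+-cong (L.*-congʳ (L.reflexive (cong (λ b → if b then 1ᴸ else 0ᴸ) (dec-false (k ℕ.≟ suc i) k≢))))
                (L.*-congˡ (∂-vanishes k u (ℕ.≤-<-trans (ℕ.m≤n+m (degree u) (suc i)) d<k))) ⟩
  0ᴸ *ᴸ monomial u +ᴸ P (suc i) *ᴸ 0ᴸ                         ≈⟨ L.+-cong (L.zeroˡ (monomial u)) (L.zeroʳ (P (suc i))) ⟩
  0ᴸ                                                          ∎
  where
  open L-Reasoning
  k≢ : k ≢ suc i
  k≢ ≡.refl = ℕ.<⇒≱ d<k (ℕ.m≤m+n (suc i) (degree u))

D-linear : ∀ k → Linear (D k)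
D-linear k = ⊙-linear (fromℕ k) (∂-linear k)

D-* : ∀ k f g → D k (f *ᴸ g) ≋ D k f *ᴸ g +ᴸ f *ᴸ D k g
D-* k f g = L.trans (·-cong K.refl (∂-* k f g)) (L.trans (·-+ _ (∂ k f *ᴸ g) (f *ᴸ ∂ k g))
  (L.+-cong (L.sym (·-* _ (∂ k f) g)) (L.sym (*-· _ f (∂ k g)))))

D-comm : ∀ k l f → D k (D l f) ≋ D l (D k f)
D-comm k l f = begin
  D k (D l f)                              ≈⟨ ·-cong K.refl (Linear.·-homo (∂-linear k) (fromℕ l) (∂ l f)) ⟩
  fromℕ k ·ᴸ fromℕ l ·ᴸ ∂ k (∂ l f)        ≈⟨ ·-· _ _ _ ⟩
  (fromℕ k * fromℕ l) ·ᴸ ∂ k (∂ l f)       ≈⟨ ·-cong (K.*-comm _ _) (∂-comm k l f) ⟩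
  (fromℕ l * fromℕ k) ·ᴸ ∂ l (∂ k f)       ≈⟨ ·-· _ _ _ ⟨
  fromℕ l ·ᴸ fromℕ k ·ᴸ ∂ l (∂ k f)        ≈⟨ ·-cong K.refl (Linear.·-homo (∂-linear l) (fromℕ k) (∂ k f)) ⟨
  D l (D k f)                              ∎
  where open L-Reasoning

D-vanishes : ∀ k u → degree u < k → D k (monomial u) ≋ 0ᴸ
D-vanishes k u d<k = ·-zeroʳ (fromℕ k) (∂-vanishes k u d<k)

D-1 : ∀ k → D k 1ᴸ ≋ 0ᴸ
D-1 k = L.refl

D-P : ∀ k l → D k (P l) ≋ const (fromℕ k) *ᴸ δ k l
D-P k zero with k
... | zero  = L.sym (L.trans (L.*-identityʳ _) const-0)
... | suc k′ = L.sym (L.zeroʳ (const (fromℕ (suc k′))))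
D-P k (suc i) = begin
  fromℕ k ·ᴸ ∂ k (monomial (i ∷ []))                    ≈⟨ ·≋const (fromℕ k) (∂ k (monomial (i ∷ []))) ⟩
  const (fromℕ k) *ᴸ ∂ k (monomial (i ∷ []))            ≈⟨ L.*-congˡ (∂-∷ k i []) ⟩
  const (fromℕ k) *ᴸ (δ k (suc i) *ᴸ 1ᴸ +ᴸ P (suc i) *ᴸ 0ᴸ)
    ≈⟨ L.*-congˡ (L.trans (L.+-cong (L.*-identityʳ _) (L.zeroʳ (P (suc i)))) (L.+-identityʳ _)) ⟩
  const (fromℕ k) *ᴸ δ k (suc i)                        ∎
  where open L-Reasoning

D-P-≡ : ∀ k → D k (P k) ≋ const (fromℕ k)
D-P-≡ k = L.trans (D-P k k) (L.trans (L.*-congˡ (L.reflexive (cong (λ b → if b then 1ᴸ else 0ᴸ) (dec-true (k ℕ.≟ k) ≡.refl)))) (L.*-identityʳ _))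

D-P-≢ : ∀ {k l} → k ≢ l → D k (P l) ≋ 0ᴸ
D-P-≢ {k} {l} k≢l = L.trans (D-P k l) (L.trans (L.*-congˡ (L.reflexive (cong (λ b → if b then 1ᴸ else 0ᴸ) (dec-false (k ℕ.≟ l) k≢l)))) (L.zeroʳ (const (fromℕ k))))

-- Finite and locally finite sums

sumᴸ : ℕ → (ℕ → Λ) → Λ
sumᴸ zero    F = 0ᴸ
sumᴸ (suc n) F = F 0 +ᴸ sumᴸ n (F ∘ suc)

sumᴸ-cong : ∀ n {F G} → (∀ i → F i ≋ G i) → sumᴸ n F ≋ sumᴸ n G
sumᴸ-cong zero    e = L.refl
sumᴸ-cong (suc n) e = L.+-cong (e 0) (sumᴸ-cong n (e ∘ suc))

sumᴸ-0 : ∀ n → sumᴸ n (λ _ → 0ᴸ) ≋ 0ᴸ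
sumᴸ-0 zero    = L.refl
sumᴸ-0 (suc n) = sumᴸ-0 n

sumᴸ-+ : ∀ n F G → sumᴸ n (λ i → F i +ᴸ G i) ≋ sumᴸ n F +ᴸ sumᴸ n G
sumᴸ-+ zero    F G = L.refl
sumᴸ-+ (suc n) F G = L.trans (L.+-congˡ (sumᴸ-+ n (F ∘ suc) (G ∘ suc)))
  (solveᴸ 4 (λ a b c d → (a :+ᴸ b) :+ᴸ (c :+ᴸ d) :=ᴸ (a :+ᴸ c) :+ᴸ (b :+ᴸ d)) L.refl
    (F 0) (G 0) (sumᴸ n (F ∘ suc)) (sumᴸ n (G ∘ suc)))

linear-sumᴸ : ∀ {A} → Linear A → ∀ n F → A (sumᴸ n F) ≋ sumᴸ n (λ i → A (F i))
linear-sumᴸ a zero    F = Linear.zero-homo a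
linear-sumᴸ a (suc n) F = L.trans (Linear.+-homo a (F 0) _) (L.+-congˡ (linear-sumᴸ a n (F ∘ suc)))

sumᴸ-extend : ∀ {m n} → m ≤ n → ∀ F → (∀ i → m ≤ i → F i ≋ 0ᴸ) → sumᴸ n F ≋ sumᴸ m F
sumᴸ-extend {n = n} z≤n F z = L.trans (sumᴸ-cong n (λ i → z i z≤n)) (sumᴸ-0 n)
sumᴸ-extend (s≤s m≤n) F z = L.+-congˡ (sumᴸ-extend m≤n (F ∘ suc) (λ i m≤i → z (suc i) (s≤s m≤i)))

sumᴸ-swap : ∀ m n (F : ℕ → ℕ → Λ) → sumᴸ m (λ i → sumᴸ n (F i)) ≋ sumᴸ n (λ j → sumᴸ m (λ i → F i j))
sumᴸ-swap zero    n F = L.sym (sumᴸ-0 n)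
sumᴸ-swap (suc m) n F = L.trans (L.+-congˡ (sumᴸ-swap m n (F ∘ suc))) (L.sym (sumᴸ-+ n (F 0) _))

concatMap-applyUpTo : ∀ (F : ℕ → Λ) g n → concatMap F (applyUpTo g n) ≡ sumᴸ n (F ∘ g)
concatMap-applyUpTo F g zero    = ≡.refl
concatMap-applyUpTo F g (suc n) = cong (F (g 0) ++_) (concatMap-applyUpTo F (g ∘ suc) n)

record LocallyFinite (A : ℕ → Operator) : Set where
  field
    linear : ∀ k → Linear (A k)
    finite : ∀ k u → degree u < k → A k (monomial u) ≋ 0ᴸ

degree-↭ : ∀ {u v} → u ↭ v → degree u ≡ degree v
degree-↭ e = sum-↭ (↭ₚ.map⁺ suc e)

-- Any common upper bound for the degrees of the terms will do; their sum is easier to handle than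
-- their maximum.
bound : Λ → ℕ
bound []            = 0
bound ((c , u) ∷ f) = degree u ℕ.+ bound f

module _ {A} (a : LocallyFinite A) where
  open LocallyFinite a

  ∑-monomial : ∀ u {n} → degree u ≤ n → ∑ A (monomial u) ≋ sumᴸ n (λ i → A (suc i) (monomial u))
  ∑-monomial u d≤n = L.trans (linearExtension-monomial (λ u → concatMap (λ i → A (suc i) (monomial u)) (upTo (degree u))) u)
    (L.trans (L.reflexive (concatMap-applyUpTo (λ i → A (suc i) (monomial u)) id (degree u)))
             (L.sym (sumᴸ-extend d≤n _ (λ i d≤i → finite (suc i) u (s≤s d≤i)))))

  ∑-linear : Linear (∑ A)
  ∑-linear = linearExtension-linear _ perm
    where
    perm : ∀ {u v} → u ↭ v → ∑ A (monomial u) ≋ ∑ A (monomial v)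
    perm {u} {v} e = L.trans (∑-monomial u (ℕ.≤-reflexive (degree-↭ e)))
      (L.trans (sumᴸ-cong (degree v) (λ i → Linear.≋-cong (linear (suc i)) (monomial-↭ e))) (L.sym (∑-monomial v ℕ.≤-refl)))

  -- The level n is free above the bound, so that several elements, such as f and D₁ f, can share
  -- one truncation.
  ∑-truncate : ∀ f {n} → bound f ≤ n → ∑ A f ≋ sumᴸ n (λ i → A (suc i) f)
  ∑-truncate []            {n} _   = L.sym (L.trans (sumᴸ-cong n (λ i → Linear.zero-homo (linear (suc i)))) (sumᴸ-0 n))
  ∑-truncate ((c , u) ∷ f) {n} b≤n = begin
    ∑ A ((c , u) ∷ f)                                                ≈⟨ Linear.cons ∑-linear c u f ⟩
    c ·ᴸ ∑ A (monomial u) +ᴸ ∑ A f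
      ≈⟨ L.+-cong (·-cong K.refl (∑-monomial u (ℕ.≤-trans (ℕ.m≤m+n (degree u) (bound f)) b≤n)))
                  (∑-truncate f (ℕ.≤-trans (ℕ.m≤n+m (bound f) (degree u)) b≤n)) ⟩
    c ·ᴸ sumᴸ n (λ i → A (suc i) (monomial u)) +ᴸ sumᴸ n (λ i → A (suc i) f)
      ≈⟨ L.+-congʳ (linear-sumᴸ (⊙-linear c id-linear) n _) ⟩
    sumᴸ n (λ i → c ·ᴸ A (suc i) (monomial u)) +ᴸ sumᴸ n (λ i → A (suc i) f)
      ≈⟨ sumᴸ-+ n _ _ ⟨
    sumᴸ n (λ i → c ·ᴸ A (suc i) (monomial u) +ᴸ A (suc i) f)
      ≈⟨ sumᴸ-cong n (λ i → Linear.cons (linear (suc i)) c u f) ⟨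
    sumᴸ n (λ i → A (suc i) ((c , u) ∷ f))                           ∎
    where open L-Reasoning

record LocallyFinite₂ (A : ℕ → ℕ → Operator) : Set where
  field
    linear  : ∀ k l → Linear (A k l)
    finite₁ : ∀ k l u → degree u < k → A k l (monomial u) ≋ 0ᴸ
    finite₂ : ∀ k l u → degree u < l → A k l (monomial u) ≋ 0ᴸ

module _ {A} (a : LocallyFinite₂ A) where
  open LocallyFinite₂ a

  inner : ∀ k → LocallyFinite (A k)
  inner k = record { linear = linear k ; finite = finite₂ k }

  outer : LocallyFinite (λ k → ∑ (A k))
  outer = record
    { linear = λ k → ∑-linear (inner k)
    ; finite = λ k u d<k → L.trans (∑-monomial (inner k) u ℕ.≤-refl)
        (L.trans (sumᴸ-cong (degree u) (λ i → finite₁ k (suc i) u d<k)) (sumᴸ-0 (degree u)))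
    }

  ∑∑-truncate : ∀ f {n} → bound f ≤ n → ∑ (λ k → ∑ (A k)) f ≋ sumᴸ n (λ i → sumᴸ n (λ j → A (suc i) (suc j) f))
  ∑∑-truncate f {n} b≤n = L.trans (∑-truncate outer f b≤n) (sumᴸ-cong n (λ i → ∑-truncate (inner (suc i)) f b≤n))

-- Complete homogeneous symmetric functions, defined by Newton's identity
-- n hₙ = Σ_{k=1}^n p_k h_{n−k}; conv n φ is Σ_{k=1}^n φ_k h_{n−k}.
mutual
  h : ℕ → Λ
  h zero    = 1ᴸ
  h (suc n) = 1/suc n ·ᴸ (P 1 *ᴸ h n +ᴸ conv n (P ∘ suc))

  conv : ℕ → (ℕ → Λ) → Λ
  conv zero    φ = 0ᴸ
  conv (suc n) φ = φ 1 *ᴸ h n +ᴸ conv n (φ ∘ suc)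

κ : ℕ → Λ
κ n = const (fromℕ n)

κ-+ : ∀ m n → κ (m ℕ.+ n) ≋ κ m +ᴸ κ n
κ-+ m n = L.trans (const-cong (fromℕ-+ m n)) (const-+ _ _)

-- The body of `h (suc n)` contains `conv (suc n) P` unfolded once, so that h is called on smaller
-- arguments; multiplication by n undoes the division.
newton : ∀ n → κ n *ᴸ h n ≋ conv n P
newton zero    = L.trans (L.*-identityʳ (κ 0)) const-0
newton (suc n) = begin
  κ (suc n) *ᴸ (1/suc n ·ᴸ conv (suc n) P)           ≈⟨ L.*-congˡ (·≋const (1/suc n) (conv (suc n) P)) ⟩
  κ (suc n) *ᴸ (const (1/suc n) *ᴸ conv (suc n) P)   ≈⟨ L.*-assoc _ _ _ ⟨
  κ (suc n) *ᴸ const (1/suc n) *ᴸ conv (suc n) P     ≈⟨ L.*-congʳ (L.trans (L.*-comm _ _) (L.trans (L.sym (const-* _ _)) (const-cong (1/suc-* n)))) ⟩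
  1ᴸ *ᴸ conv (suc n) P                               ≈⟨ L.*-identityˡ _ ⟩
  conv (suc n) P                                     ∎
  where open L-Reasoning

conv-cong : ∀ n {φ ψ} → (∀ k → φ (suc k) ≋ ψ (suc k)) → conv n φ ≋ conv n ψ
conv-cong zero    e = L.refl
conv-cong (suc n) e = L.+-cong (L.*-congʳ (e 0)) (conv-cong n (e ∘ suc))

conv-+ : ∀ n φ ψ → conv n (λ k → φ k +ᴸ ψ k) ≋ conv n φ +ᴸ conv n ψ
conv-+ zero    φ ψ = L.refl
conv-+ (suc n) φ ψ = L.trans (L.+-congˡ {(φ 1 +ᴸ ψ 1) *ᴸ h n} (conv-+ n (φ ∘ suc) (ψ ∘ suc)))
  (solveᴸ 5 (λ a b c d e → (a :+ᴸ b) :*ᴸ c :+ᴸ (d :+ᴸ e) :=ᴸ (a :*ᴸ c :+ᴸ d) :+ᴸ (b :*ᴸ c :+ᴸ e)) L.refl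
    (φ 1) (ψ 1) (h n) (conv n (φ ∘ suc)) (conv n (ψ ∘ suc)))

conv-* : ∀ n c φ → conv n (λ k → c *ᴸ φ k) ≋ c *ᴸ conv n φ
conv-* zero    c φ = L.sym (L.zeroʳ c)
conv-* (suc n) c φ = L.trans (L.+-congˡ {c *ᴸ φ 1 *ᴸ h n} (conv-* n c (φ ∘ suc)))
  (solveᴸ 4 (λ a b c d → c :*ᴸ a :*ᴸ b :+ᴸ c :*ᴸ d :=ᴸ c :*ᴸ (a :*ᴸ b :+ᴸ d)) L.refl
    (φ 1) (h n) c (conv n (φ ∘ suc)))

conv-0 : ∀ n {φ} → (∀ k → φ (suc k) ≋ 0ᴸ) → conv n φ ≋ 0ᴸ
conv-0 zero    e = L.refl
conv-0 (suc n) e = L.+-cong (L.trans (L.*-congʳ (e 0)) (L.zeroˡ (h n))) (conv-0 n (e ∘ suc))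

-- This is h_{n-k}, with value 0 for k > n, where the truncated subtraction in `h (n ∸ k)` would
-- give h₀ = 1.
h↓ : ℕ → ℕ → Λ
h↓ n       zero    = h n
h↓ zero    (suc k) = 0ᴸ
h↓ (suc n) (suc k) = h↓ n k

h↓-≤ : ∀ {n k} → k ≤ n → h↓ n k ≡ h (n ∸ k)
h↓-≤ {n}     {zero}  z≤n       = ≡.refl
h↓-≤ {suc n} {suc k} (s≤s k≤n) = h↓-≤ k≤n

h↓-> : ∀ {n k} → n < k → h↓ n k ≡ 0ᴸ
h↓-> {zero}  {suc k} _         = ≡.refl
h↓-> {suc n} {suc k} (s≤s n<k) = h↓-> n<k

conv-δ : ∀ k n → conv n (δ (suc k)) ≋ h↓ n (suc k)
conv-δ k       zero    = L.refl
conv-δ zero    (suc n) = L.trans (L.+-cong (L.*-identityˡ (h n)) (conv-0 n (λ _ → L.refl))) (L.+-identityʳ (h n))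
conv-δ (suc k) (suc n) = L.trans (L.+-congʳ (L.zeroˡ (h n))) (conv-δ k n)

-- One unfolding of `conv (n ∸ k)`. For k ≥ n both sides vanish: `h↓` is 0 and the truncated
-- subtractions leave empty sums.
conv-↓ : ∀ n k φ → φ 1 *ᴸ h↓ n (suc k) +ᴸ conv (n ∸ suc k) (φ ∘ suc) ≋ conv (n ∸ k) φ
conv-↓ zero    zero    φ = L.+-congʳ (L.zeroʳ (φ 1))
conv-↓ zero    (suc k) φ = L.+-congʳ (L.zeroʳ (φ 1))
conv-↓ (suc n) zero    φ = L.refl
conv-↓ (suc n) (suc k) φ = conv-↓ n k φ

-- Past n the factors `h↓` vanish, so the truncation level N disappears from the result.
sumᴸ≋conv : ∀ {n N} → n ≤ N → ∀ φ → sumᴸ N (λ i → φ (suc i) *ᴸ h↓ n (suc i)) ≋ conv n φ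
sumᴸ≋conv {zero}  {N} z≤n φ = L.trans (sumᴸ-cong N (λ i → L.zeroʳ (φ (suc i)))) (sumᴸ-0 N)
sumᴸ≋conv {suc n} (s≤s n≤N) φ = L.+-congˡ {φ 1 *ᴸ h n} (sumᴸ≋conv n≤N (φ ∘ suc))

-- With K = k + 1, for K ≤ n this is K + (n - K) = n. Otherwise `h↓` is 0, and `κ (n ∸ suc k)` is 0
-- as well.
D-·conv : ∀ k n → κ (suc k) *ᴸ h↓ n (suc k) +ᴸ κ (n ∸ suc k) *ᴸ h (n ∸ suc k) ≋ κ n *ᴸ h↓ n (suc k)
D-·conv k n with suc k ℕ.≤? n
... | yes k<n = begin
  κ (suc k) *ᴸ h↓ n (suc k) +ᴸ κ (n ∸ suc k) *ᴸ h (n ∸ suc k)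
    ≈⟨ L.+-cong (L.*-congˡ (L.reflexive (h↓-≤ k<n))) L.refl ⟩
  κ (suc k) *ᴸ h (n ∸ suc k) +ᴸ κ (n ∸ suc k) *ᴸ h (n ∸ suc k)
    ≈⟨ L.distribʳ (h (n ∸ suc k)) (κ (suc k)) (κ (n ∸ suc k)) ⟨
  (κ (suc k) +ᴸ κ (n ∸ suc k)) *ᴸ h (n ∸ suc k)
    ≈⟨ L.*-cong (L.sym (κ-+ (suc k) (n ∸ suc k))) (L.reflexive (≡.sym (h↓-≤ k<n))) ⟩
  κ (suc k ℕ.+ (n ∸ suc k)) *ᴸ h↓ n (suc k)
    ≈⟨ L.*-congʳ (L.reflexive (cong κ (ℕ.m+[n∸m]≡n k<n))) ⟩
  κ n *ᴸ h↓ n (suc k) ∎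
  where open L-Reasoning
... | no k≮n = begin
  κ (suc k) *ᴸ h↓ n (suc k) +ᴸ κ (n ∸ suc k) *ᴸ h (n ∸ suc k)
    ≈⟨ L.+-cong (L.*-congˡ {κ (suc k)} zero↓) (L.*-congʳ (L.trans (L.reflexive (cong κ (ℕ.m≤n⇒m∸n≡0 (ℕ.<⇒≤ (ℕ.≰⇒> k≮n))))) const-0)) ⟩
  κ (suc k) *ᴸ 0ᴸ +ᴸ 0ᴸ *ᴸ h (n ∸ suc k)
    ≈⟨ L.+-cong (L.zeroʳ (κ (suc k))) (L.zeroˡ (h (n ∸ suc k))) ⟩
  0ᴸ
    ≈⟨ L.zeroʳ (κ n) ⟨
  κ n *ᴸ 0ᴸ
    ≈⟨ L.*-congˡ zero↓ ⟨
  κ n *ᴸ h↓ n (suc k) ∎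
  where
  open L-Reasoning
  zero↓ : h↓ n (suc k) ≋ 0ᴸ
  zero↓ = L.reflexive (h↓-> (ℕ.≰⇒> k≮n))

mutual
  -- In generating functions, H(t) = exp (Σ p_k t^k / k) gives D_k H = t^k H. Here D_k is applied to
  -- Newton's identity: n D_k h_n = k h_{n-k} + Σ p_i h_{n-k-i}, and the last sum is (n-k) h_{n-k}
  -- by Newton again.
  D-h : ∀ k n → D (suc k) (h n) ≋ h↓ n (suc k)
  D-h k zero    = D-1 (suc k)
  D-h k (suc n) = begin
    D (suc k) (1/suc n ·ᴸ conv (suc n) P)   ≈⟨ Linear.·-homo (D-linear (suc k)) (1/suc n) (conv (suc n) P) ⟩
    1/suc n ·ᴸ D (suc k) (conv (suc n) P)
      ≈⟨ ·-cong K.refl (D-conv-step k n P (D-h k n) (D-conv k n (P ∘ suc))) ⟩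
    1/suc n ·ᴸ (conv (suc n) (λ i → D (suc k) (P i)) +ᴸ conv (n ∸ k) P)
      ≈⟨ ·-cong K.refl (L.+-cong (L.trans (conv-cong (suc n) {λ i → D (suc k) (P i)} {λ i → κ (suc k) *ᴸ δ (suc k) i} (λ i → D-P (suc k) (suc i)))
           (L.trans (conv-* (suc n) (κ (suc k)) (δ (suc k))) (L.*-congˡ (conv-δ k (suc n))))) (L.sym (newton (n ∸ k)))) ⟩
    1/suc n ·ᴸ (κ (suc k) *ᴸ h↓ n k +ᴸ κ (n ∸ k) *ᴸ h (n ∸ k))
      ≈⟨ ·-cong K.refl (D-·conv k (suc n)) ⟩
    1/suc n ·ᴸ (κ (suc n) *ᴸ h↓ n k)
      ≈⟨ ·≋const (1/suc n) _ ⟩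
    const (1/suc n) *ᴸ (κ (suc n) *ᴸ h↓ n k)
      ≈⟨ L.*-assoc _ _ _ ⟨
    const (1/suc n) *ᴸ κ (suc n) *ᴸ h↓ n k
      ≈⟨ L.*-congʳ (L.trans (L.sym (const-* _ _)) (const-cong (1/suc-* n))) ⟩
    1ᴸ *ᴸ h↓ n k
      ≈⟨ L.*-identityˡ (h↓ n k) ⟩
    h↓ n k ∎
    where open L-Reasoning

  D-conv : ∀ k n φ → D (suc k) (conv n φ) ≋ conv n (λ i → D (suc k) (φ i)) +ᴸ conv (n ∸ suc k) φ
  D-conv k zero    φ = L.refl
  D-conv k (suc n) φ = D-conv-step k n φ (D-h k n) (D-conv k n (φ ∘ suc))

  D-conv-step : ∀ k n φ → D (suc k) (h n) ≋ h↓ n (suc k) →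
    D (suc k) (conv n (φ ∘ suc)) ≋ conv n (λ i → D (suc k) (φ (suc i))) +ᴸ conv (n ∸ suc k) (φ ∘ suc) →
    D (suc k) (conv (suc n) φ) ≋ conv (suc n) (λ i → D (suc k) (φ i)) +ᴸ conv (n ∸ k) φ
  D-conv-step k n φ Dh Dconv = begin
    D (suc k) (φ 1 *ᴸ h n +ᴸ conv n (φ ∘ suc))
      ≈⟨ Linear.+-homo (D-linear (suc k)) (φ 1 *ᴸ h n) (conv n (φ ∘ suc)) ⟩
    D (suc k) (φ 1 *ᴸ h n) +ᴸ D (suc k) (conv n (φ ∘ suc))
      ≈⟨ L.+-cong (L.trans (D-* (suc k) (φ 1) (h n)) (L.+-congˡ {D (suc k) (φ 1) *ᴸ h n} (L.*-congˡ Dh))) Dconv ⟩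
    (D (suc k) (φ 1) *ᴸ h n +ᴸ φ 1 *ᴸ h↓ n (suc k)) +ᴸ (conv n (λ i → D (suc k) (φ (suc i))) +ᴸ conv (n ∸ suc k) (φ ∘ suc))
      ≈⟨ solveᴸ 4 (λ a b c d → (a :+ᴸ b) :+ᴸ (c :+ᴸ d) :=ᴸ (a :+ᴸ c) :+ᴸ (b :+ᴸ d)) L.refl
           (D (suc k) (φ 1) *ᴸ h n) (φ 1 *ᴸ h↓ n (suc k)) (conv n (λ i → D (suc k) (φ (suc i)))) (conv (n ∸ suc k) (φ ∘ suc)) ⟩
    conv (suc n) (λ i → D (suc k) (φ i)) +ᴸ (φ 1 *ᴸ h↓ n (suc k) +ᴸ conv (n ∸ suc k) (φ ∘ suc))
      ≈⟨ L.+-congˡ {conv (suc n) (λ i → D (suc k) (φ i))} (conv-↓ n k φ) ⟩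
    conv (suc n) (λ i → D (suc k) (φ i)) +ᴸ conv (n ∸ k) φ ∎
    where open L-Reasoning

Derivation : Operator → Set
Derivation A = ∀ f g → A (f *ᴸ g) ≋ A f *ᴸ g +ᴸ f *ᴸ A g

*-derivation : ∀ {A} c → Derivation A → Derivation (λ f → c *ᴸ A f)
*-derivation {A} c d f g = L.trans (L.*-congˡ (d f g))
  (solveᴸ 5 (λ c a g f b → c :*ᴸ (a :*ᴸ g :+ᴸ f :*ᴸ b) :=ᴸ (c :*ᴸ a) :*ᴸ g :+ᴸ f :*ᴸ (c :*ᴸ b)) L.refl
    c (A f) g f (A g))

sumᴸ-derivation : ∀ n {A : ℕ → Operator} → (∀ i → Derivation (A i)) → Derivation (λ f → sumᴸ n (λ i → A i f))
sumᴸ-derivation zero    d f g = L.sym (L.trans (L.+-cong (L.zeroˡ g) (L.zeroʳ f)) (L.+-identityʳ 0ᴸ))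
sumᴸ-derivation (suc n) {A} d f g = L.trans (L.+-cong (d 0 f g) (sumᴸ-derivation n (d ∘ suc) f g))
  (solveᴸ 6 (λ a f g b s t → (a :*ᴸ g :+ᴸ f :*ᴸ b) :+ᴸ (s :*ᴸ g :+ᴸ f :*ᴸ t)
     :=ᴸ (a :+ᴸ s) :*ᴸ g :+ᴸ f :*ᴸ (b :+ᴸ t)) L.refl
    (A 0 f) f g (A 0 g) (sumᴸ n (λ i → A (suc i) f)) (sumᴸ n (λ i → A (suc i) g)))

-- The three parts of Δ₂, the operator E, and the polarisation Γ of the
-- second order part, all truncated to indices ≤ N.
module _ (N : ℕ) where

  R Q U Eₙ Δₙ : Operator
  R f = sumᴸ N λ i → sumᴸ N λ j → P (suc i) *ᴸ P (suc j) *ᴸ D (suc i ℕ.+ suc j) f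
  Q f = sumᴸ N λ i → sumᴸ N λ j → P (suc i ℕ.+ suc j) *ᴸ D (suc i) (D (suc j) f)
  U f = sumᴸ N λ i → κ i *ᴸ P (suc i) *ᴸ D (suc i) f
  Eₙ f = sumᴸ N λ i → P (suc i) *ᴸ D (suc i) f
  Δₙ f = const α *ᴸ R f +ᴸ Q f +ᴸ const (α - 1#) *ᴸ U f

  Γ : Λ → Λ → Λ
  Γ f g = sumᴸ N λ i → sumᴸ N λ j → P (suc i ℕ.+ suc j) *ᴸ D (suc i) f *ᴸ D (suc j) g

  R-derivation : Derivation R
  R-derivation = sumᴸ-derivation N λ i → sumᴸ-derivation N λ j → *-derivation (P (suc i) *ᴸ P (suc j)) (D-* (suc i ℕ.+ suc j))

  U-derivation : Derivation U
  U-derivation = sumᴸ-derivation N λ i → *-derivation (κ i *ᴸ P (suc i)) (D-* (suc i))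

  Eₙ-derivation : Derivation Eₙ
  Eₙ-derivation = sumᴸ-derivation N λ i → *-derivation (P (suc i)) (D-* (suc i))

  Γ-derivation : ∀ f → Derivation (Γ f)
  Γ-derivation f = sumᴸ-derivation N λ i → sumᴸ-derivation N λ j → *-derivation (P (suc i ℕ.+ suc j) *ᴸ D (suc i) f) (D-* (suc j))

  sumᴸ²-+ : ∀ (F G : ℕ → ℕ → Λ) → sumᴸ N (λ i → sumᴸ N (λ j → F i j +ᴸ G i j)) ≋ sumᴸ N (λ i → sumᴸ N (F i)) +ᴸ sumᴸ N (λ i → sumᴸ N (G i))
  sumᴸ²-+ F G = L.trans (sumᴸ-cong N (λ i → sumᴸ-+ N (F i) (G i))) (sumᴸ-+ N _ _)

  sumᴸ²-linear : ∀ {A} → Linear A → ∀ (F : ℕ → ℕ → Λ) → sumᴸ N (λ i → sumᴸ N (λ j → A (F i j))) ≋ A (sumᴸ N (λ i → sumᴸ N (F i)))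
  sumᴸ²-linear a F = L.sym (L.trans (linear-sumᴸ a N _) (sumᴸ-cong N (λ i → linear-sumᴸ a N (F i))))

  -- The operator is of second order, so its product rule has two mixed terms. Exchanging the
  -- summation indices identifies them, hence the factor 2.
  Q-* : ∀ f g → Q (f *ᴸ g) ≋ Q f *ᴸ g +ᴸ f *ᴸ Q g +ᴸ κ 2 *ᴸ Γ f g
  Q-* f g = begin
    Q (f *ᴸ g)
      ≈⟨ sumᴸ-cong N (λ i → sumᴸ-cong N (term i)) ⟩
    sumᴸ N (λ i → sumᴸ N (λ j → (qf i j *ᴸ g +ᴸ f *ᴸ qg i j) +ᴸ (γ i j +ᴸ γ′ i j)))
      ≈⟨ sumᴸ²-+ (λ i j → qf i j *ᴸ g +ᴸ f *ᴸ qg i j) (λ i j → γ i j +ᴸ γ′ i j) ⟩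
    sumᴸ N (λ i → sumᴸ N (λ j → qf i j *ᴸ g +ᴸ f *ᴸ qg i j)) +ᴸ sumᴸ N (λ i → sumᴸ N (λ j → γ i j +ᴸ γ′ i j))
      ≈⟨ L.+-cong (sumᴸ²-+ (λ i j → qf i j *ᴸ g) (λ i j → f *ᴸ qg i j)) (sumᴸ²-+ γ γ′) ⟩
    (sumᴸ N (λ i → sumᴸ N (λ j → qf i j *ᴸ g)) +ᴸ sumᴸ N (λ i → sumᴸ N (λ j → f *ᴸ qg i j))) +ᴸ (Γ f g +ᴸ sumᴸ N (λ i → sumᴸ N (γ′ i)))
      ≈⟨ L.+-cong (L.+-cong (sumᴸ²-linear (*-linearʳ g) qf) (sumᴸ²-linear (*-linearˡ f) qg)) (L.+-cong L.refl γ′-sum) ⟩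
    (Q f *ᴸ g +ᴸ f *ᴸ Q g) +ᴸ (Γ f g +ᴸ Γ f g)
      ≈⟨ solveᴸ 2 (λ a b → a :+ᴸ (b :+ᴸ b) :=ᴸ a :+ᴸ conᴸ (ℤ.+ 2) :*ᴸ b) L.refl (Q f *ᴸ g +ᴸ f *ᴸ Q g) (Γ f g) ⟩
    Q f *ᴸ g +ᴸ f *ᴸ Q g +ᴸ κ 2 *ᴸ Γ f g ∎
    where
    open L-Reasoning
    qf qg γ γ′ : ℕ → ℕ → Λ
    qf i j = P (suc i ℕ.+ suc j) *ᴸ D (suc i) (D (suc j) f)
    qg i j = P (suc i ℕ.+ suc j) *ᴸ D (suc i) (D (suc j) g)
    γ i j = P (suc i ℕ.+ suc j) *ᴸ D (suc i) f *ᴸ D (suc j) g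
    γ′ i j = P (suc i ℕ.+ suc j) *ᴸ D (suc j) f *ᴸ D (suc i) g
    γ′-sum : sumᴸ N (λ i → sumᴸ N (γ′ i)) ≋ Γ f g
    γ′-sum = L.trans (sumᴸ-swap N N γ′) (sumᴸ-cong N (λ i → sumᴸ-cong N (λ j →
      L.*-congʳ (L.*-congʳ (L.reflexive (cong P (ℕ.+-comm (suc j) (suc i))))))))
    term : ∀ i j → P (suc i ℕ.+ suc j) *ᴸ D (suc i) (D (suc j) (f *ᴸ g)) ≋ (qf i j *ᴸ g +ᴸ f *ᴸ qg i j) +ᴸ (γ i j +ᴸ γ′ i j)
    term i j = L.trans (L.*-congˡ (begin
        D (suc i) (D (suc j) (f *ᴸ g))
          ≈⟨ Linear.≋-cong (D-linear (suc i)) (D-* (suc j) f g) ⟩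
        D (suc i) (D (suc j) f *ᴸ g +ᴸ f *ᴸ D (suc j) g)
          ≈⟨ Linear.+-homo (D-linear (suc i)) (D (suc j) f *ᴸ g) (f *ᴸ D (suc j) g) ⟩
        D (suc i) (D (suc j) f *ᴸ g) +ᴸ D (suc i) (f *ᴸ D (suc j) g)
          ≈⟨ L.+-cong (D-* (suc i) (D (suc j) f) g) (D-* (suc i) f (D (suc j) g)) ⟩
        (D (suc i) (D (suc j) f) *ᴸ g +ᴸ D (suc j) f *ᴸ D (suc i) g) +ᴸ (D (suc i) f *ᴸ D (suc j) g +ᴸ f *ᴸ D (suc i) (D (suc j) g)) ∎))
      (solveᴸ 9 (λ p dd g dj di e e′ f ee → p :*ᴸ ((dd :*ᴸ g :+ᴸ dj :*ᴸ e) :+ᴸ (di :*ᴸ e′ :+ᴸ f :*ᴸ ee))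
          :=ᴸ (p :*ᴸ dd :*ᴸ g :+ᴸ f :*ᴸ (p :*ᴸ ee)) :+ᴸ (p :*ᴸ di :*ᴸ e′ :+ᴸ p :*ᴸ dj :*ᴸ e)) L.refl
        (P (suc i ℕ.+ suc j)) (D (suc i) (D (suc j) f)) g (D (suc j) f) (D (suc i) f) (D (suc i) g) (D (suc j) g) f (D (suc i) (D (suc j) g)))

  -- R and U are of first order, so the deviation from a derivation comes from Q alone.
  Δₙ-* : ∀ f g → Δₙ (f *ᴸ g) ≋ Δₙ f *ᴸ g +ᴸ f *ᴸ Δₙ g +ᴸ κ 2 *ᴸ Γ f g
  Δₙ-* f g = L.trans
    (L.+-cong (L.+-cong (L.*-congˡ (R-derivation f g)) (Q-* f g)) (L.*-congˡ (U-derivation f g)))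
    (solveᴸ 11 (λ a rf g f rg qf qg γ c uf ug →
        a :*ᴸ (rf :*ᴸ g :+ᴸ f :*ᴸ rg) :+ᴸ (qf :*ᴸ g :+ᴸ f :*ᴸ qg :+ᴸ γ) :+ᴸ c :*ᴸ (uf :*ᴸ g :+ᴸ f :*ᴸ ug)
        :=ᴸ (a :*ᴸ rf :+ᴸ qf :+ᴸ c :*ᴸ uf) :*ᴸ g :+ᴸ f :*ᴸ (a :*ᴸ rg :+ᴸ qg :+ᴸ c :*ᴸ ug) :+ᴸ γ) L.refl
      (const α) (R f) g f (R g) (Q f) (Q g) (κ 2 *ᴸ Γ f g) (const (α - 1#)) (U f) (U g))

-- The sum of Φ_{ij} h_{n-i-j} over i, j ≥ 1 with i + j ≤ n.
conv₂ : ℕ → (ℕ → ℕ → Λ) → Λ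
conv₂ zero    Φ = 0ᴸ
conv₂ (suc n) Φ = conv n (Φ 1) +ᴸ conv₂ n (Φ ∘ suc)

sumᴸ²≋conv₂ : ∀ {n M N} → n ≤ M → n ≤ N → ∀ Φ →
  sumᴸ M (λ i → sumᴸ N (λ j → Φ (suc i) (suc j) *ᴸ h↓ n (suc i ℕ.+ suc j))) ≋ conv₂ n Φ
sumᴸ²≋conv₂ {zero} {M} {N} z≤n _ Φ =
  L.trans (sumᴸ-cong M (λ i → L.trans (sumᴸ-cong N (λ j → L.zeroʳ (Φ (suc i) (suc j)))) (sumᴸ-0 N))) (sumᴸ-0 M)
sumᴸ²≋conv₂ {suc n} (s≤s n≤M) n<N Φ =
  L.+-cong (sumᴸ≋conv (ℕ.<⇒≤ n<N) (Φ 1)) (sumᴸ²≋conv₂ n≤M (ℕ.<⇒≤ n<N) (Φ ∘ suc))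

-- There are k - 1 pairs i, j ≥ 1 with i + j = k.
conv₂-diagonal : ∀ n (φ : ℕ → Λ) → conv₂ n (λ i j → φ (i ℕ.+ j)) ≋ conv n (λ k → κ (k ∸ 1) *ᴸ φ k)
conv₂-diagonal zero    φ = L.refl
conv₂-diagonal (suc n) φ = begin
  conv n (φ ∘ suc) +ᴸ conv₂ n (λ i j → φ (suc (i ℕ.+ j)))
    ≈⟨ L.+-congˡ {conv n (φ ∘ suc)} (conv₂-diagonal n (φ ∘ suc)) ⟩
  conv n (φ ∘ suc) +ᴸ conv n (λ k → κ (k ∸ 1) *ᴸ φ (suc k))
    ≈⟨ conv-+ n (φ ∘ suc) (λ k → κ (k ∸ 1) *ᴸ φ (suc k)) ⟨
  conv n (λ k → φ (suc k) +ᴸ κ (k ∸ 1) *ᴸ φ (suc k))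
    ≈⟨ conv-cong n {λ k → φ (suc k) +ᴸ κ (k ∸ 1) *ᴸ φ (suc k)} {λ k → κ k *ᴸ φ (suc k)} (λ k → L.trans
         (solveᴸ 2 (λ a b → b :+ᴸ a :*ᴸ b :=ᴸ (conᴸ 1ℤ :+ᴸ a) :*ᴸ b) L.refl (κ k) (φ (suc (suc k))))
         (L.*-congʳ (L.sym (κ-+ 1 k)))) ⟩
  conv n (λ k → κ k *ᴸ φ (suc k))
    ≈⟨ L.+-identityˡ _ ⟨
  0ᴸ +ᴸ conv n (λ k → κ k *ᴸ φ (suc k))
    ≈⟨ L.+-congʳ (L.trans (L.*-congʳ (L.trans (L.*-congʳ const-0) (L.zeroˡ (φ 1)))) (L.zeroˡ (h n))) ⟨
  κ 0 *ᴸ φ 1 *ᴸ h n +ᴸ conv n (λ k → κ k *ᴸ φ (suc k)) ∎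
  where open L-Reasoning

-- For fixed i, Newton's identity evaluates the sum over j to (n-i) h_{n-i}; the second summand
-- supplies the missing i.
conv₂-product : ∀ n (ψ : ℕ → Λ) → conv₂ n (λ i j → ψ i *ᴸ P j) +ᴸ conv n (λ k → κ k *ᴸ ψ k) ≋ κ n *ᴸ conv n ψ
conv₂-product zero    ψ = L.sym (L.zeroʳ (κ 0))
conv₂-product (suc n) ψ = begin
  (conv n (λ j → ψ 1 *ᴸ P j) +ᴸ conv₂ n (λ i j → ψ (suc i) *ᴸ P j)) +ᴸ (κ 1 *ᴸ ψ 1 *ᴸ h n +ᴸ conv n (λ k → κ (suc k) *ᴸ ψ (suc k)))
    ≈⟨ L.+-cong (L.+-cong (L.trans (conv-* n (ψ 1) P) (L.*-congˡ (L.sym (newton n)))) L.refl)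
         (L.+-congˡ {κ 1 *ᴸ ψ 1 *ᴸ h n} (L.trans (conv-cong n {λ k → κ (suc k) *ᴸ ψ (suc k)} {λ k → ψ (suc k) +ᴸ κ k *ᴸ ψ (suc k)} (λ k → L.trans
           (L.*-congʳ (κ-+ 1 (suc k))) (solveᴸ 2 (λ a b → (conᴸ 1ℤ :+ᴸ a) :*ᴸ b :=ᴸ b :+ᴸ a :*ᴸ b) L.refl (κ (suc k)) (ψ (suc (suc k))))))
           (conv-+ n (ψ ∘ suc) (λ k → κ k *ᴸ ψ (suc k))))) ⟩
  (ψ 1 *ᴸ (κ n *ᴸ h n) +ᴸ conv₂ n (λ i j → ψ (suc i) *ᴸ P j)) +ᴸ (κ 1 *ᴸ ψ 1 *ᴸ h n +ᴸ (conv n (ψ ∘ suc) +ᴸ conv n (λ k → κ k *ᴸ ψ (suc k))))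
    ≈⟨ solveᴸ 6 (λ ψ₁ m h s t u → (ψ₁ :*ᴸ (m :*ᴸ h) :+ᴸ s) :+ᴸ (conᴸ 1ℤ :*ᴸ ψ₁ :*ᴸ h :+ᴸ (t :+ᴸ u))
         :=ᴸ (conᴸ 1ℤ :+ᴸ m) :*ᴸ (ψ₁ :*ᴸ h) :+ᴸ (t :+ᴸ (s :+ᴸ u))) L.refl
         (ψ 1) (κ n) (h n) (conv₂ n (λ i j → ψ (suc i) *ᴸ P j)) (conv n (ψ ∘ suc)) (conv n (λ k → κ k *ᴸ ψ (suc k))) ⟩
  (1ᴸ +ᴸ κ n) *ᴸ (ψ 1 *ᴸ h n) +ᴸ (conv n (ψ ∘ suc) +ᴸ (conv₂ n (λ i j → ψ (suc i) *ᴸ P j) +ᴸ conv n (λ k → κ k *ᴸ ψ (suc k))))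
    ≈⟨ L.+-congˡ {(1ᴸ +ᴸ κ n) *ᴸ (ψ 1 *ᴸ h n)} (L.+-congˡ {conv n (ψ ∘ suc)} (conv₂-product n (ψ ∘ suc))) ⟩
  (1ᴸ +ᴸ κ n) *ᴸ (ψ 1 *ᴸ h n) +ᴸ (conv n (ψ ∘ suc) +ᴸ κ n *ᴸ conv n (ψ ∘ suc))
    ≈⟨ solveᴸ 3 (λ a m t → (conᴸ 1ℤ :+ᴸ m) :*ᴸ a :+ᴸ (t :+ᴸ m :*ᴸ t) :=ᴸ (conᴸ 1ℤ :+ᴸ m) :*ᴸ (a :+ᴸ t)) L.refl
         (ψ 1 *ᴸ h n) (κ n) (conv n (ψ ∘ suc)) ⟩
  (1ᴸ +ᴸ κ n) *ᴸ (ψ 1 *ᴸ h n +ᴸ conv n (ψ ∘ suc))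
    ≈⟨ L.*-congʳ (κ-+ 1 n) ⟨
  κ (suc n) *ᴸ (ψ 1 *ᴸ h n +ᴸ conv n (ψ ∘ suc)) ∎
  where open L-Reasoning

D-h↓ : ∀ k n m → D (suc k) (h↓ n m) ≋ h↓ n (m ℕ.+ suc k)
D-h↓ k n       zero    = D-h k n
D-h↓ k zero    (suc m) = L.refl
D-h↓ k (suc n) (suc m) = D-h↓ k n m

module _ {N n : ℕ} (n≤N : n ≤ N) where

  Eₙ-h : Eₙ N (h n) ≋ κ n *ᴸ h n
  Eₙ-h = L.trans (sumᴸ-cong N (λ i → L.*-congˡ (D-h i n))) (L.trans (sumᴸ≋conv n≤N P) (L.sym (newton n)))

  R-h : R N (h n) ≋ conv₂ n (λ i j → P i *ᴸ P j)
  R-h = L.trans (sumᴸ-cong N (λ i → sumᴸ-cong N (λ j → L.*-congˡ (D-h (i ℕ.+ suc j) n)))) (sumᴸ²≋conv₂ n≤N n≤N (λ i j → P i *ᴸ P j))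

  Q-h : Q N (h n) ≋ conv n (λ k → κ (k ∸ 1) *ᴸ P k)
  Q-h = L.trans (sumᴸ-cong N (λ i → sumᴸ-cong N (λ j → L.*-congˡ (L.trans (Linear.≋-cong (D-linear (suc i)) (D-h j n))
      (L.trans (D-h↓ i n (suc j)) (L.reflexive (cong (h↓ n) (ℕ.+-comm (suc j) (suc i)))))))))
    (L.trans (sumᴸ²≋conv₂ n≤N n≤N (λ i j → P (i ℕ.+ j))) (conv₂-diagonal n P))

  U-h : U N (h n) ≋ conv n (λ k → κ (k ∸ 1) *ᴸ P k)
  U-h = L.trans (sumᴸ-cong N (λ i → L.*-congˡ (D-h i n))) (sumᴸ≋conv n≤N (λ k → κ (k ∸ 1) *ᴸ P k))

  -- The eigenvalue α n (n-1) is twice the content sum of a single row. Q and U give the same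
  -- element u = Σ (k-1) p_k h_{n-k}, so the coefficient α - 1 in Δ₂ combines with the coefficient 1
  -- of Q, and the whole is α (r + u), where r comes from R.
  Δₙ-h : Δₙ N (h n) ≋ const α *ᴸ (κ n *ᴸ κ n +ᴸ -ᴸ κ n) *ᴸ h n
  Δₙ-h = begin
    const α *ᴸ R N (h n) +ᴸ Q N (h n) +ᴸ const (α - 1#) *ᴸ U N (h n)
      ≈⟨ L.+-cong (L.+-cong (L.*-congˡ R-h) Q-h) (L.*-cong (L.trans (const-+ α (- 1#)) (L.+-congˡ {const α} (const-neg 1#))) U-h) ⟩
    const α *ᴸ r +ᴸ u +ᴸ (const α +ᴸ -ᴸ 1ᴸ) *ᴸ u
      ≈⟨ solveᴸ 3 (λ a r u → a :*ᴸ r :+ᴸ u :+ᴸ (a :-ᴸ conᴸ 1ℤ) :*ᴸ u :=ᴸ a :*ᴸ (r :+ᴸ u)) L.refl (const α) r u ⟩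
    const α *ᴸ (r +ᴸ u)
      ≈⟨ L.*-congˡ r+u ⟩
    const α *ᴸ (κ n *ᴸ (κ n *ᴸ h n) +ᴸ -ᴸ (κ n *ᴸ h n))
      ≈⟨ solveᴸ 3 (λ a k h → a :*ᴸ (k :*ᴸ (k :*ᴸ h) :-ᴸ k :*ᴸ h) :=ᴸ a :*ᴸ (k :*ᴸ k :-ᴸ k) :*ᴸ h) L.refl (const α) (κ n) (h n) ⟩
    const α *ᴸ (κ n *ᴸ κ n +ᴸ -ᴸ κ n) *ᴸ h n ∎
    where
    open L-Reasoning
    r u : Λ
    r = conv₂ n (λ i j → P i *ᴸ P j)
    u = conv n (λ k → κ (k ∸ 1) *ᴸ P k)
    -- Splitting k as 1 + (k-1) relates u to the sum with weights k that occurs in `conv₂-product`.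
    total-u : conv n (λ k → κ k *ᴸ P k) ≋ conv n P +ᴸ u
    total-u = L.trans (conv-cong n {λ k → κ k *ᴸ P k} {λ k → P k +ᴸ κ (k ∸ 1) *ᴸ P k} (λ k → L.trans (L.*-congʳ (κ-+ 1 k))
        (solveᴸ 2 (λ a b → (conᴸ 1ℤ :+ᴸ a) :*ᴸ b :=ᴸ b :+ᴸ a :*ᴸ b) L.refl (κ k) (P (suc k)))))
      (conv-+ n P (λ k → κ (k ∸ 1) *ᴸ P k))
    r+u : r +ᴸ u ≋ κ n *ᴸ (κ n *ᴸ h n) +ᴸ -ᴸ (κ n *ᴸ h n)
    r+u = begin
      r +ᴸ u                                          ≈⟨ solveᴸ 3 (λ r u c → r :+ᴸ u :=ᴸ (r :+ᴸ (c :+ᴸ u)) :-ᴸ c) L.refl r u (conv n P) ⟩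
      (r +ᴸ (conv n P +ᴸ u)) +ᴸ -ᴸ conv n P           ≈⟨ L.+-congʳ (L.+-congˡ {r} (L.sym total-u)) ⟩
      (r +ᴸ conv n (λ k → κ k *ᴸ P k)) +ᴸ -ᴸ conv n P ≈⟨ L.+-congʳ (conv₂-product n P) ⟩
      κ n *ᴸ conv n P +ᴸ -ᴸ conv n P                  ≈⟨ L.+-cong (L.*-congˡ (L.sym (newton n))) (L.-‿cong (L.sym (newton n))) ⟩
      κ n *ᴸ (κ n *ᴸ h n) +ᴸ -ᴸ (κ n *ᴸ h n)          ∎

-- The action on products of complete functions, tested by functionals

polar : ℕ → ℕ → Λ
polar m n = conv n (λ j → conv m (λ i → P (i ℕ.+ j)))

Γ-h : ∀ {N m n} → m ≤ N → n ≤ N → Γ N (h m) (h n) ≋ polar m n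
Γ-h {N} {m} {n} m≤N n≤N = begin
  sumᴸ N (λ i → sumᴸ N (λ j → P (suc i ℕ.+ suc j) *ᴸ D (suc i) (h m) *ᴸ D (suc j) (h n)))
    ≈⟨ sumᴸ-cong N (λ i → sumᴸ-cong N (λ j → L.*-cong (L.*-congˡ (D-h i m)) (D-h j n))) ⟩
  sumᴸ N (λ i → sumᴸ N (λ j → P (suc i ℕ.+ suc j) *ᴸ h↓ m (suc i) *ᴸ h↓ n (suc j)))
    ≈⟨ sumᴸ-swap N N _ ⟩
  sumᴸ N (λ j → sumᴸ N (λ i → P (suc i ℕ.+ suc j) *ᴸ h↓ m (suc i) *ᴸ h↓ n (suc j)))
    ≈⟨ sumᴸ-cong N (λ j → L.trans (L.sym (linear-sumᴸ (*-linearʳ (h↓ n (suc j))) N _)) (L.*-congʳ (sumᴸ≋conv m≤N (λ i → P (i ℕ.+ suc j))))) ⟩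
  sumᴸ N (λ j → conv m (λ i → P (i ℕ.+ suc j)) *ᴸ h↓ n (suc j))
    ≈⟨ sumᴸ≋conv n≤N (λ j → conv m (λ i → P (i ℕ.+ j))) ⟩
  polar m n ∎
  where open L-Reasoning

-- Both double sums contain the same part `conv n s`, in which the index of the power sum is i + j +
-- 1. Their remaining boundary rows are Newton sums without the p₁ term, and the two missing terms
-- p₁ h_m h_n cancel.
polar-step : ∀ m n → polar m (suc n) ≋
  polar (suc m) n +ᴸ κ (suc m) *ᴸ (h (suc m) *ᴸ h n) +ᴸ -ᴸ (κ (suc n) *ᴸ (h m *ᴸ h (suc n)))
polar-step m n = begin
  conv m (λ i → P (i ℕ.+ 1)) *ᴸ h n +ᴸ conv n (λ j → conv m (λ i → P (i ℕ.+ suc j)))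
    ≈⟨ L.+-cong (L.*-congʳ (conv-cong m {λ i → P (i ℕ.+ 1)} {P ∘ suc} (λ i → L.reflexive (cong P (ℕ.+-comm (suc i) 1)))))
         (conv-cong n {λ j → conv m (λ i → P (i ℕ.+ suc j))} {s} (λ j → conv-cong m {λ i → P (i ℕ.+ suc (suc j))} {λ i → P (suc i ℕ.+ suc j)} (λ i → L.reflexive (cong P (ℕ.+-suc (suc i) (suc j)))))) ⟩
  conv m (P ∘ suc) *ᴸ h n +ᴸ conv n s
    ≈⟨ solveᴸ 6 (λ cm cn hm hn s p → cm :*ᴸ hn :+ᴸ s :=ᴸ
         ((hm :*ᴸ cn :+ᴸ s) :+ᴸ (p :*ᴸ hm :+ᴸ cm) :*ᴸ hn) :-ᴸ hm :*ᴸ (p :*ᴸ hn :+ᴸ cn)) L.refl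
         (conv m (P ∘ suc)) (conv n (P ∘ suc)) (h m) (h n) (conv n s) (P 1) ⟩
  ((h m *ᴸ conv n (P ∘ suc) +ᴸ conv n s) +ᴸ conv (suc m) P *ᴸ h n) +ᴸ -ᴸ (h m *ᴸ conv (suc n) P)
    ≈⟨ L.+-cong (L.+-cong (L.sym expand) (L.trans (L.*-congʳ (L.sym (newton (suc m)))) (L.*-assoc (κ (suc m)) (h (suc m)) (h n))))
         (L.-‿cong (L.trans (L.*-congˡ (L.sym (newton (suc n))))
           (solveᴸ 3 (λ a b c → a :*ᴸ (b :*ᴸ c) :=ᴸ b :*ᴸ (a :*ᴸ c)) L.refl (h m) (κ (suc n)) (h (suc n))))) ⟩
  polar (suc m) n +ᴸ κ (suc m) *ᴸ (h (suc m) *ᴸ h n) +ᴸ -ᴸ (κ (suc n) *ᴸ (h m *ᴸ h (suc n))) ∎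
  where
  open L-Reasoning
  s : ℕ → Λ
  s j = conv m (λ i → P (suc i ℕ.+ j))
  expand : polar (suc m) n ≋ h m *ᴸ conv n (P ∘ suc) +ᴸ conv n s
  expand = L.trans (conv-+ n (λ j → P (suc j) *ᴸ h m) s) (L.+-congʳ (L.trans
    (conv-cong n {λ j → P (suc j) *ᴸ h m} {λ j → h m *ᴸ P (suc j)} (λ j → L.*-comm (P (suc (suc j))) (h m))) (conv-* n (h m) (P ∘ suc))))

-- Homogeneity is stated for products with constants, the form in which the solver for Λ delivers
-- identities.
record Functional (F : Λ → ℚ⟨α⟩) : Set where
  field
    resp   : ∀ {f g} → f ≋ g → F f ≈ F g
    +-homo : ∀ f g → F (f +ᴸ g) ≈ F f + F g
    c-homo : ∀ c f → F (const c *ᴸ f) ≈ c * F f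

  0-homo : F 0ᴸ ≈ 0#
  0-homo = K.trans (resp (L.sym (L.zeroʳ (const 0#)))) (K.trans (c-homo 0# 0ᴸ) (K.zeroˡ (F 0ᴸ)))

  neg-homo : ∀ f → F (-ᴸ f) ≈ - F f
  neg-homo f = K.trans (resp (solveᴸ 1 (λ f → :-ᴸ f :=ᴸ conᴸ -1ℤ :*ᴸ f) L.refl f))
    (K.trans (c-homo (polynomial [ -1ℤ ]) f) (solve 1 (λ x → con -1ℤ :* x := :- x) K.refl (F f)))

-- Absorbing a fixed factor into the functional is what makes induction over the factors of h_β
-- possible.
∘*-functional : ∀ {F} → Functional F → ∀ g → Functional (λ f → F (g *ᴸ f))
∘*-functional {F} fun g = record
  { resp   = λ e → resp (L.*-congˡ e)
  ; +-homo = λ f k → K.trans (resp (L.distribˡ g f k)) (+-homo (g *ᴸ f) (g *ᴸ k))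
  ; c-homo = λ c f → K.trans (resp (solveᴸ 3 (λ g c f → g :*ᴸ (c :*ᴸ f) :=ᴸ c :*ᴸ (g :*ᴸ f)) L.refl g (const c) f)) (c-homo c (g *ᴸ f))
  }
  where open Functional fun

hs : List ℕ → Λ
hs = foldr (λ n f → h n *ᴸ f) 1ᴸ

-- The results may be unsorted and contain zeros; `fromComposition` turns them into partitions
-- later.
data Lowered (k : ℕ) : List ℕ → List ℕ → Set where
  here  : ∀ {b β} → Lowered k (k ℕ.+ b ∷ β) (b ∷ β)
  there : ∀ {b β γ} → Lowered k β γ → Lowered k (b ∷ β) (b ∷ γ)

-- Raised β γ: γ arises from β by moving boxes from some row to an earlier one.
data Raised : List ℕ → List ℕ → Set where
  here  : ∀ {a k β γ} → Lowered (suc k) β γ → Raised (a ∷ β) (a ℕ.+ suc k ∷ γ)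
  there : ∀ {a β γ} → Raised β γ → Raised (a ∷ β) (a ∷ γ)

-- Iterating `polar-step` until its second index is 0 produces products h_{m+k} h_{n-k}. Those with
-- k > 0 are killed by F, and h_m h_n itself occurs only in the first step, with coefficient -n.
functional-polar : ∀ {F} → Functional F → ∀ m n →
  (∀ k b → suc k ℕ.+ b ≡ n → F (h (m ℕ.+ suc k) *ᴸ h b) ≈ 0#) →
  F (polar m n) ≈ - fromℕ n * F (h m *ᴸ h n)
functional-polar {F} fun m zero    z = K.trans (Functional.0-homo fun)
  (solve 1 (λ x → con 0ℤ := :- con 0ℤ :* x) K.refl (F (h m *ᴸ 1ᴸ)))
functional-polar {F} fun m (suc n) z = begin
  F (polar m (suc n))
    ≈⟨ resp (polar-step m n) ⟩
  F (polar (suc m) n +ᴸ κ (suc m) *ᴸ (h (suc m) *ᴸ h n) +ᴸ -ᴸ (κ (suc n) *ᴸ (h m *ᴸ h (suc n))))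
    ≈⟨ +-homo (polar (suc m) n +ᴸ κ (suc m) *ᴸ (h (suc m) *ᴸ h n)) _ ⟩
  F (polar (suc m) n +ᴸ κ (suc m) *ᴸ (h (suc m) *ᴸ h n)) + F (-ᴸ (κ (suc n) *ᴸ (h m *ᴸ h (suc n))))
    ≈⟨ K.+-cong (+-homo (polar (suc m) n) _) (K.trans (neg-homo _) (K.-‿cong (c-homo (fromℕ (suc n)) _))) ⟩
  F (polar (suc m) n) + F (κ (suc m) *ᴸ (h (suc m) *ᴸ h n)) + - (fromℕ (suc n) * F (h m *ᴸ h (suc n)))
    ≈⟨ K.+-congʳ (K.+-cong (K.trans (functional-polar fun (suc m) n raise) (K.*-congˡ one)) (K.trans (c-homo (fromℕ (suc m)) _) (K.*-congˡ one))) ⟩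
  - fromℕ n * 0# + fromℕ (suc m) * 0# + - (fromℕ (suc n) * F (h m *ᴸ h (suc n)))
    ≈⟨ solve 4 (λ a b c x → :- a :* con 0ℤ :+ b :* con 0ℤ :- c :* x := :- c :* x) K.refl
         (fromℕ n) (fromℕ (suc m)) (fromℕ (suc n)) (F (h m *ᴸ h (suc n))) ⟩
  - fromℕ (suc n) * F (h m *ᴸ h (suc n)) ∎
  where
  open K-Reasoning
  open Functional fun
  one : F (h (suc m) *ᴸ h n) ≈ 0#
  one = K.trans (resp (L.*-congʳ (L.reflexive (cong h (ℕ.+-comm 1 m))))) (z 0 n ≡.refl)
  raise : ∀ k b → suc k ℕ.+ b ≡ n → F (h (suc m ℕ.+ suc k) *ᴸ h b) ≈ 0#
  raise k b e = K.trans (resp (L.*-congʳ (L.reflexive (cong h (≡.sym (ℕ.+-suc m (suc k))))))) (z (suc k) b (cong suc e))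

Γ-1 : ∀ N f → Γ N f 1ᴸ ≋ 0ᴸ
Γ-1 N f = L.trans (sumᴸ-cong N (λ i → L.trans (sumᴸ-cong N (λ j → L.trans (L.*-congˡ (D-1 (suc j))) (L.zeroʳ _))) (sumᴸ-0 N))) (sumᴸ-0 N)

-- Γ (h_m , -) is a derivation, and each factor h_b contributes -b. So every box below the row m
-- counts -1, which is the share of that row in the contents of these boxes.
functional-Γ : ∀ {F} → Functional F → ∀ {N m β} → m ≤ N → All (_≤ N) β →
  (∀ {k γ} → Lowered (suc k) β γ → F (h (m ℕ.+ suc k) *ᴸ hs γ) ≈ 0#) →
  F (Γ N (h m) (hs β)) ≈ - fromℕ (sum β) * F (h m *ᴸ hs β)
functional-Γ {F} fun {N} {m} {[]} m≤N [] z = K.trans (resp (Γ-1 N (h m)))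
  (K.trans 0-homo (solve 1 (λ x → con 0ℤ := :- con 0ℤ :* x) K.refl (F (h m *ᴸ 1ᴸ))))
  where open Functional fun
functional-Γ {F} fun {N} {m} {b ∷ β} m≤N (b≤N ∷ β≤N) z = begin
  F (Γ N (h m) (h b *ᴸ hs β))
    ≈⟨ resp (Γ-derivation N (h m) (h b) (hs β)) ⟩
  F (Γ N (h m) (h b) *ᴸ hs β +ᴸ h b *ᴸ Γ N (h m) (hs β))
    ≈⟨ +-homo (Γ N (h m) (h b) *ᴸ hs β) _ ⟩
  F (Γ N (h m) (h b) *ᴸ hs β) + F (h b *ᴸ Γ N (h m) (hs β))
    ≈⟨ K.+-cong (K.trans (resp (L.trans (L.*-congʳ (Γ-h m≤N b≤N)) (L.*-comm _ (hs β))))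
                         (functional-polar (∘*-functional fun (hs β)) m b λ { k c ≡.refl →
                            K.trans (resp (L.trans (L.*-comm (hs β) _) (L.*-assoc _ _ _))) (z here) }))
                (functional-Γ (∘*-functional fun (h b)) m≤N β≤N (λ l → K.trans (resp (exchange (h b) _ _)) (z (there l)))) ⟩
  - fromℕ b * F (hs β *ᴸ (h m *ᴸ h b)) + - fromℕ (sum β) * F (h b *ᴸ (h m *ᴸ hs β))
    ≈⟨ K.+-cong (K.*-congˡ (resp (L.trans (L.*-comm (hs β) _) (L.*-assoc _ _ _)))) (K.*-congˡ (resp (exchange (h b) (h m) (hs β)))) ⟩
  - fromℕ b * F (h m *ᴸ (h b *ᴸ hs β)) + - fromℕ (sum β) * F (h m *ᴸ (h b *ᴸ hs β))
    ≈⟨ solve 3 (λ a b x → :- a :* x :+ :- b :* x := :- (a :+ b) :* x) K.refl (fromℕ b) (fromℕ (sum β)) _ ⟩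
  - (fromℕ b + fromℕ (sum β)) * F (h m *ᴸ (h b *ᴸ hs β))
    ≈⟨ K.*-congʳ (K.-‿cong (fromℕ-+ b (sum β))) ⟨
  - fromℕ (b ℕ.+ sum β) * F (h m *ᴸ (h b *ᴸ hs β)) ∎
  where
  open K-Reasoning
  open Functional fun
  exchange : ∀ x y z → x *ᴸ (y *ᴸ z) ≋ y *ᴸ (x *ᴸ z)
  exchange x y z = solveᴸ 3 (λ x y z → x :*ᴸ (y :*ᴸ z) :=ᴸ y :*ᴸ (x :*ᴸ z)) L.refl x y z

-- Σ over the rows i = 0, 1, … of α β_i (β_i − 1) − 2 i β_i
Δ₂-eigenvalue : List ℕ → ℚ⟨α⟩
Δ₂-eigenvalue []      = 0#
Δ₂-eigenvalue (n ∷ β) = α * (fromℕ n * fromℕ n - fromℕ n) + Δ₂-eigenvalue β - fromℕ 2 * fromℕ (sum β)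

Δₙ-1 : ∀ N → Δₙ N 1ᴸ ≋ 0ᴸ
Δₙ-1 N = begin
  const α *ᴸ R N 1ᴸ +ᴸ Q N 1ᴸ +ᴸ const (α - 1#) *ᴸ U N 1ᴸ
    ≈⟨ L.+-cong (L.+-cong (L.*-congˡ (vanish₂ λ i j → zero* _ (D-1 (suc i ℕ.+ suc j))))
                          (vanish₂ λ i j → zero* _ (Linear.vanishes (D-linear (suc i)) (D-1 (suc j)))))
                (L.*-congˡ (L.trans (sumᴸ-cong N (λ i → zero* _ (D-1 (suc i)))) (sumᴸ-0 N))) ⟩
  const α *ᴸ 0ᴸ +ᴸ 0ᴸ +ᴸ const (α - 1#) *ᴸ 0ᴸ
    ≈⟨ L.+-cong (L.+-congʳ {0ᴸ} (L.zeroʳ (const α))) (L.zeroʳ (const (α - 1#))) ⟩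
  0ᴸ ∎
  where
  open L-Reasoning
  zero* : ∀ x {y} → y ≋ 0ᴸ → x *ᴸ y ≋ 0ᴸ
  zero* x e = L.trans (L.*-congˡ e) (L.zeroʳ x)
  vanish₂ : ∀ {F : ℕ → ℕ → Λ} → (∀ i j → F i j ≋ 0ᴸ) → sumᴸ N (λ i → sumᴸ N (F i)) ≋ 0ᴸ
  vanish₂ z = L.trans (sumᴸ-cong N (λ i → L.trans (sumᴸ-cong N (z i)) (sumᴸ-0 N))) (sumᴸ-0 N)

-- By the product rule the first row n gives α n (n-1), the remaining rows give their eigenvalue by
-- induction with h_n absorbed into F, and the mixed term 2Γ gives -2 |β|. The two constructors of
-- `Raised` match the last two contributions.
functional-Δₙ : ∀ {F} → Functional F → ∀ {N β} → All (_≤ N) β →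
  (∀ {γ} → Raised β γ → F (hs γ) ≈ 0#) →
  F (Δₙ N (hs β)) ≈ Δ₂-eigenvalue β * F (hs β)
functional-Δₙ {F} fun {N} {[]} [] z = K.trans (resp (Δₙ-1 N)) (K.trans 0-homo (K.sym (K.zeroˡ (F 1ᴸ))))
  where open Functional fun
functional-Δₙ {F} fun {N} {n ∷ β} (n≤N ∷ β≤N) z = begin
  F (Δₙ N (h n *ᴸ hs β))
    ≈⟨ resp (Δₙ-* N (h n) (hs β)) ⟩
  F (Δₙ N (h n) *ᴸ hs β +ᴸ h n *ᴸ Δₙ N (hs β) +ᴸ κ 2 *ᴸ Γ N (h n) (hs β))
    ≈⟨ K.trans (+-homo _ (κ 2 *ᴸ Γ N (h n) (hs β))) (K.+-congʳ (+-homo _ (h n *ᴸ Δₙ N (hs β)))) ⟩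
  F (Δₙ N (h n) *ᴸ hs β) + F (h n *ᴸ Δₙ N (hs β)) + F (κ 2 *ᴸ Γ N (h n) (hs β))
    ≈⟨ K.+-cong (K.+-cong head-term (functional-Δₙ (∘*-functional fun (h n)) β≤N (λ r → z (there r))))
                (K.trans (c-homo (fromℕ 2) _) (K.*-congˡ (functional-Γ fun n≤N β≤N (λ l → z (here l))))) ⟩
  α * (fromℕ n * fromℕ n - fromℕ n) * x + Δ₂-eigenvalue β * x + fromℕ 2 * (- fromℕ (sum β) * x)
    ≈⟨ solve 4 (λ a e s x → a :* x :+ e :* x :+ con (ℤ.+ 2) :* (:- s :* x)
         := (a :+ e :- con (ℤ.+ 2) :* s) :* x) K.refl
         (α * (fromℕ n * fromℕ n - fromℕ n)) (Δ₂-eigenvalue β) (fromℕ (sum β)) x ⟩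
  Δ₂-eigenvalue (n ∷ β) * x ∎
  where
  open K-Reasoning
  open Functional fun
  x = F (h n *ᴸ hs β)
  head-term : F (Δₙ N (h n) *ᴸ hs β) ≈ α * (fromℕ n * fromℕ n - fromℕ n) * x
  head-term = K.trans (resp (L.trans (L.*-congʳ (L.trans (Δₙ-h n≤N) (L.*-congʳ scalar))) (L.*-assoc _ _ _))) (c-homo _ _)
    where
    scalar : const α *ᴸ (κ n *ᴸ κ n +ᴸ -ᴸ κ n) ≋ const (α * (fromℕ n * fromℕ n - fromℕ n))
    scalar = L.sym (L.trans (const-* α _) (L.*-congˡ (L.trans (const-+ (fromℕ n * fromℕ n) (- fromℕ n))
      (L.+-cong (const-* (fromℕ n) (fromℕ n)) (const-neg (fromℕ n))))))

Eₙ-hs : ∀ {N β} → All (_≤ N) β → Eₙ N (hs β) ≋ κ (sum β) *ᴸ hs β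
Eₙ-hs {N} {[]} [] = L.trans (L.trans (sumᴸ-cong N (λ i → L.trans (L.*-congˡ (D-1 (suc i))) (L.zeroʳ (P (suc i))))) (sumᴸ-0 N))
  (L.sym (L.trans (L.*-congʳ const-0) (L.zeroˡ 1ᴸ)))
Eₙ-hs {N} {n ∷ β} (n≤N ∷ β≤N) = L.trans (Eₙ-derivation N (h n) (hs β))
  (L.trans (L.+-cong (L.*-congʳ (Eₙ-h n≤N)) (L.*-congˡ (Eₙ-hs β≤N)))
  (L.trans (solveᴸ 4 (λ a s x y → (a :*ᴸ x) :*ᴸ y :+ᴸ x :*ᴸ (s :*ᴸ y) :=ᴸ (a :+ᴸ s) :*ᴸ (x :*ᴸ y)) L.refl
              (κ n) (κ (sum β)) (h n) (hs β))
           (L.*-congʳ (L.sym (κ-+ n (sum β))))))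

-- Truncation of the operators E and Δ₂

∘D-locallyFinite : ∀ (A : ℕ → Operator) → (∀ k → Linear (A k)) → LocallyFinite (λ k → A k ∘ D k)
∘D-locallyFinite A lin = record
  { linear = λ k → ∘-linear (lin k) (D-linear k)
  ; finite = λ k u d<k → Linear.vanishes (lin k) (D-vanishes k u d<k)
  }

E-locallyFinite : LocallyFinite (λ k → p k ∘ D k)
E-locallyFinite = ∘D-locallyFinite p p-linear

U-locallyFinite : LocallyFinite (λ k → fromℕ (k ∸ 1) ⊙ p k ∘ D k)
U-locallyFinite = ∘D-locallyFinite (λ k → fromℕ (k ∸ 1) ⊙ p k) (λ k → ⊙-linear (fromℕ (k ∸ 1)) (p-linear k))

R-locallyFinite : LocallyFinite₂ (λ i j → p i ∘ p j ∘ D (i ℕ.+ j))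
R-locallyFinite = record
  { linear  = λ i j → ∘-linear (p-linear i) (∘-linear (p-linear j) (D-linear (i ℕ.+ j)))
  ; finite₁ = λ i j u d<i → vanish i j (D-vanishes (i ℕ.+ j) u (ℕ.<-≤-trans d<i (ℕ.m≤m+n i j)))
  ; finite₂ = λ i j u d<j → vanish i j (D-vanishes (i ℕ.+ j) u (ℕ.<-≤-trans d<j (ℕ.m≤n+m j i)))
  }
  where
  vanish : ∀ i j {f} → f ≋ 0ᴸ → p i (p j f) ≋ 0ᴸ
  vanish i j e = Linear.vanishes (p-linear i) (Linear.vanishes (p-linear j) e)

Q-locallyFinite : LocallyFinite₂ (λ i j → p (i ℕ.+ j) ∘ D i ∘ D j)
Q-locallyFinite = record
  { linear  = λ i j → ∘-linear (p-linear (i ℕ.+ j)) (∘-linear (D-linear i) (D-linear j))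
  ; finite₁ = λ i j u d<i → Linear.vanishes (p-linear (i ℕ.+ j))
      (L.trans (D-comm i j (monomial u)) (Linear.vanishes (D-linear j) (D-vanishes i u d<i)))
  ; finite₂ = λ i j u d<j → Linear.vanishes (p-linear (i ℕ.+ j)) (Linear.vanishes (D-linear i) (D-vanishes j u d<j))
  }

E-linear : Linear E
E-linear = ∑-linear E-locallyFinite

Δ₂-linear : Linear Δ₂
Δ₂-linear = ⊕-linear (⊕-linear (⊙-linear α (∑-linear (outer R-locallyFinite))) (∑-linear (outer Q-locallyFinite)))
  (⊙-linear (α - 1#) (∑-linear U-locallyFinite))

E≋Eₙ : ∀ f {N} → bound f ≤ N → E f ≋ Eₙ N f
E≋Eₙ f {N} b≤N = L.trans (∑-truncate E-locallyFinite f b≤N) (sumᴸ-cong N (λ i → p≋* (suc i) (D (suc i) f)))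

Δ₂≋Δₙ : ∀ f {N} → bound f ≤ N → Δ₂ f ≋ Δₙ N f
Δ₂≋Δₙ f {N} b≤N = L.+-cong (L.+-cong
  (L.trans (·≋const α (∑ (λ i → ∑ λ j → p i ∘ p j ∘ D (i ℕ.+ j)) f)) (L.*-congˡ (L.trans (∑∑-truncate R-locallyFinite f b≤N)
    (sumᴸ-cong N (λ i → sumᴸ-cong N (λ j → L.trans (p≋* (suc i) (p (suc j) (D (suc i ℕ.+ suc j) f)))
      (L.trans (L.*-congˡ (p≋* (suc j) (D (suc i ℕ.+ suc j) f))) (L.sym (L.*-assoc (P (suc i)) (P (suc j)) _)))))))))
  (L.trans (∑∑-truncate Q-locallyFinite f b≤N) (sumᴸ-cong N (λ i → sumᴸ-cong N (λ j → p≋* (suc i ℕ.+ suc j) (D (suc i) (D (suc j) f)))))))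
  (L.trans (·≋const (α - 1#) (∑ (λ k → fromℕ (k ∸ 1) ⊙ p k ∘ D k) f)) (L.*-congˡ (L.trans (∑-truncate U-locallyFinite f b≤N)
    (sumᴸ-cong N (λ i → L.trans (·≋const (fromℕ i) (p (suc i) (D (suc i) f)))
      (L.trans (L.*-congˡ (p≋* (suc i) (D (suc i) f))) (L.sym (L.*-assoc (κ i) (P (suc i)) _))))))))

≤sum : ∀ β → All (_≤ sum β) β
≤sum []      = []
≤sum (n ∷ β) = ℕ.m≤m+n n (sum β) ∷ All.map (λ m≤ → ℕ.≤-trans m≤ (ℕ.m≤n+m (sum β) n)) (≤sum β)

-- The truncation level must bound the degrees in `hs β` and also the entries of β; the sum of both
-- bounds serves.
E-hs : ∀ β → E (hs β) ≋ κ (sum β) *ᴸ hs β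
E-hs β = L.trans (E≋Eₙ (hs β) (ℕ.m≤m+n (bound (hs β)) (sum β)))
  (Eₙ-hs (All.map (λ m≤ → ℕ.≤-trans m≤ (ℕ.m≤n+m (sum β) (bound (hs β)))) (≤sum β)))

functional-Δ₂ : ∀ {F} → Functional F → ∀ β → (∀ {γ} → Raised β γ → F (hs γ) ≈ 0#) →
  F (Δ₂ (hs β)) ≈ Δ₂-eigenvalue β * F (hs β)
functional-Δ₂ fun β z = K.trans (Functional.resp fun (Δ₂≋Δₙ (hs β) (ℕ.m≤m+n (bound (hs β)) (sum β))))
  (functional-Δₙ fun (All.map (λ m≤ → ℕ.≤-trans m≤ (ℕ.m≤n+m (sum β) (bound (hs β)))) (≤sum β)) z)

-- The Hall form

singleton≋ : ∀ c u → [ (c , u) ] ≋ const c *ᴸ monomial u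
singleton≋ c u = L.trans (eval⇒≋ λ _ → K.+-congʳ (K.*-congʳ (K.sym (K.*-identityʳ c)))) (·≋const c (monomial u))

functional-ext : ∀ {F G} → Functional F → Functional G → (∀ u → F (monomial u) ≈ G (monomial u)) → ∀ f → F f ≈ G f
functional-ext F′ G′ e []            = K.trans (Functional.0-homo F′) (K.sym (Functional.0-homo G′))
functional-ext F′ G′ e ((c , u) ∷ f) = K.trans (split F′)
  (K.trans (K.+-cong (K.*-congˡ (e u)) (functional-ext F′ G′ e f)) (K.sym (split G′)))
  where
  split : ∀ {F} → Functional F → F ((c , u) ∷ f) ≈ c * F (monomial u) + F f
  split F′ = K.trans (+-homo [ (c , u) ] f) (K.+-congʳ (K.trans (resp (singleton≋ c u)) (c-homo c (monomial u))))
    where open Functional F′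

eval-functional : ∀ {G} → Invariant G → Functional (eval G)
eval-functional {G} inv = record
  { resp   = λ e → ≋⇒eval e inv
  ; +-homo = eval-++ G
  ; c-homo = λ c f → K.trans (≋⇒eval (L.sym (·≋const c f)) inv) (eval-scale G c f)
  }

functional-∘ : ∀ {F A} → Functional F → Linear A → Functional (F ∘ A)
functional-∘ F′ lin = record
  { resp   = λ e → F.resp (T.≋-cong e)
  ; +-homo = λ f g → K.trans (F.resp (T.+-homo f g)) (F.+-homo _ _)
  ; c-homo = λ c f → K.trans (F.resp (L.trans (T.≋-cong (L.sym (·≋const c f))) (L.trans (T.·-homo c f) (·≋const c _)))) (F.c-homo c _)
  }
  where
  module F = Functional F′
  module T = Linear lin

functional-scale : ∀ {F} c → Functional F → Functional (λ f → c * F f)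
functional-scale c F′ = record
  { resp   = λ e → K.*-congˡ (resp e)
  ; +-homo = λ f g → K.trans (K.*-congˡ (+-homo f g)) (K.distribˡ c _ _)
  ; c-homo = λ d f → K.trans (K.*-congˡ (c-homo d f)) (solve 3 (λ c d x → c :* (d :* x) := d :* (c :* x)) K.refl c d _)
  }
  where open Functional F′

functional-sumᴸ : ∀ {F G} → Functional F → Functional G → ∀ n {A B : ℕ → Λ} →
  (∀ i → F (A i) ≈ G (B i)) → F (sumᴸ n A) ≈ G (sumᴸ n B)
functional-sumᴸ F′ G′ zero    e = K.trans (Functional.0-homo F′) (K.sym (Functional.0-homo G′))
functional-sumᴸ F′ G′ (suc n) e = K.trans (Functional.+-homo F′ _ _)
  (K.trans (K.+-cong (e 0) (functional-sumᴸ F′ G′ n (e ∘ suc))) (K.sym (Functional.+-homo G′ _ _)))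

wordTotal-functional : ∀ u → Functional (wordTotal u)
wordTotal-functional u = eval-functional (indicator-invariant u)

indicator-⇔ : ∀ {P Q : Set} (d : Dec P) (e : Dec Q) → (P → Q) → (Q → P) → indicator d ≈ indicator e
indicator-⇔ (yes _) (yes _) _ _ = K.refl
indicator-⇔ (no _)  (no _)  _ _ = K.refl
indicator-⇔ (yes x) (no ¬y) f _ = contradiction (f x) ¬y
indicator-⇔ (no ¬x) (yes y) _ g = contradiction (g y) ¬x

wordTotal-p : ∀ i u f → wordTotal (i ∷ u) (p (suc i) f) ≈ wordTotal u f
wordTotal-p i u f = K.trans (eval-map₂ _ (i ∷_) f)
  (eval-cong (λ v → indicator-⇔ ((i ∷ u) ↭? (i ∷ v)) (u ↭? v) ↭ₚ.drop-∷ (prep i)) f)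

wordTotal-↮ : ∀ {u v} → ¬ (u ↭ v) → wordTotal u (monomial v) ≈ 0#
wordTotal-↮ {u} {v} ¬e = K.trans (K.+-identityʳ _) (K.trans (K.*-identityˡ _) (K.sym (indicator-no (u ↭? v) ¬e)))

multiplicity : ℕ → Monomial → ℕ
multiplicity i u = length (filter (i ℕ.≟_) u)

P*∂ : ∀ i u → P (suc i) *ᴸ ∂ (suc i) (monomial u) ≋ κ (multiplicity i u) *ᴸ monomial u
P*∂ i []      = L.trans (L.zeroʳ (P (suc i))) (L.sym (L.trans (L.*-congʳ const-0) (L.zeroˡ (monomial []))))
P*∂ i (j ∷ u) = begin
  P (suc i) *ᴸ ∂ (suc i) (monomial (j ∷ u))
    ≈⟨ L.*-congˡ (∂-∷ (suc i) j u) ⟩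
  P (suc i) *ᴸ (δ (suc i) (suc j) *ᴸ monomial u +ᴸ P (suc j) *ᴸ ∂ (suc i) (monomial u))
    ≈⟨ solveᴸ 5 (λ p d m q e → p :*ᴸ (d :*ᴸ m :+ᴸ q :*ᴸ e) :=ᴸ d :*ᴸ (p :*ᴸ m) :+ᴸ q :*ᴸ (p :*ᴸ e)) L.refl
         (P (suc i)) (δ (suc i) (suc j)) (monomial u) (P (suc j)) (∂ (suc i) (monomial u)) ⟩
  δ (suc i) (suc j) *ᴸ (P (suc i) *ᴸ monomial u) +ᴸ P (suc j) *ᴸ (P (suc i) *ᴸ ∂ (suc i) (monomial u))
    ≈⟨ L.+-congˡ {δ (suc i) (suc j) *ᴸ (P (suc i) *ᴸ monomial u)} (L.*-congˡ (P*∂ i u)) ⟩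
  δ (suc i) (suc j) *ᴸ (P (suc i) *ᴸ monomial u) +ᴸ P (suc j) *ᴸ (κ (multiplicity i u) *ᴸ monomial u)
    ≈⟨ collect ⟩
  κ (multiplicity i (j ∷ u)) *ᴸ (P (suc j) *ᴸ monomial u)
    ≈⟨ L.*-congˡ (p≋* (suc j) (monomial u)) ⟨
  κ (multiplicity i (j ∷ u)) *ᴸ monomial (j ∷ u) ∎
  where
  open L-Reasoning
  collect : δ (suc i) (suc j) *ᴸ (P (suc i) *ᴸ monomial u) +ᴸ P (suc j) *ᴸ (κ (multiplicity i u) *ᴸ monomial u)
    ≋ κ (multiplicity i (j ∷ u)) *ᴸ (P (suc j) *ᴸ monomial u)
  collect with i ℕ.≟ j
  ... | yes ≡.refl rewrite dec-true (i ℕ.≟ i) ≡.refl = L.trans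
    (solveᴸ 3 (λ x c m → conᴸ 1ℤ :*ᴸ (x :*ᴸ m) :+ᴸ x :*ᴸ (c :*ᴸ m) :=ᴸ (conᴸ 1ℤ :+ᴸ c) :*ᴸ (x :*ᴸ m)) L.refl
      (P (suc i)) (κ (multiplicity i u)) (monomial u))
    (L.*-congʳ (L.sym (κ-+ 1 (multiplicity i u))))
  ... | no i≢j rewrite dec-false (i ℕ.≟ j) i≢j = L.trans (L.+-congʳ (L.zeroˡ (P (suc i) *ᴸ monomial u)))
    (solveᴸ 3 (λ x c m → x :*ᴸ (c :*ᴸ m) :=ᴸ c :*ᴸ (x :*ᴸ m)) L.refl
      (P (suc j)) (κ (multiplicity i u)) (monomial u))

-- Prefixing a letter is injective on words, so the coefficient of u in ∂f can be read off at i ∷ u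
-- after multiplying by the variable. The operator p ∂/∂p counts multiplicities.
wordTotal-∂ : ∀ i u f → wordTotal u (∂ (suc i) f) ≈ fromℕ (suc (multiplicity i u)) * wordTotal (i ∷ u) f
wordTotal-∂ i u = functional-ext
  (functional-∘ (wordTotal-functional u) (∂-linear (suc i)))
  (functional-scale (fromℕ (suc (multiplicity i u))) (wordTotal-functional (i ∷ u)))
  word
  where
  open K-Reasoning
  open Functional (wordTotal-functional (i ∷ u))
  word : ∀ v → wordTotal u (∂ (suc i) (monomial v)) ≈ fromℕ (suc (multiplicity i u)) * wordTotal (i ∷ u) (monomial v)
  word v = begin
    wordTotal u (∂ (suc i) (monomial v))                           ≈⟨ wordTotal-p i u (∂ (suc i) (monomial v)) ⟨
    wordTotal (i ∷ u) (p (suc i) (∂ (suc i) (monomial v)))         ≈⟨ resp (L.trans (p≋* (suc i) (∂ (suc i) (monomial v))) (P*∂ i v)) ⟩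
    wordTotal (i ∷ u) (κ (multiplicity i v) *ᴸ monomial v)         ≈⟨ c-homo (fromℕ (multiplicity i v)) (monomial v) ⟩
    fromℕ (multiplicity i v) * wordTotal (i ∷ u) (monomial v)      ≈⟨ multiplicities ⟩
    fromℕ (suc (multiplicity i u)) * wordTotal (i ∷ u) (monomial v) ∎
    where
    multiplicities : fromℕ (multiplicity i v) * wordTotal (i ∷ u) (monomial v)
                   ≈ fromℕ (suc (multiplicity i u)) * wordTotal (i ∷ u) (monomial v)
    -- Unless v is a permutation of i ∷ u both sides vanish; if it is, v contains i once more than u
    -- does.
    multiplicities with (i ∷ u) ↭? v
    ... | no ¬e = K.trans (K.*-congˡ (wordTotal-↮ ¬e)) (K.trans (K.zeroʳ (fromℕ (multiplicity i v)))
                    (K.sym (K.trans (K.*-congˡ (wordTotal-↮ ¬e)) (K.zeroʳ (fromℕ (suc (multiplicity i u)))))))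
    ... | yes e = K.*-congʳ (K.reflexive (cong fromℕ (≡.trans (≡.sym (↭ₚ.↭-length (↭ₚ.filter-↭ (i ℕ.≟_) e)))
                    (cong length (List.filter-accept (i ℕ.≟_) {x = i} {xs = u} ≡.refl)))))

wordPairing : Monomial → Λ → ℚ⟨α⟩
wordPairing u g = fromℕ (z u) * wordTotal u g

-- In the recursion for z the factor k is the one in D_k = k ∂/∂p_k, and the factor m is the
-- multiplicity produced by differentiating. This is the adjointness of p_k and D_k on words.
wordPairing-∷ : ∀ i u g → wordPairing (i ∷ u) g ≈ wordPairing u (D (suc i) g)
wordPairing-∷ i u g = begin
  fromℕ (suc i ℕ.* m ℕ.* z u) * t                         ≈⟨ K.*-congʳ (K.trans (fromℕ-* (suc i ℕ.* m) (z u)) (K.*-congʳ (fromℕ-* (suc i) m))) ⟩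
  fromℕ (suc i) * fromℕ m * fromℕ (z u) * t               ≈⟨ solve 4 (λ a b c t → a :* b :* c :* t := c :* (a :* (b :* t))) K.refl
                                                               (fromℕ (suc i)) (fromℕ m) (fromℕ (z u)) t ⟩
  fromℕ (z u) * (fromℕ (suc i) * (fromℕ m * t))           ≈⟨ K.*-congˡ (K.*-congˡ (wordTotal-∂ i u g)) ⟨
  fromℕ (z u) * (fromℕ (suc i) * wordTotal u (∂ (suc i) g)) ≈⟨ K.*-congˡ (eval-scale _ (fromℕ (suc i)) (∂ (suc i) g)) ⟨
  fromℕ (z u) * wordTotal u (D (suc i) g)                 ∎
  where
  open K-Reasoning
  m = suc (multiplicity i u)
  t = wordTotal (i ∷ u) g

wordPairing-functional : ∀ u → Functional (wordPairing u)
wordPairing-functional u = functional-scale (fromℕ (z u)) (wordTotal-functional u)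

-- The recursion for z depends on the order of the letters. Invariance is obtained from the
-- commutation of the D_k, without a closed formula for z.
wordPairing-invariant : ∀ g → Invariant (λ u → wordPairing u g)
wordPairing-invariant g ↭.refl = K.refl
wordPairing-invariant g (prep {u} {v} i e) = K.trans (wordPairing-∷ i u g)
  (K.trans (wordPairing-invariant (D (suc i) g) e) (K.sym (wordPairing-∷ i v g)))
wordPairing-invariant g (swap {u} {v} i j e) = begin
  wordPairing (i ∷ j ∷ u) g                 ≈⟨ K.trans (wordPairing-∷ i (j ∷ u) g) (wordPairing-∷ j u (D (suc i) g)) ⟩
  wordPairing u (D (suc j) (D (suc i) g))   ≈⟨ Functional.resp (wordPairing-functional u) (D-comm (suc j) (suc i) g) ⟩
  wordPairing u (D (suc i) (D (suc j) g))   ≈⟨ wordPairing-invariant (D (suc i) (D (suc j) g)) e ⟩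
  wordPairing v (D (suc i) (D (suc j) g))   ≈⟨ K.trans (wordPairing-∷ j (i ∷ v) g) (wordPairing-∷ i v (D (suc j) g)) ⟨
  wordPairing (j ∷ i ∷ v) g                 ∎
  where open K-Reasoning
wordPairing-invariant g (↭.trans e f) = K.trans (wordPairing-invariant g e) (wordPairing-invariant g f)

⟪_,_⟫ : Λ → Λ → ℚ⟨α⟩
⟪ f , g ⟫ = eval (λ u → wordPairing u g) f

bilinear≈eval : ∀ w f g → bilinear w f g ≈ eval (λ u → w u * wordTotal u g) f
bilinear≈eval w []            g = K.refl
bilinear≈eval w ((c , u) ∷ f) g = K.+-cong (row g) (bilinear≈eval w f g)
  where
  row : ∀ g → Σᴷ (map (λ (d , v) → if does (sameMonomial? u v) then c * d * w u else 0#) g) ≈ c * (w u * wordTotal u g)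
  row []            = solve 2 (λ c w → con 0ℤ := c :* (w :* con 0ℤ)) K.refl c (w u)
  row ((d , v) ∷ g) = K.trans (K.+-cong (if-scale (does (sameMonomial? u v)) (c * d * w u)) (row g))
    (solve 5 (λ c w d x t → c :* d :* w :* x :+ c :* (w :* t) := c :* (w :* (d :* x :+ t))) K.refl
      c (w u) d (indicator (u ↭? v)) (wordTotal u g))

Hall≈ : ∀ f g → ⟨ f , g ⟩Hall ≈ ⟪ f , g ⟫
Hall≈ = bilinear≈eval (λ u → fromℕ (z u))

pairing-functionalˡ : ∀ g → Functional (λ f → ⟪ f , g ⟫)
pairing-functionalˡ g = eval-functional (wordPairing-invariant g)

pairing-functionalʳ : ∀ f → Functional (λ g → ⟪ f , g ⟫)
pairing-functionalʳ f = record
  { resp   = λ e → eval-cong (λ u → Functional.resp (wordPairing-functional u) e) f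
  ; +-homo = λ g h → K.trans (eval-cong (λ u → Functional.+-homo (wordPairing-functional u) g h) f) (eval-+ (λ u → wordPairing u g) (λ u → wordPairing u h) f)
  ; c-homo = λ c g → K.trans (eval-cong (λ u → Functional.c-homo (wordPairing-functional u) c g) f) (eval-* c (λ u → wordPairing u g) f)
  }

pairing-monomialˡ : ∀ u g → ⟪ monomial u , g ⟫ ≈ wordPairing u g
pairing-monomialˡ u g = solve 1 (λ x → con 1ℤ :* x :+ con 0ℤ := x) K.refl (wordPairing u g)

pairing-sym : ∀ f g → ⟪ f , g ⟫ ≈ ⟪ g , f ⟫
pairing-sym f g = functional-ext (pairing-functionalˡ g) (pairing-functionalʳ g) (λ u → functional-ext
  (pairing-functionalʳ (monomial u)) (pairing-functionalˡ (monomial u)) (words u) g) f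
  where
  words : ∀ u v → ⟪ monomial u , monomial v ⟫ ≈ ⟪ monomial v , monomial u ⟫
  words u v = K.trans (pairing-monomialˡ u (monomial v)) (K.trans (go (u ↭? v)) (K.sym (pairing-monomialˡ v (monomial u))))
    where
    go : Dec (u ↭ v) → wordPairing u (monomial v) ≈ wordPairing v (monomial u)
    go (yes u↭v) = K.trans (wordPairing-invariant (monomial v) u↭v)
      (Functional.resp (wordPairing-functional v) (monomial-↭ (↭-sym u↭v)))
    go (no u↮v) = K.trans (K.*-congˡ (wordTotal-↮ u↮v)) (K.trans (K.zeroʳ (fromℕ (z u)))
      (K.sym (K.trans (K.*-congˡ (wordTotal-↮ (u↮v ∘ ↭-sym))) (K.zeroʳ (fromℕ (z v))))))

P-adjointˡ : ∀ k f g → ⟪ P k *ᴸ f , g ⟫ ≈ ⟪ f , D k g ⟫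
P-adjointˡ zero f g = K.trans (Functional.resp (pairing-functionalˡ g) (L.zeroˡ f))
  (K.sym (K.trans (Functional.resp (pairing-functionalʳ f) (0· (∂ 0 g))) (Functional.0-homo (pairing-functionalʳ f))))
P-adjointˡ (suc i) f g = K.trans (Functional.resp (pairing-functionalˡ g) (L.sym (p≋* (suc i) f)))
  (K.trans (eval-map₂ (λ u → wordPairing u g) (i ∷_) f) (eval-cong (λ u → wordPairing-∷ i u g) f))

P-adjointʳ : ∀ k f g → ⟪ f , P k *ᴸ g ⟫ ≈ ⟪ D k f , g ⟫
P-adjointʳ k f g = K.trans (pairing-sym f (P k *ᴸ g)) (K.trans (P-adjointˡ k g f) (pairing-sym g (D k f)))

-- ⟨ f , g ⟩α = ⟨ f , θ g ⟩Hall

θ : Operator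
θ = linearExtension (λ u → (α ^ length u) ·ᴸ monomial u)

θ-monomial : ∀ u → θ (monomial u) ≋ const (α ^ length u) *ᴸ monomial u
θ-monomial u = L.trans (linearExtension-monomial (λ u → (α ^ length u) ·ᴸ monomial u) u) (·≋const (α ^ length u) (monomial u))

θ-linear : Linear θ
θ-linear = linearExtension-linear _ (λ {u} {v} e → L.trans (θ-monomial u)
  (L.trans (L.*-cong (const-cong (K.reflexive (cong (α ^_) (↭ₚ.↭-length e)))) (monomial-↭ e)) (L.sym (θ-monomial v))))

linear-const : ∀ {A} → Linear A → ∀ c f → A (const c *ᴸ f) ≋ const c *ᴸ A f
linear-const lin c f = L.trans (≋-cong (L.sym (·≋const c f))) (L.trans (·-homo c f) (·≋const c _))
  where open Linear lin

wordTotal-θ : ∀ u f → wordTotal u (θ f) ≈ α ^ length u * wordTotal u f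
wordTotal-θ u = functional-ext (functional-∘ (wordTotal-functional u) θ-linear)
  (functional-scale (α ^ length u) (wordTotal-functional u)) word
  where
  open K-Reasoning
  word : ∀ v → wordTotal u (θ (monomial v)) ≈ α ^ length u * wordTotal u (monomial v)
  word v = K.trans (resp (θ-monomial v)) (K.trans (c-homo (α ^ length v) (monomial v)) (go (u ↭? v)))
    where
    open Functional (wordTotal-functional u)
    go : Dec (u ↭ v) → α ^ length v * wordTotal u (monomial v) ≈ α ^ length u * wordTotal u (monomial v)
    go (yes e) = K.*-congʳ (K.reflexive (cong (α ^_) (≡.sym (↭ₚ.↭-length e))))
    go (no ¬e) = begin
      α ^ length v * wordTotal u (monomial v) ≈⟨ K.*-congˡ (wordTotal-↮ ¬e) ⟩
      α ^ length v * 0#                       ≈⟨ K.trans (K.zeroʳ _) (K.sym (K.zeroʳ _)) ⟩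
      α ^ length u * 0#                       ≈⟨ K.*-congˡ (wordTotal-↮ ¬e) ⟨
      α ^ length u * wordTotal u (monomial v) ∎

⟨⟩α≈θ : ∀ f g → ⟨ f , g ⟩α ≈ ⟪ f , θ g ⟫
⟨⟩α≈θ f g = K.trans (bilinear≈eval (λ u → fromℕ (z u) * α ^ length u) f g)
  (eval-cong (λ u → K.trans (K.*-assoc _ _ _) (K.*-congˡ (K.sym (wordTotal-θ u g)))) f)

θ-injective : ∀ {f} → θ f ≋ 0ᴸ → f ≋ 0ᴸ
θ-injective {f} e = fromᴸ λ u → K.trans (coefficient≈total u f)
  (*-cancelˡ (α ^ length u) (α^n≉0 (length u)) (K.trans (K.sym (wordTotal-θ u f))
    (K.trans (Functional.resp (wordTotal-functional u) e) (K.sym (K.zeroʳ _)))))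

θ-P : ∀ k f → θ (P k *ᴸ f) ≋ const α *ᴸ (P k *ᴸ θ f)
θ-P zero f = L.trans (Linear.vanishes θ-linear (L.zeroˡ f)) (L.sym (L.trans (L.*-congˡ (L.zeroˡ (θ f))) (L.zeroʳ (const α))))
θ-P (suc i) = linear-ext (∘-linear θ-linear (*-linearˡ (P (suc i))))
  (∘-linear (*-linearˡ (const α)) (∘-linear (*-linearˡ (P (suc i))) θ-linear)) word
  where
  open L-Reasoning
  word : ∀ u → θ (P (suc i) *ᴸ monomial u) ≋ const α *ᴸ (P (suc i) *ᴸ θ (monomial u))
  word u = begin
    θ (P (suc i) *ᴸ monomial u)               ≈⟨ Linear.≋-cong θ-linear (p≋* (suc i) (monomial u)) ⟨
    θ (monomial (i ∷ u))                      ≈⟨ θ-monomial (i ∷ u) ⟩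
    const (α * α ^ length u) *ᴸ monomial (i ∷ u) ≈⟨ L.*-cong (const-* α (α ^ length u)) (p≋* (suc i) (monomial u)) ⟩
    const α *ᴸ const (α ^ length u) *ᴸ (P (suc i) *ᴸ monomial u)
      ≈⟨ solveᴸ 4 (λ a b p m → a :*ᴸ b :*ᴸ (p :*ᴸ m) :=ᴸ a :*ᴸ (p :*ᴸ (b :*ᴸ m))) L.refl (const α) (const (α ^ length u)) (P (suc i)) (monomial u) ⟩
    const α *ᴸ (P (suc i) *ᴸ (const (α ^ length u) *ᴸ monomial u)) ≈⟨ L.*-congˡ (L.*-congˡ (θ-monomial u)) ⟨
    const α *ᴸ (P (suc i) *ᴸ θ (monomial u))  ∎

θ-δ : ∀ k l f → θ (δ k l *ᴸ f) ≋ δ k l *ᴸ θ f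
θ-δ k l f with does (k ℕ.≟ l)
... | true  = L.trans (Linear.≋-cong θ-linear (L.*-identityˡ f)) (L.sym (L.*-identityˡ (θ f)))
... | false = L.trans (Linear.vanishes θ-linear (L.zeroˡ f)) (L.sym (L.zeroˡ (θ f)))

-- θ is the substitution of α p_k for p_k, so this is the chain rule.
θ-D : ∀ k f → D k (θ f) ≋ const α *ᴸ θ (D k f)
θ-D k = linear-ext (∘-linear (D-linear k) θ-linear) (∘-linear (*-linearˡ (const α)) (∘-linear θ-linear (D-linear k))) word
  where
  open L-Reasoning
  c = const (fromℕ k)
  word : ∀ u → D k (θ (monomial u)) ≋ const α *ᴸ θ (D k (monomial u))
  word [] = L.trans (Linear.≋-cong (D-linear k) (θ-monomial [])) (L.trans (linear-const (D-linear k) 1# 1ᴸ)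
    (L.trans (L.*-congˡ (D-1 k)) (L.trans (L.zeroʳ 1ᴸ) (L.sym (L.trans (L.*-congˡ (Linear.vanishes θ-linear (D-1 k))) (L.zeroʳ (const α)))))))
  word (i ∷ u) = begin
    D k (θ (monomial (i ∷ u)))
      ≈⟨ Linear.≋-cong (D-linear k) (L.trans (Linear.≋-cong θ-linear (p≋* (suc i) (monomial u))) (θ-P (suc i) (monomial u))) ⟩
    D k (const α *ᴸ (P (suc i) *ᴸ θ m))
      ≈⟨ linear-const (D-linear k) α _ ⟩
    const α *ᴸ D k (P (suc i) *ᴸ θ m)
      ≈⟨ L.*-congˡ (D-* k (P (suc i)) (θ m)) ⟩
    const α *ᴸ (D k (P (suc i)) *ᴸ θ m +ᴸ P (suc i) *ᴸ D k (θ m))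
      ≈⟨ L.*-congˡ (L.+-cong (L.*-congʳ (D-P k (suc i))) (L.*-congˡ (word u))) ⟩
    const α *ᴸ (c *ᴸ δ k (suc i) *ᴸ θ m +ᴸ P (suc i) *ᴸ (const α *ᴸ θ (D k m)))
      ≈⟨ L.*-congˡ (L.+-cong
           (L.trans (L.*-assoc c _ _) (L.trans (L.*-congˡ (L.sym (θ-δ k (suc i) m))) (L.sym (linear-const θ-linear (fromℕ k) _))))
           (L.trans (solveᴸ 3 (λ a b x → a :*ᴸ (b :*ᴸ x) :=ᴸ b :*ᴸ (a :*ᴸ x)) L.refl (P (suc i)) (const α) (θ (D k m)))
                    (L.sym (θ-P (suc i) (D k m))))) ⟩
    const α *ᴸ (θ (c *ᴸ (δ k (suc i) *ᴸ m)) +ᴸ θ (P (suc i) *ᴸ D k m))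
      ≈⟨ L.*-congˡ (Linear.+-homo θ-linear (c *ᴸ (δ k (suc i) *ᴸ m)) (P (suc i) *ᴸ D k m)) ⟨
    const α *ᴸ θ (c *ᴸ (δ k (suc i) *ᴸ m) +ᴸ P (suc i) *ᴸ D k m)
      ≈⟨ L.*-congˡ (Linear.≋-cong θ-linear (L.+-congʳ (L.trans (L.sym (L.*-assoc c _ _)) (L.*-congʳ (L.sym (D-P k (suc i))))))) ⟩
    const α *ᴸ θ (D k (P (suc i)) *ᴸ m +ᴸ P (suc i) *ᴸ D k m)
      ≈⟨ L.*-congˡ (Linear.≋-cong θ-linear (D-* k (P (suc i)) m)) ⟨
    const α *ᴸ θ (D k (P (suc i) *ᴸ m))
      ≈⟨ L.*-congˡ (Linear.≋-cong θ-linear (Linear.≋-cong (D-linear k) (p≋* (suc i) m))) ⟨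
    const α *ᴸ θ (D k (monomial (i ∷ u))) ∎
    where m = monomial u

θ-adjoint : ∀ f g → ⟪ f , θ g ⟫ ≈ ⟪ θ f , g ⟫
θ-adjoint f g = functional-ext (pairing-functionalˡ (θ g)) (functional-∘ (pairing-functionalˡ g) θ-linear) word f
  where
  word : ∀ u → ⟪ monomial u , θ g ⟫ ≈ ⟪ θ (monomial u) , g ⟫
  word u = K.trans (pairing-monomialˡ u (θ g)) (K.trans (K.*-congˡ (wordTotal-θ u g))
    (K.trans (solve 3 (λ a b c → a :* (b :* c) := b :* (a :* c)) K.refl (fromℕ (z u)) (α ^ length u) (wordTotal u g))
    (K.sym (K.trans (Functional.resp (pairing-functionalˡ g) (θ-monomial u))
      (K.trans (Functional.c-homo (pairing-functionalˡ g) (α ^ length u) (monomial u)) (K.*-congˡ (pairing-monomialˡ u g)))))))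

-- Complete functions are Hall dual to monomial functions

ε-p : ∀ i f → wordTotal [] (p (suc i) f) ≈ 0#
ε-p i f = K.trans (eval-map₂ _ (i ∷_) f) (K.trans (eval-cong (λ v → K.sym (indicator-no ([] ↭? (i ∷ v)) ((λ ()) ∘ ↭ₚ.↭-length))) f) (eval-0 f))

ε-h : ∀ n f → wordTotal [] (h (suc n) *ᴸ f) ≈ 0#
ε-h n f = K.trans (resp (L.trans (L.*-congʳ (·≋const (1/suc n) (conv (suc n) P))) (L.*-assoc _ _ _)))
  (K.trans (c-homo (1/suc n) (conv (suc n) P *ᴸ f)) (K.trans (K.*-congˡ (ε-conv (suc n) id)) (K.zeroʳ _)))
  where
  open Functional (wordTotal-functional [])
  -- The reindexing s makes the induction work, since `conv` shifts its sequence at each step.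
  ε-conv : ∀ m (s : ℕ → ℕ) → wordTotal [] (conv m (λ k → P (s k)) *ᴸ f) ≈ 0#
  ε-conv zero    s = K.trans (resp (L.zeroˡ f)) 0-homo
  ε-conv (suc m) s = K.trans (resp (L.distribʳ f (P (s 1) *ᴸ h m) _)) (K.trans (+-homo (P (s 1) *ᴸ h m *ᴸ f) (conv m (λ k → P (s (suc k))) *ᴸ f))
    (K.trans (K.+-cong (K.trans (resp (L.*-assoc (P (s 1)) (h m) f)) (ε-P (s 1))) (ε-conv m (s ∘ suc))) (K.+-identityˡ 0#)))
    where
    ε-P : ∀ k → wordTotal [] (P k *ᴸ (h m *ᴸ f)) ≈ 0#
    ε-P zero    = K.trans (resp (L.zeroˡ (h m *ᴸ f))) 0-homo
    ε-P (suc i) = K.trans (resp (L.sym (p≋* (suc i) (h m *ᴸ f)))) (ε-p i (h m *ᴸ f))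

ε-hs : ∀ β → wordTotal [] (hs β) ≈ fromℕ (xCoefficient [] β)
ε-hs []          = solve 0 (con 1ℤ :* con 1ℤ :+ con 0ℤ := con 1ℤ) K.refl
ε-hs (zero ∷ β)  = K.trans (Functional.resp (wordTotal-functional []) (L.*-identityˡ (hs β))) (ε-hs β)
ε-hs (suc n ∷ β) = ε-h n (hs β)

Σhs : List (List ℕ) → Λ
Σhs = foldr (λ β f → hs β +ᴸ f) 0ᴸ

Σhs-++ : ∀ βs γs → Σhs (βs ++ γs) ≋ Σhs βs +ᴸ Σhs γs
Σhs-++ []       γs = L.refl
Σhs-++ (β ∷ βs) γs = L.trans (L.+-congˡ {hs β} (Σhs-++ βs γs)) (L.sym (L.+-assoc (hs β) (Σhs βs) (Σhs γs)))

Σhs-∷ : ∀ n βs → Σhs (map (n ∷_) βs) ≋ h n *ᴸ Σhs βs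
Σhs-∷ n []       = L.sym (L.zeroʳ (h n))
Σhs-∷ n (β ∷ βs) = L.trans (L.+-congˡ {h n *ᴸ hs β} (Σhs-∷ n βs)) (L.sym (L.distribˡ (h n) (hs β) (Σhs βs)))

-- By the product rule and D_k h_n = h_{n-k}, the operation `lower` from the definition of the
-- coefficient of x^β reappears as the action of D_k on h_β.
D-hs : ∀ k β → D (suc k) (hs β) ≋ Σhs (lower (suc k) β)
D-hs k []      = D-1 (suc k)
D-hs k (n ∷ β) = L.trans (D-* (suc k) (h n) (hs β))
  (L.trans (L.+-cong (L.trans (L.*-congʳ (D-h k n)) lead) (L.trans (L.*-congˡ (D-hs k β)) (L.sym (Σhs-∷ n (lower (suc k) β)))))
    (L.sym (Σhs-++ (if does (suc k ℕ.≤? n) then [ n ∸ suc k ∷ β ] else []) (map (n ∷_) (lower (suc k) β)))))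
  where
  lead : h↓ n (suc k) *ᴸ hs β ≋ Σhs (if does (suc k ℕ.≤? n) then [ n ∸ suc k ∷ β ] else [])
  lead with suc k ℕ.≤? n
  ... | yes k<n rewrite dec-true (suc k ℕ.≤? n) k<n = L.trans (L.*-congʳ (L.reflexive (h↓-≤ k<n))) (L.sym (L.+-identityʳ _))
  ... | no k≮n rewrite dec-false (suc k ℕ.≤? n) k≮n = L.trans (L.*-congʳ (L.reflexive (h↓-> (ℕ.≰⇒> k≮n)))) (L.zeroˡ (hs β))

-- Moving the letters of u across as derivatives reproduces the recursion of `xCoefficient`; at the
-- empty word only the constant term of h_β remains.
wordPairing-hs : ∀ u β → wordPairing u (hs β) ≈ fromℕ (xCoefficient u β)
wordPairing-hs []      β = K.trans (K.*-identityˡ _) (ε-hs β)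
wordPairing-hs (i ∷ u) β = K.trans (wordPairing-∷ i u (hs β)) (K.trans (resp (D-hs i β)) (go (lower (suc i) β)))
  where
  open Functional (wordPairing-functional u)
  go : ∀ βs → wordPairing u (Σhs βs) ≈ fromℕ (sum (map (xCoefficient u) βs))
  go []       = 0-homo
  go (β ∷ βs) = K.trans (+-homo (hs β) (Σhs βs))
    (K.trans (K.+-cong (wordPairing-hs u β) (go βs)) (K.sym (fromℕ-+ (xCoefficient u β) _)))

mCoefficient≈ : ∀ lam f → mCoefficient lam f ≈ ⟪ f , hs (parts lam) ⟫
mCoefficient≈ lam []            = K.refl
mCoefficient≈ lam ((c , u) ∷ f) = K.+-cong (K.*-congˡ (K.sym (wordPairing-hs u (parts lam)))) (mCoefficient≈ lam f)

-- θ-symmetry of E and Δ₂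

pairing-PD : ∀ k f g → ⟪ f , P k *ᴸ D k (θ g) ⟫ ≈ ⟪ P k *ᴸ D k (θ f) , g ⟫
pairing-PD k f g = begin
  ⟪ f , P k *ᴸ D k (θ g) ⟫          ≈⟨ P-adjointʳ k f (D k (θ g)) ⟩
  ⟪ D k f , D k (θ g) ⟫             ≈⟨ Functional.resp (pairing-functionalʳ (D k f)) (θ-D k g) ⟩
  ⟪ D k f , const α *ᴸ θ (D k g) ⟫  ≈⟨ Functional.c-homo (pairing-functionalʳ (D k f)) α (θ (D k g)) ⟩
  α * ⟪ D k f , θ (D k g) ⟫         ≈⟨ K.*-congˡ (θ-adjoint (D k f) (D k g)) ⟩
  α * ⟪ θ (D k f) , D k g ⟫         ≈⟨ Functional.c-homo (pairing-functionalˡ (D k g)) α (θ (D k f)) ⟨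
  ⟪ const α *ᴸ θ (D k f) , D k g ⟫  ≈⟨ Functional.resp (pairing-functionalˡ (D k g)) (θ-D k f) ⟨
  ⟪ D k (θ f) , D k g ⟫             ≈⟨ P-adjointˡ k (D k (θ f)) g ⟨
  ⟪ P k *ᴸ D k (θ f) , g ⟫          ∎
  where open K-Reasoning

pairing-E : ∀ N f g → ⟪ f , Eₙ N (θ g) ⟫ ≈ ⟪ Eₙ N (θ f) , g ⟫
pairing-E N f g = functional-sumᴸ (pairing-functionalʳ f) (pairing-functionalˡ g) N (λ i → pairing-PD (suc i) f g)

pairing-U : ∀ N f g → ⟪ f , U N (θ g) ⟫ ≈ ⟪ U N (θ f) , g ⟫
pairing-U N f g = functional-sumᴸ (pairing-functionalʳ f) (pairing-functionalˡ g) N λ i → begin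
  ⟪ f , κ i *ᴸ P (suc i) *ᴸ D (suc i) (θ g) ⟫       ≈⟨ F.resp (L.*-assoc (κ i) (P (suc i)) (D (suc i) (θ g))) ⟩
  ⟪ f , κ i *ᴸ (P (suc i) *ᴸ D (suc i) (θ g)) ⟫     ≈⟨ F.c-homo (fromℕ i) (P (suc i) *ᴸ D (suc i) (θ g)) ⟩
  fromℕ i * ⟪ f , P (suc i) *ᴸ D (suc i) (θ g) ⟫    ≈⟨ K.*-congˡ (pairing-PD (suc i) f g) ⟩
  fromℕ i * ⟪ P (suc i) *ᴸ D (suc i) (θ f) , g ⟫    ≈⟨ G.c-homo (fromℕ i) (P (suc i) *ᴸ D (suc i) (θ f)) ⟨
  ⟪ κ i *ᴸ (P (suc i) *ᴸ D (suc i) (θ f)) , g ⟫     ≈⟨ G.resp (L.*-assoc (κ i) (P (suc i)) (D (suc i) (θ f))) ⟨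
  ⟪ κ i *ᴸ P (suc i) *ᴸ D (suc i) (θ f) , g ⟫       ∎
  where
  open K-Reasoning
  module F = Functional (pairing-functionalʳ f)
  module G = Functional (pairing-functionalˡ g)

-- Hall adjunction turns p_i p_j D_m into p_m D_j D_i with m = i + j. Moving θ past one derivative
-- gives a factor α and past two of them α², so the factor α in front of R balances the two sides.
pairing-RQ : ∀ N f g → ⟪ f , const α *ᴸ R N (θ g) ⟫ ≈ ⟪ Q N (θ f) , g ⟫
pairing-RQ N f g = functional-sumᴸ αF (pairing-functionalˡ g) N λ i → functional-sumᴸ αF (pairing-functionalˡ g) N λ j → term (suc i) (suc j)
  where
  open K-Reasoning
  αF : Functional (λ x → ⟪ f , const α *ᴸ x ⟫)
  αF = ∘*-functional (pairing-functionalʳ f) (const α)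
  term : ∀ i j → ⟪ f , const α *ᴸ (P i *ᴸ P j *ᴸ D (i ℕ.+ j) (θ g)) ⟫ ≈ ⟪ P (i ℕ.+ j) *ᴸ D i (D j (θ f)) , g ⟫
  term i j = begin
    ⟪ f , const α *ᴸ (P i *ᴸ P j *ᴸ D m (θ g)) ⟫   ≈⟨ Functional.c-homo (pairing-functionalʳ f) α _ ⟩
    α * ⟪ f , P i *ᴸ P j *ᴸ D m (θ g) ⟫            ≈⟨ K.*-congˡ (Functional.resp (pairing-functionalʳ f) (L.*-assoc (P i) (P j) (D m (θ g)))) ⟩
    α * ⟪ f , P i *ᴸ (P j *ᴸ D m (θ g)) ⟫          ≈⟨ K.*-congˡ (K.trans (P-adjointʳ i f (P j *ᴸ D m (θ g))) (P-adjointʳ j (D i f) (D m (θ g)))) ⟩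
    α * ⟪ D j (D i f) , D m (θ g) ⟫                ≈⟨ K.*-congˡ (K.trans (Functional.resp (pairing-functionalʳ (D j (D i f))) (θ-D m g)) (Functional.c-homo (pairing-functionalʳ (D j (D i f))) α (θ (D m g)))) ⟩
    α * (α * ⟪ D j (D i f) , θ (D m g) ⟫)          ≈⟨ K.*-congˡ (K.*-congˡ (θ-adjoint (D j (D i f)) (D m g))) ⟩
    α * (α * ⟪ θ (D j (D i f)) , D m g ⟫)          ≈⟨ K.*-congˡ (K.*-congˡ (resp (Linear.≋-cong θ-linear (D-comm j i f)))) ⟩
    α * (α * ⟪ θ (D i (D j f)) , D m g ⟫)          ≈⟨ K.trans (c-homo α (const α *ᴸ θ (D i (D j f)))) (K.*-congˡ (c-homo α (θ (D i (D j f))))) ⟨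
    ⟪ const α *ᴸ (const α *ᴸ θ (D i (D j f))) , D m g ⟫
      ≈⟨ resp (L.trans (Linear.≋-cong (D-linear i) (θ-D j f)) (L.trans (linear-const (D-linear i) α (θ (D j f))) (L.*-congˡ (θ-D i (D j f))))) ⟨
    ⟪ D i (D j (θ f)) , D m g ⟫                    ≈⟨ P-adjointˡ m (D i (D j (θ f))) g ⟨
    ⟪ P m *ᴸ D i (D j (θ f)) , g ⟫                 ∎
    where
    m = i ℕ.+ j
    open Functional (pairing-functionalˡ (D m g))

-- Equivalently, the conjugate of T by θ is self-adjoint for ⟨ , ⟩α.
θ-Symmetric : Operator → Set
θ-Symmetric T = ∀ f g → ⟪ f , T (θ g) ⟫ ≈ ⟪ T (θ f) , g ⟫

E-symmetric : θ-Symmetric E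
E-symmetric f g = K.trans (Functional.resp (pairing-functionalʳ f) (E≋Eₙ (θ g) (ℕ.m≤n+m (bound (θ g)) (bound (θ f)))))
  (K.trans (pairing-E N f g) (Functional.resp (pairing-functionalˡ g) (L.sym (E≋Eₙ (θ f) (ℕ.m≤m+n (bound (θ f)) (bound (θ g)))))))
  where N = bound (θ f) ℕ.+ bound (θ g)

Δ₂-symmetric : θ-Symmetric Δ₂
Δ₂-symmetric f g = begin
  ⟪ f , Δ₂ (θ g) ⟫
    ≈⟨ F.resp (Δ₂≋Δₙ (θ g) (ℕ.m≤n+m (bound (θ g)) (bound (θ f)))) ⟩
  ⟪ f , const α *ᴸ R N (θ g) +ᴸ Q N (θ g) +ᴸ const (α - 1#) *ᴸ U N (θ g) ⟫
    ≈⟨ K.trans (F.+-homo (const α *ᴸ R N (θ g) +ᴸ Q N (θ g)) (const (α - 1#) *ᴸ U N (θ g))) (K.+-cong (F.+-homo (const α *ᴸ R N (θ g)) (Q N (θ g))) (F.c-homo (α - 1#) (U N (θ g)))) ⟩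
  ⟪ f , const α *ᴸ R N (θ g) ⟫ + ⟪ f , Q N (θ g) ⟫ + (α - 1#) * ⟪ f , U N (θ g) ⟫
    -- The parts αR and Q are exchanged; the second of these relations is the first with f and g
    -- interchanged.
    ≈⟨ K.+-cong (K.+-cong (pairing-RQ N f g)
         (K.trans (pairing-sym f (Q N (θ g))) (K.trans (K.sym (pairing-RQ N g f)) (pairing-sym g (const α *ᴸ R N (θ f))))))
         (K.*-congˡ (pairing-U N f g)) ⟩
  ⟪ Q N (θ f) , g ⟫ + ⟪ const α *ᴸ R N (θ f) , g ⟫ + (α - 1#) * ⟪ U N (θ f) , g ⟫
    ≈⟨ K.+-congʳ (K.+-comm _ _) ⟩
  ⟪ const α *ᴸ R N (θ f) , g ⟫ + ⟪ Q N (θ f) , g ⟫ + (α - 1#) * ⟪ U N (θ f) , g ⟫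
    ≈⟨ K.trans (G.+-homo (const α *ᴸ R N (θ f) +ᴸ Q N (θ f)) (const (α - 1#) *ᴸ U N (θ f))) (K.+-cong (G.+-homo (const α *ᴸ R N (θ f)) (Q N (θ f))) (G.c-homo (α - 1#) (U N (θ f)))) ⟨
  ⟪ const α *ᴸ R N (θ f) +ᴸ Q N (θ f) +ᴸ const (α - 1#) *ᴸ U N (θ f) , g ⟫
    ≈⟨ G.resp (Δ₂≋Δₙ (θ f) (ℕ.m≤m+n (bound (θ f)) (bound (θ g)))) ⟨
  ⟪ Δ₂ (θ f) , g ⟫ ∎
  where
  open K-Reasoning
  N = bound (θ f) ℕ.+ bound (θ g)
  module F = Functional (pairing-functionalʳ f)
  module G = Functional (pairing-functionalˡ g)

-- Dominance order

lowered-sum : ∀ {k β γ} → Lowered k β γ → sum β ≡ k ℕ.+ sum γ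
lowered-sum {k} (here {b} {β})          = ℕ.+-assoc k b (sum β)
lowered-sum {k} (there {b} {β} {γ} l) = begin
  b ℕ.+ sum β            ≡⟨ cong (b ℕ.+_) (lowered-sum l) ⟩
  b ℕ.+ (k ℕ.+ sum γ)    ≡⟨ ℕ.+-assoc b k (sum γ) ⟨
  b ℕ.+ k ℕ.+ sum γ      ≡⟨ cong (ℕ._+ sum γ) (ℕ.+-comm b k) ⟩
  k ℕ.+ b ℕ.+ sum γ      ≡⟨ ℕ.+-assoc k b (sum γ) ⟩
  k ℕ.+ (b ℕ.+ sum γ)    ∎
  where open ≡-Reasoning

lowered-take : ∀ {k β γ} → Lowered k β γ → ∀ n → sum (take n β) ≤ k ℕ.+ sum (take n γ)
lowered-take l zero = z≤n
lowered-take {k} (here {b} {β}) (suc n) = ℕ.≤-reflexive (ℕ.+-assoc k b (sum (take n β)))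
lowered-take {k} (there {b} {β} {γ} l) (suc n) = begin
  b ℕ.+ sum (take n β)           ≤⟨ ℕ.+-monoʳ-≤ b (lowered-take l n) ⟩
  b ℕ.+ (k ℕ.+ sum (take n γ))   ≡⟨ ℕ.+-assoc b k _ ⟨
  b ℕ.+ k ℕ.+ sum (take n γ)     ≡⟨ cong (ℕ._+ sum (take n γ)) (ℕ.+-comm b k) ⟩
  k ℕ.+ b ℕ.+ sum (take n γ)     ≡⟨ ℕ.+-assoc k b _ ⟩
  k ℕ.+ (b ℕ.+ sum (take n γ))   ∎
  where open ℕ.≤-Reasoning

raised-sum : ∀ {β γ} → Raised β γ → sum β ≡ sum γ
raised-sum (here {a} {k} {β} {γ} l) = ≡.trans (cong (a ℕ.+_) (lowered-sum l)) (≡.sym (ℕ.+-assoc a (suc k) (sum γ)))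
raised-sum (there {a} r)            = cong (a ℕ.+_) (raised-sum r)

raised-take : ∀ {β γ} → Raised β γ → ∀ n → sum (take n β) ≤ sum (take n γ)
raised-take r zero = z≤n
raised-take (here {a} {k} {β} {γ} l) (suc n) = ℕ.≤-trans (ℕ.+-monoʳ-≤ a (lowered-take l n)) (ℕ.≤-reflexive (≡.sym (ℕ.+-assoc a (suc k) _)))
raised-take (there {a} r) (suc n) = ℕ.+-monoʳ-≤ a (raised-take r n)

raised-strict : ∀ {β γ} → Raised β γ → ∃ λ n → sum (take n β) < sum (take n γ)
raised-strict (here {a} {k} l) = 1 , ℕ.+-monoˡ-< 0 (ℕ.m<m+n a (s≤s z≤n))
raised-strict (there {a} r) with raised-strict r
... | n , lt = suc n , ℕ.+-monoʳ-< a lt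

private
  ≥-decTotalOrder : DecTotalOrder _ _ _
  ≥-decTotalOrder = Flip.decTotalOrder ℕ.≤-decTotalOrder
  module Desc  = Data.List.Sort.InsertionSort.Base ≥-decTotalOrder
  module Descₚ = Data.List.Sort.InsertionSort.Properties ≥-decTotalOrder

  positives : List ℕ → List ℕ
  positives = filter (0 ℕ.<?_)

-- Dropping zeros and sorting leaves h_β unchanged, because h₀ = 1 and Λ is commutative.
fromComposition : List ℕ → Partition
fromComposition β = partition (Desc.sort (positives β))
  (↭ₚ.All-resp-↭ (↭-sym (Descₚ.sort-↭ (positives β))) (All.all-filter (0 ℕ.<?_) β))
  (Descₚ.sort-↗ (positives β))

hs-↭ : ∀ {β γ} → β ↭ γ → hs β ≋ hs γ
hs-↭ ↭.refl = L.refl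
hs-↭ (prep n e) = L.*-congˡ (hs-↭ e)
hs-↭ (swap {β} {γ} m n e) = L.trans (L.*-congˡ (L.*-congˡ (hs-↭ e)))
  (solveᴸ 3 (λ x y z → x :*ᴸ (y :*ᴸ z) :=ᴸ y :*ᴸ (x :*ᴸ z)) L.refl (h m) (h n) (hs γ))
hs-↭ (↭.trans e f) = L.trans (hs-↭ e) (hs-↭ f)

hs-positives : ∀ β → hs (positives β) ≋ hs β
hs-positives []          = L.refl
hs-positives (zero ∷ β)  = L.trans (hs-positives β) (L.sym (L.*-identityˡ (hs β)))
hs-positives (suc n ∷ β) = L.*-congˡ (hs-positives β)

hs-fromComposition : ∀ β → hs (parts (fromComposition β)) ≋ hs β
hs-fromComposition β = L.trans (hs-↭ (Descₚ.sort-↭ (positives β))) (hs-positives β)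

sum-positives : ∀ β → sum (positives β) ≡ sum β
sum-positives []          = ≡.refl
sum-positives (zero ∷ β)  = sum-positives β
sum-positives (suc n ∷ β) = cong (suc n ℕ.+_) (sum-positives β)

take-positives : ∀ β n → sum (take n β) ≤ sum (take n (positives β))
take-positives β           zero    = z≤n
take-positives []          (suc n) = z≤n
take-positives (zero ∷ β)  (suc n) = ℕ.≤-trans (take-positives β n) (take-mono (positives β) n)
  where
  take-mono : ∀ β n → sum (take n β) ≤ sum (take (suc n) β)
  take-mono β       zero    = z≤n
  take-mono []      (suc n) = z≤n
  take-mono (b ∷ β) (suc n) = ℕ.+-monoʳ-≤ b (take-mono β n)
take-positives (suc b ∷ β) (suc n) = ℕ.+-monoʳ-≤ (suc b) (take-positives β n)

take-insert : ∀ b β n → sum (take n (b ∷ β)) ≤ sum (take n (Desc.insert b β))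
take-insert b β       zero    = z≤n
take-insert b []      (suc n) = ℕ.≤-refl
take-insert b (c ∷ β) (suc n) with c ℕ.≤? b
... | yes c≤b rewrite dec-true (c ℕ.≤? b) c≤b = ℕ.≤-refl
... | no c≰b rewrite dec-false (c ℕ.≤? b) c≰b = go n
  where
  go : ∀ n → b ℕ.+ sum (take n (c ∷ β)) ≤ c ℕ.+ sum (take n (Desc.insert b β))
  go zero    = ℕ.+-monoˡ-≤ 0 (ℕ.<⇒≤ (ℕ.≰⇒> c≰b))
  go (suc n) = begin
    b ℕ.+ (c ℕ.+ sum (take n β))             ≡⟨ ℕ.+-assoc b c _ ⟨
    b ℕ.+ c ℕ.+ sum (take n β)               ≡⟨ cong (ℕ._+ sum (take n β)) (ℕ.+-comm b c) ⟩
    c ℕ.+ b ℕ.+ sum (take n β)               ≡⟨ ℕ.+-assoc c b _ ⟩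
    c ℕ.+ (b ℕ.+ sum (take n β))             ≤⟨ ℕ.+-monoʳ-≤ c (take-insert b β (suc n)) ⟩
    c ℕ.+ sum (take (suc n) (Desc.insert b β)) ∎
    where open ℕ.≤-Reasoning

take-sort : ∀ β n → sum (take n β) ≤ sum (take n (Desc.sort β))
take-sort []      n       = ℕ.≤-refl
take-sort (b ∷ β) zero    = z≤n
take-sort (b ∷ β) (suc n) = ℕ.≤-trans (ℕ.+-monoʳ-≤ b (take-sort β n)) (take-insert b (Desc.sort β) (suc n))

⊴-trans : ∀ {lam mu nu} → lam ⊴ mu → mu ⊴ nu → lam ⊴ nu
⊴-trans (e , l) (e′ , l′) = ≡.trans e e′ , λ n → ℕ.≤-trans (l n) (l′ n)

-- Moving boxes to earlier rows raises partial sums weakly; dropping zeros and sorting in decreasing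
-- order can only raise them further.
raised-⊴ : ∀ {lam γ} → Raised (parts lam) γ → lam ⊴ fromComposition γ
raised-⊴ {lam} {γ} r =
    ≡.trans (raised-sum r) (≡.sym (≡.trans (sum-↭ (Descₚ.sort-↭ (positives γ))) (sum-positives γ)))
  , λ n → ℕ.≤-trans (raised-take r n) (ℕ.≤-trans (take-positives γ n) (take-sort (positives γ) n))

raised-≢ : ∀ {lam γ} → Raised (parts lam) γ → lam ≢ fromComposition γ
raised-≢ {lam} {γ} r e with raised-strict r
... | n , lt = ℕ.<-irrefl (cong (sum ∘ take n ∘ parts) e)
  (ℕ.<-≤-trans lt (ℕ.≤-trans (take-positives γ n) (take-sort (positives γ) n)))

parts-injective : ∀ {lam mu} → parts lam ≡ parts mu → lam ≡ mu
parts-injective {partition _ _ _} {partition _ _ _} ≡.refl = ≡.refl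

_≟ₚ_ : (lam mu : Partition) → Dec (lam ≡ mu)
lam ≟ₚ mu = map′ parts-injective (cong parts) (List.≡-dec ℕ._≟_ (parts lam) (parts mu))

parts-positive : ∀ lam → All (0 <_) (parts lam)
parts-positive (partition β β>0 _) = recompute (All.all? (0 ℕ.<?_) β) β>0

-- Positivity excludes trailing zeros, which partial sums do not detect.
partial-sums-injective : ∀ {β γ} → All (0 <_) β → All (0 <_) γ → (∀ n → sum (take n β) ≡ sum (take n γ)) → β ≡ γ
partial-sums-injective []        []        e = ≡.refl
partial-sums-injective []        (c>0 ∷ _) e = contradiction (≡.trans (e 1) (ℕ.+-identityʳ _)) (ℕ.<⇒≢ c>0)
partial-sums-injective (b>0 ∷ _) []        e = contradiction (≡.trans (≡.sym (e 1)) (ℕ.+-identityʳ _)) (ℕ.<⇒≢ b>0)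
partial-sums-injective {b ∷ β} {c ∷ γ} (_ ∷ β>0) (_ ∷ γ>0) e with ℕ.+-cancelʳ-≡ 0 b c (e 1)
... | ≡.refl = cong (b ∷_) (partial-sums-injective β>0 γ>0 (λ n → ℕ.+-cancelˡ-≡ b _ _ (e (suc n))))

⊴-antisym : ∀ {lam mu} → lam ⊴ mu → mu ⊴ lam → lam ≡ mu
⊴-antisym {lam} {mu} (_ , l) (_ , l′) = parts-injective
  (partial-sums-injective (parts-positive lam) (parts-positive mu) (λ n → ℕ.≤-antisym (l n) (l′ n)))

sumTo : ℕ → (ℕ → ℕ) → ℕ
sumTo zero    f = 0
sumTo (suc n) f = f n ℕ.+ sumTo n f

sumTo-mono : ∀ N {f g} → (∀ n → f n ≤ g n) → sumTo N f ≤ sumTo N g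
sumTo-mono zero    l = z≤n
sumTo-mono (suc N) l = ℕ.+-mono-≤ (l N) (sumTo-mono N l)

sumTo-strict : ∀ N {f g} → (∀ n → f n ≤ g n) → (sumTo N f < sumTo N g) ⊎ (∀ {n} → n < N → f n ≡ g n)
sumTo-strict zero    l = inj₂ λ ()
sumTo-strict (suc N) {f} {g} l with f N ℕ.≟ g N | sumTo-strict N l
... | no  f≢g | _       = inj₁ (ℕ.+-mono-<-≤ (ℕ.≤∧≢⇒< (l N) f≢g) (sumTo-mono N l))
... | yes _   | inj₁ lt = inj₁ (ℕ.+-mono-≤-< (l N) lt)
... | yes f≡g | inj₂ e  = inj₂ λ {n} n<1+N → go (ℕ.m≤n⇒m<n∨m≡n (ℕ.s≤s⁻¹ n<1+N))
  where
  go : ∀ {n} → n < N ⊎ n ≡ N → f n ≡ g n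
  go (inj₁ n<N)    = e n<N
  go (inj₂ ≡.refl) = f≡g

sum-take≤ : ∀ β n → sum (take n β) ≤ sum β
sum-take≤ β       zero    = z≤n
sum-take≤ []      (suc n) = z≤n
sum-take≤ (b ∷ β) (suc n) = ℕ.+-monoʳ-≤ b (sum-take≤ β n)

sum-take≡ : ∀ {β} n → All (0 <_) β → sum β ≤ n → sum (take n β) ≡ sum β
sum-take≡ zero    []          _  = ≡.refl
sum-take≡ zero    (s≤s _ ∷ _) ()
sum-take≡ (suc n) []          _  = ≡.refl
sum-take≡ {suc b ∷ β} (suc n) (_ ∷ β>0) (s≤s b+β≤n) =
  cong (suc b ℕ.+_) (sum-take≡ n β>0 (ℕ.≤-trans (ℕ.m≤n+m (sum β) b) b+β≤n))

-- n(λ) = Σ_i i λ_{i+1} in terms of partial sums; it strictly decreases along ⊴.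
defect : Partition → ℕ
defect lam = sumTo ∣ lam ∣ λ n → ∣ lam ∣ ∸ sum (take n (parts lam))

defect-< : ∀ {lam mu} → lam ⊴ mu → lam ≢ mu → defect mu < defect lam
defect-< {lam} {mu} lam⊴mu@(e , l) lam≢mu with sumTo-strict ∣ lam ∣ {λ n → ∣ lam ∣ ∸ sum (take n (parts mu))} {λ n → ∣ lam ∣ ∸ sum (take n (parts lam))} (λ n → ℕ.∸-monoʳ-≤ ∣ lam ∣ (l n))
... | inj₁ lt = ≡.subst (_< defect lam) (cong (λ N → sumTo N (λ n → N ∸ sum (take n (parts mu)))) e) lt
... | inj₂ eq = contradiction (⊴-antisym lam⊴mu (≡.sym e , λ n → ℕ.≤-reflexive (equal n))) lam≢mu
  where
  equal : ∀ n → sum (take n (parts mu)) ≡ sum (take n (parts lam))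
  -- A partition has at most as many parts as its size, so from n = |λ| on both partial sums are the
  -- full size.
  equal n with n ℕ.<? ∣ lam ∣
  ... | yes n<N = ℕ.∸-cancelˡ-≡ (≡.subst (sum (take n (parts mu)) ≤_) (≡.sym e) (sum-take≤ (parts mu) n)) (sum-take≤ (parts lam) n) (eq n<N)
  ... | no n≮N = ≡.trans (sum-take≡ n (parts-positive mu) (≡.subst (_≤ n) e (ℕ.≮⇒≥ n≮N)))
                   (≡.trans (≡.sym e) (≡.sym (sum-take≡ n (parts-positive lam) (ℕ.≮⇒≥ n≮N))))

-- Eigenvectors

-- The local function `rows` of `boxes` cannot be named; abstracting its
-- arguments 0 and `parts lam` makes it the solution of a pattern unification problem.
mutual
  rows : Partition → ℕ → List ℕ → List Box
  rows = _

  boxes≡rows : ∀ lam → boxes lam ≡ rows lam 0 (parts lam)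
  boxes≡rows lam with 0 | parts lam
  ... | i | β = ≡.refl

length-boxes : ∀ lam → length (boxes lam) ≡ ∣ lam ∣
length-boxes lam = ≡.trans (cong length (boxes≡rows lam)) (go 0 (parts lam))
  where
  go : ∀ i β → length (rows lam i β) ≡ sum β
  go i []      = ≡.refl
  go i (n ∷ β) = ≡.trans (List.length-++ (map (i ,_) (upTo n)))
    (cong₂ ℕ._+_ (≡.trans (List.length-map (i ,_) (upTo n)) (List.length-upTo n)) (go (suc i) β))

Σᴷ-++ : ∀ xs ys → Σᴷ (xs ++ ys) ≈ Σᴷ xs + Σᴷ ys
Σᴷ-++ []       ys = K.sym (K.+-identityˡ _)
Σᴷ-++ (x ∷ xs) ys = K.trans (K.+-congˡ (Σᴷ-++ xs ys)) (K.sym (K.+-assoc x _ _))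

-- The offset s and the function f are general because `applyUpTo` passes to `f ∘ suc`; the case
-- used is s = 0, f = id.
row-contents : ∀ i n f s → (∀ j → f j ≡ s ℕ.+ j) →
  fromℕ 2 * Σᴷ (map content (map (i ,_) (applyUpTo f n))) ≈
    α * (fromℕ n * fromℕ n - fromℕ n + fromℕ 2 * fromℕ s * fromℕ n) - fromℕ 2 * fromℕ i * fromℕ n
row-contents i zero f s e = solve 3 (λ a s i → con (ℤ.+ 2) :* con 0ℤ :=
  a :* (con 0ℤ :* con 0ℤ :- con 0ℤ :+ con (ℤ.+ 2) :* s :* con 0ℤ) :- con (ℤ.+ 2) :* i :* con 0ℤ)
  K.refl α (fromℕ s) (fromℕ i)
row-contents i (suc n) f s e = begin
  fromℕ 2 * (α * fromℕ (f 0) - fromℕ i + rest)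
    ≈⟨ K.*-congˡ (K.+-congʳ (K.+-congʳ (K.*-congˡ (K.reflexive (cong fromℕ (≡.trans (e 0) (ℕ.+-identityʳ s))))))) ⟩
  fromℕ 2 * (α * fromℕ s - fromℕ i + rest)
    ≈⟨ solve 4 (λ a s i r → con (ℤ.+ 2) :* (a :* s :- i :+ r) := con (ℤ.+ 2) :* (a :* s :- i) :+ con (ℤ.+ 2) :* r) K.refl
         α (fromℕ s) (fromℕ i) rest ⟩
  fromℕ 2 * (α * fromℕ s - fromℕ i) + fromℕ 2 * rest
    ≈⟨ K.+-congˡ (K.trans (row-contents i n (f ∘ suc) (suc s) (λ j → ≡.trans (e (suc j)) (ℕ.+-suc s j)))
         (K.+-congʳ (K.*-congˡ (K.+-congˡ (K.*-congʳ (K.*-congˡ (fromℕ-+ 1 s))))))) ⟩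
  fromℕ 2 * (α * fromℕ s - fromℕ i) + (α * (fromℕ n * fromℕ n - fromℕ n + fromℕ 2 * (1# + fromℕ s) * fromℕ n) - fromℕ 2 * fromℕ i * fromℕ n)
    ≈⟨ solve 4 (λ a s i n → two :* (a :* s :- i) :+ (a :* (n :* n :- n :+ two :* (one :+ s) :* n) :- two :* i :* n)
         := a :* ((one :+ n) :* (one :+ n) :- (one :+ n) :+ two :* s :* (one :+ n)) :- two :* i :* (one :+ n)) K.refl
         α (fromℕ s) (fromℕ i) (fromℕ n) ⟩
  α * ((1# + fromℕ n) * (1# + fromℕ n) - (1# + fromℕ n) + fromℕ 2 * fromℕ s * (1# + fromℕ n)) - fromℕ 2 * fromℕ i * (1# + fromℕ n)
    ≈⟨ K.+-cong (K.*-congˡ (K.+-cong (K.+-cong (K.*-cong n+1 n+1) (K.-‿cong n+1)) (K.*-congˡ n+1))) (K.-‿cong (K.*-congˡ n+1)) ⟨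
  α * (fromℕ (suc n) * fromℕ (suc n) - fromℕ (suc n) + fromℕ 2 * fromℕ s * fromℕ (suc n)) - fromℕ 2 * fromℕ i * fromℕ (suc n) ∎
  where
  open K-Reasoning
  two one : ∀ {n} → Polynomial n
  two = con (ℤ.+ 2)
  one = con 1ℤ
  rest = Σᴷ (map content (map (i ,_) (applyUpTo (f ∘ suc) n)))
  n+1 = fromℕ-+ 1 n

2C₁≈Δ₂-eigenvalue : ∀ lam → fromℕ 2 * C₁ lam ≈ Δ₂-eigenvalue (parts lam)
2C₁≈Δ₂-eigenvalue lam = K.trans (K.*-congˡ (K.reflexive (cong (Σᴷ ∘ map content) (boxes≡rows lam))))
  (K.trans (go 0 (parts lam)) (solve 2 (λ e s → e :- con (ℤ.+ 2) :* con 0ℤ :* s := e) K.refl (Δ₂-eigenvalue (parts lam)) (fromℕ (sum (parts lam)))))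
  where
  open K-Reasoning
  two : ∀ {n} → Polynomial n
  two = con (ℤ.+ 2)
  -- Numbering the rows from i lowers every content by i, hence the correction -2 i |β|.
  go : ∀ i β → fromℕ 2 * Σᴷ (map content (rows lam i β)) ≈ Δ₂-eigenvalue β - fromℕ 2 * fromℕ i * fromℕ (sum β)
  go i []      = solve 1 (λ i → two :* con 0ℤ := con 0ℤ :- two :* i :* con 0ℤ) K.refl (fromℕ i)
  go i (n ∷ β) = begin
    fromℕ 2 * Σᴷ (map content (map (i ,_) (upTo n) ++ rows lam (suc i) β))
      ≈⟨ K.*-congˡ (K.trans (K.reflexive (cong Σᴷ (List.map-++ content (map (i ,_) (upTo n)) _))) (Σᴷ-++ (map content (map (i ,_) (upTo n))) _)) ⟩
    fromℕ 2 * (Σᴷ (map content (map (i ,_) (upTo n))) + Σᴷ (map content (rows lam (suc i) β)))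
      ≈⟨ K.distribˡ (fromℕ 2) _ _ ⟩
    fromℕ 2 * Σᴷ (map content (map (i ,_) (upTo n))) + fromℕ 2 * Σᴷ (map content (rows lam (suc i) β))
      ≈⟨ K.+-cong (row-contents i n id 0 (λ _ → ≡.refl)) (K.trans (go (suc i) β) (K.+-congˡ (K.-‿cong (K.*-congʳ (K.*-congˡ (fromℕ-+ 1 i)))))) ⟩
    (α * (fromℕ n * fromℕ n - fromℕ n + fromℕ 2 * 0# * fromℕ n) - fromℕ 2 * fromℕ i * fromℕ n) + (Δ₂-eigenvalue β - fromℕ 2 * (1# + fromℕ i) * fromℕ (sum β))
      ≈⟨ solve 5 (λ a n i e s → (a :* (n :* n :- n :+ two :* con 0ℤ :* n) :- two :* i :* n) :+ (e :- two :* (con 1ℤ :+ i) :* s)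
           := (a :* (n :* n :- n) :+ e :- two :* s) :- two :* i :* (n :+ s)) K.refl
           α (fromℕ n) (fromℕ i) (Δ₂-eigenvalue β) (fromℕ (sum β)) ⟩
    Δ₂-eigenvalue (n ∷ β) - fromℕ 2 * fromℕ i * (fromℕ n + fromℕ (sum β))
      ≈⟨ K.+-congˡ (K.-‿cong (K.*-congˡ (fromℕ-+ n (sum β)))) ⟨
    Δ₂-eigenvalue (n ∷ β) - fromℕ 2 * fromℕ i * fromℕ (n ℕ.+ sum β) ∎

indicator-cases : ∀ {P : Set} {a c} (d : Dec P) → (P → a ≈ c) → (¬ P → a ≈ 0#) → a ≈ c * indicator d
indicator-cases {c = c} (yes x) e _ = K.trans (e x) (K.sym (K.*-identityʳ c))
indicator-cases {c = c} (no ¬x) _ e = K.trans (e ¬x) (K.sym (K.zeroʳ c))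

open Grouping {A = Partition} ≡.isEquivalence _≟ₚ_ public
  using () renaming (total to partitionTotal; eval-vanishes to partition-eval-vanishes)

functional-combination : ∀ {F} → Functional F → ∀ v cs → F (combination v cs) ≈ eval (F ∘ v) cs
functional-combination F′ v []               = Functional.0-homo F′
functional-combination F′ v ((c , lam) ∷ cs) = K.trans (+-homo (c ·ᴸ v lam) (combination v cs))
  (K.+-cong (K.trans (resp (·≋const c (v lam))) (c-homo c (v lam))) (functional-combination F′ v cs))
  where open Functional F′

functional-− : ∀ {F} → Functional F → ∀ f g → F (f +ᴸ -ᴸ g) ≈ F f - F g
functional-− F′ f g = K.trans (+-homo f (-ᴸ g)) (K.+-congˡ (neg-homo g))
  where open Functional F′

-- T h_λ equals d(λ) h_λ modulo the span of the h_γ with γ raised from λ, phrased without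
-- coefficients.
TriangularOnComplete : Operator → (Partition → ℚ⟨α⟩) → Set
TriangularOnComplete T d = ∀ {F} → Functional F → ∀ lam → (∀ {γ} → Raised (parts lam) γ → F (hs γ) ≈ 0#) →
  F (T (hs (parts lam))) ≈ d lam * F (hs (parts lam))

-- Triangular and symmetric operators are diagonal on Q′

module _ {P Q′ : Partition → Λ} (jack : IsMonicJack P) (dual : IsHallDualBasis P Q′) where
  open IsMonicJack jack
  open IsHallDualBasis dual
  open IsBasis isBasis

  pairing-PQ : ∀ lam mu → ⟪ P lam , Q′ mu ⟫ ≈ indicator (lam ≟ₚ mu)
  pairing-PQ lam mu = K.trans (indicator-cases (lam ≟ₚ mu)
    (λ { ≡.refl → K.trans (K.sym (Hall≈ (P lam) (Q′ lam))) (dual-one lam) })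
    (λ lam≢mu → K.trans (K.sym (Hall≈ (P lam) (Q′ mu))) (dual-off lam mu lam≢mu))) (K.*-identityˡ _)

  -- Here f = Σ ⟨P_λ , f⟩ Q′_λ. The list given by `spanning` may repeat partitions, so its terms are
  -- grouped before its coefficients are compared with the pairings.
  functional-vanishes : ∀ {F} → Functional F → ∀ f → (∀ lam → ⟪ P lam , f ⟫ * F (Q′ lam) ≈ 0#) → F f ≈ 0#
  functional-vanishes {F} F′ f z with spanning f
  ... | cs , f≈cs = K.trans (expand F′)
    (partition-eval-vanishes cs (λ e → K.reflexive (cong (F ∘ Q′) e)) (λ lam → K.trans (K.*-congʳ (K.sym (coordinate lam))) (z lam)))
    where
    expand : ∀ {G} → Functional G → G f ≈ eval (G ∘ Q′) cs
    expand G′ = K.trans (Functional.resp G′ (fromᴸ f≈cs)) (functional-combination G′ Q′ cs)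
    coordinate : ∀ lam → ⟪ P lam , f ⟫ ≈ partitionTotal lam cs
    coordinate lam = K.trans (expand (pairing-functionalʳ (P lam))) (eval-cong (pairing-PQ lam) cs)

  P-separates : ∀ {f g} → (∀ lam → ⟪ P lam , f ⟫ ≈ ⟪ P lam , g ⟫) → f ≋ g
  P-separates {f} {g} e = fromᴸ λ u → K.trans (coefficient≈total u f)
    (K.trans (x∙y⁻¹≈ε⇒x≈y _ _ (K.trans (K.sym (functional-− (wordTotal-functional u) f g))
      (functional-vanishes (wordTotal-functional u) (f +ᴸ -ᴸ g) (λ lam → K.trans (K.*-congʳ (K.trans (functional-− (pairing-functionalʳ (P lam)) f g)
        (x≈y⇒x∙y⁻¹≈ε (e lam)))) (K.zeroˡ _))))) (K.sym (coefficient≈total u g)))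
    where open import Algebra.Properties.Group K.+-group using (x∙y⁻¹≈ε⇒x≈y; x≈y⇒x∙y⁻¹≈ε)

  linear-agree : ∀ {A B} → Linear A → Linear B → (∀ lam → A (Q′ lam) ≋ B (Q′ lam)) → ∀ f → A f ≋ B f
  linear-agree {A} {B} a b e f with spanning f
  ... | cs , f≈cs = L.trans (Linear.≋-cong a (fromᴸ f≈cs)) (L.trans (go cs) (L.sym (Linear.≋-cong b (fromᴸ f≈cs))))
    where
    go : ∀ cs → A (combination Q′ cs) ≋ B (combination Q′ cs)
    go []               = L.trans (Linear.zero-homo a) (L.sym (Linear.zero-homo b))
    go ((c , lam) ∷ cs) = L.trans (Linear.+-homo a (c ·ᴸ Q′ lam) _) (L.trans
      (L.+-cong (L.trans (Linear.·-homo a c (Q′ lam)) (L.trans (·-cong K.refl (e lam)) (L.sym (Linear.·-homo b c (Q′ lam))))) (go cs))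
      (L.sym (Linear.+-homo b (c ·ᴸ Q′ lam) _)))

  norm : Partition → ℚ⟨α⟩
  norm lam = ⟪ P lam , θ (P lam) ⟫

  θP : ∀ lam → θ (P lam) ≋ const (norm lam) *ᴸ Q′ lam
  θP lam = P-separates λ mu → K.trans (diagonal mu)
    (K.sym (K.trans (Functional.c-homo (pairing-functionalʳ (P mu)) (norm lam) (Q′ lam)) (K.*-congˡ (pairing-PQ mu lam))))
    where
    diagonal : ∀ mu → ⟪ P mu , θ (P lam) ⟫ ≈ norm lam * indicator (mu ≟ₚ lam)
    diagonal mu = indicator-cases (mu ≟ₚ lam) (λ { ≡.refl → K.refl })
      (λ mu≢lam → K.trans (K.sym (⟨⟩α≈θ (P mu) (P lam))) (orthogonal mu lam mu≢lam))

  -- If the norm vanished, so would θ P_λ, hence P_λ by injectivity of θ, against ⟨P_λ , Q′_λ⟩ = 1.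
  norm≉0 : ∀ lam → ¬ norm lam ≈ 0#
  norm≉0 lam n≈0 = fromℕ-suc≉0 0 (begin
    1#                      ≈⟨ dual-one lam ⟨
    ⟨ P lam , Q′ lam ⟩Hall  ≈⟨ Hall≈ (P lam) (Q′ lam) ⟩
    ⟪ P lam , Q′ lam ⟫      ≈⟨ Functional.resp (pairing-functionalˡ (Q′ lam)) P≋0 ⟩
    0#                      ∎)
    where
    open K-Reasoning
    P≋0 : P lam ≋ 0ᴸ
    P≋0 = θ-injective (L.trans (θP lam) (L.trans (L.*-congʳ (L.trans (const-cong n≈0) const-0)) (L.zeroˡ (Q′ lam))))

  module _ {T : Operator} (T-linear : Linear T) (T-symmetric : θ-Symmetric T)
           {d : Partition → ℚ⟨α⟩} (T-triangular : TriangularOnComplete T d) where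

    private
      entry : Partition → Partition → ℚ⟨α⟩
      entry mu lam = ⟪ P mu , T (Q′ lam) ⟫

      entry-functional : ∀ mu → Functional (λ f → ⟪ P mu , T f ⟫)
      entry-functional mu = functional-∘ (pairing-functionalʳ (P mu)) T-linear

      -- Q′_λ is replaced by h_λ. Their difference involves only Q′_ν with ν strictly above λ; such
      -- ν have smaller defect, and induction gives entry 0 for them since ν is not below μ. On h_λ
      -- triangularity applies: a raised γ yields a partition strictly above λ, hence not below μ,
      -- so P_μ is orthogonal to h_γ.
      triangular-entry : ∀ lam → Acc _<_ (defect lam) → ∀ mu → (∀ nu → lam ⊴ nu → lam ≢ nu → ¬ nu ⊴ mu) →
        entry mu lam ≈ d lam * mCoefficient lam (P mu)
      triangular-entry lam (acc rec) mu above = begin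
        entry mu lam                           ≈⟨ x∙y⁻¹≈ε⇒x≈y _ _ (K.trans (K.sym (functional-− (entry-functional mu) hλ (Q′ lam))) (functional-vanishes (entry-functional mu) (hλ +ᴸ -ᴸ Q′ lam) term)) ⟨
        ⟪ P mu , T hλ ⟫                        ≈⟨ T-triangular (pairing-functionalʳ (P mu)) lam raised ⟩
        d lam * ⟪ P mu , hλ ⟫                  ≈⟨ K.*-congˡ (mCoefficient≈ lam (P mu)) ⟨
        d lam * mCoefficient lam (P mu)        ∎
        where
        open K-Reasoning
        open import Algebra.Properties.Group K.+-group using (x∙y⁻¹≈ε⇒x≈y)
        hλ = hs (parts lam)
        raised : ∀ {γ} → Raised (parts lam) γ → ⟪ P mu , hs γ ⟫ ≈ 0#
        raised {γ} r = begin
          ⟪ P mu , hs γ ⟫                               ≈⟨ Functional.resp (pairing-functionalʳ (P mu)) (hs-fromComposition γ) ⟨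
          ⟪ P mu , hs (parts (fromComposition γ)) ⟫     ≈⟨ mCoefficient≈ (fromComposition γ) (P mu) ⟨
          mCoefficient (fromComposition γ) (P mu)       ≈⟨ triangular mu (fromComposition γ) (above (fromComposition γ) (raised-⊴ {lam} r) (raised-≢ r)) ⟩
          0#                                            ∎
        higher : ∀ nu → lam ⊴ nu → lam ≢ nu → entry mu nu ≈ 0#
        higher nu l≤n l≢n = K.trans
          (triangular-entry nu (rec (defect-< l≤n l≢n)) mu (λ nu′ n≤n′ _ n′≤mu → above nu l≤n l≢n (⊴-trans {nu} {nu′} {mu} n≤n′ n′≤mu)))
          (K.trans (K.*-congˡ (triangular mu nu (above nu l≤n l≢n))) (K.zeroʳ (d nu)))
        component : ∀ nu → ⟪ P nu , hλ +ᴸ -ᴸ Q′ lam ⟫ ≈ mCoefficient lam (P nu) - indicator (nu ≟ₚ lam)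
        component nu = K.trans (functional-− (pairing-functionalʳ (P nu)) hλ (Q′ lam))
          (K.+-cong (K.sym (mCoefficient≈ lam (P nu))) (K.-‿cong (pairing-PQ nu lam)))
        term : ∀ nu → ⟪ P nu , hλ +ᴸ -ᴸ Q′ lam ⟫ * entry mu nu ≈ 0#
        term nu with nu ≟ₚ lam
        ... | yes ≡.refl = K.trans (K.*-congʳ (K.trans (component lam) (K.trans
          (K.+-cong (monic lam) (K.-‿cong (K.sym (indicator-yes (lam ≟ₚ lam) ≡.refl)))) (K.-‿inverseʳ 1#)))) (K.zeroˡ _)
        -- If λ ⊴ ν the entry is zero, and otherwise the coefficient of m_λ in P_ν is. Either way
        -- the product vanishes, and stability of this equation avoids deciding which case holds.
        ... | no nu≢lam = decidable-stable (_ ≈0?) λ t≉0 →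
          t≉0 (K.trans (K.*-congʳ (K.trans (component nu) (K.trans
            (K.+-cong (triangular nu lam λ l≤n → t≉0 (K.trans (K.*-congˡ (higher nu l≤n (nu≢lam ∘ ≡.sym))) (K.zeroʳ _)))
                      (K.-‿cong (K.sym (indicator-no (nu ≟ₚ lam) nu≢lam)))) (K.-‿inverseʳ 0#)))) (K.zeroˡ _))

      entry-⋬ : ∀ lam mu → ¬ lam ⊴ mu → entry mu lam ≈ 0#
      entry-⋬ lam mu ¬l = K.trans
        (triangular-entry lam (<-wellFounded _) mu (λ nu l≤n _ n≤m → ¬l (⊴-trans {lam} {nu} {mu} l≤n n≤m)))
        (K.trans (K.*-congˡ (triangular mu lam ¬l)) (K.zeroʳ (d lam)))

      entry-diagonal : ∀ lam → entry lam lam ≈ d lam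
      entry-diagonal lam = K.trans
        (triangular-entry lam (<-wellFounded _) lam (λ nu l≤n l≢n n≤l → l≢n (⊴-antisym l≤n n≤l)))
        (K.trans (K.*-congˡ (monic lam)) (K.*-identityʳ (d lam)))

      entry-θ : ∀ mu lam → ⟪ P mu , T (θ (P lam)) ⟫ ≈ norm lam * entry mu lam
      entry-θ mu lam = K.trans (Functional.resp (entry-functional mu) (θP lam)) (Functional.c-homo (entry-functional mu) (norm lam) (Q′ lam))

      entry-symmetric : ∀ mu lam → norm lam * entry mu lam ≈ norm mu * entry lam mu
      entry-symmetric mu lam = begin
        norm lam * entry mu lam      ≈⟨ entry-θ mu lam ⟨
        ⟪ P mu , T (θ (P lam)) ⟫     ≈⟨ T-symmetric (P mu) (P lam) ⟩
        ⟪ T (θ (P mu)) , P lam ⟫     ≈⟨ pairing-sym (T (θ (P mu))) (P lam) ⟩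
        ⟪ P lam , T (θ (P mu)) ⟫     ≈⟨ entry-θ lam mu ⟩
        norm mu * entry lam mu       ∎
        where open K-Reasoning

      -- If λ ⊴ μ and μ ≠ λ, then μ is not below λ and the transposed entry vanishes. Symmetry
      -- carries this over, the norms being nonzero.
      entry-off : ∀ mu lam → mu ≢ lam → entry mu lam ≈ 0#
      entry-off mu lam mu≢lam = decidable-stable (_ ≈0?) λ e≉0 → e≉0 (entry-⋬ lam mu λ l≤m →
        e≉0 (*-cancelˡ (norm lam) (norm≉0 lam) (K.trans (entry-symmetric mu lam)
          (K.trans (K.*-congˡ (entry-⋬ mu lam λ m≤l → mu≢lam (⊴-antisym m≤l l≤m))) (K.trans (K.zeroʳ _) (K.sym (K.zeroʳ _)))))))

    eigenvectors : ∀ lam → T (Q′ lam) ≋ const (d lam) *ᴸ Q′ lam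
    eigenvectors lam = P-separates λ mu → K.trans (diagonal mu)
      (K.sym (K.trans (Functional.c-homo (pairing-functionalʳ (P mu)) (d lam) (Q′ lam)) (K.*-congˡ (pairing-PQ mu lam))))
      where
      diagonal : ∀ mu → entry mu lam ≈ d lam * indicator (mu ≟ₚ lam)
      diagonal mu = indicator-cases (mu ≟ₚ lam) (λ { ≡.refl → entry-diagonal mu }) (entry-off mu lam)

  E-eigenvectors : ∀ lam → E (Q′ lam) ≋ κ ∣ lam ∣ *ᴸ Q′ lam
  E-eigenvectors = eigenvectors E-linear E-symmetric {d = fromℕ ∘ ∣_∣} (λ F′ lam _ →
    K.trans (Functional.resp F′ (E-hs (parts lam))) (Functional.c-homo F′ (fromℕ ∣ lam ∣) (hs (parts lam))))

  Δ₂-eigenvectors : ∀ lam → Δ₂ (Q′ lam) ≋ const (fromℕ 2 * C₁ lam) *ᴸ Q′ lam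
  Δ₂-eigenvectors = eigenvectors Δ₂-linear Δ₂-symmetric {d = λ lam → fromℕ 2 * C₁ lam} (λ F′ lam z →
    K.trans (functional-Δ₂ F′ (parts lam) z) (K.*-congʳ (K.sym (2C₁≈Δ₂-eigenvalue lam))))

-- The generating series ψ(z)

record Expansion (F : Series) (a₀ a₁ a₂ a₃ a₄ : ℚ⟨α⟩) : Set where
  constructor expansion
  field
    at₀ : F 0 ≈ a₀
    at₁ : F 1 ≈ a₁
    at₂ : F 2 ≈ a₂
    at₃ : F 3 ≈ a₃
    at₄ : F 4 ≈ a₄

-- The trailing zeros reproduce the shape of `Σᴷ`, so that the proof is congruence alone and
-- simplification is left to the solver.
⊛-expansion : ∀ {F G a₀ a₁ a₂ a₃ a₄ b₀ b₁ b₂ b₃ b₄} → Expansion F a₀ a₁ a₂ a₃ a₄ → Expansion G b₀ b₁ b₂ b₃ b₄ →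
  Expansion (F ⊛ G)
    (a₀ * b₀ + 0#)
    (a₀ * b₁ + (a₁ * b₀ + 0#))
    (a₀ * b₂ + (a₁ * b₁ + (a₂ * b₀ + 0#)))
    (a₀ * b₃ + (a₁ * b₂ + (a₂ * b₁ + (a₃ * b₀ + 0#))))
    (a₀ * b₄ + (a₁ * b₃ + (a₂ * b₂ + (a₃ * b₁ + (a₄ * b₀ + 0#)))))
⊛-expansion (expansion a₀ a₁ a₂ a₃ a₄) (expansion b₀ b₁ b₂ b₃ b₄) = expansion
  (a₀ ∙ b₀ ⊹ K.refl)
  (a₀ ∙ b₁ ⊹ (a₁ ∙ b₀ ⊹ K.refl))
  (a₀ ∙ b₂ ⊹ (a₁ ∙ b₁ ⊹ (a₂ ∙ b₀ ⊹ K.refl)))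
  (a₀ ∙ b₃ ⊹ (a₁ ∙ b₂ ⊹ (a₂ ∙ b₁ ⊹ (a₃ ∙ b₀ ⊹ K.refl))))
  (a₀ ∙ b₄ ⊹ (a₁ ∙ b₃ ⊹ (a₂ ∙ b₂ ⊹ (a₃ ∙ b₁ ⊹ (a₄ ∙ b₀ ⊹ K.refl)))))
  where
  infix 7 _∙_
  infix 6 _⊹_
  _∙_ = *-cong
  _⊹_ = +-cong

≈-expansion : ∀ {F a₀ a₁ a₂ a₃ a₄ b₀ b₁ b₂ b₃ b₄} → Expansion F a₀ a₁ a₂ a₃ a₄ →
  a₀ ≈ b₀ → a₁ ≈ b₁ → a₂ ≈ b₂ → a₃ ≈ b₃ → a₄ ≈ b₄ → Expansion F b₀ b₁ b₂ b₃ b₄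
≈-expansion (expansion a₀ a₁ a₂ a₃ a₄) e₀ e₁ e₂ e₃ e₄ =
  expansion (K.trans a₀ e₀) (K.trans a₁ e₁) (K.trans a₂ e₂) (K.trans a₃ e₃) (K.trans a₄ e₄)

module _ where
  private
    two six : ∀ {n} → Polynomial n
    two = con (ℤ.+ 2)
    six = con (ℤ.+ 6)

  -- (z + h - c)/(z - h - c) = 1 + 2h/(z - (h + c)), expanded as a geometric series.
  factor-expansion : ∀ h c → Expansion [z+ h - c ]/[z- h + c ]
    1# (fromℕ 2 * h) (fromℕ 2 * h * (h + c)) (fromℕ 2 * h * ((h + c) * (h + c))) (fromℕ 2 * h * ((h + c) * (h + c) * (h + c)))
  factor-expansion h c = ≈-expansion
    (⊛-expansion (expansion K.refl K.refl K.refl K.refl K.refl) (expansion K.refl K.refl K.refl K.refl K.refl))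
    (solve 0 (con 1ℤ :* con 1ℤ :+ con 0ℤ := con 1ℤ) K.refl)
    (solve 2 (λ h c → con 1ℤ :* ((h :+ c) :* con 1ℤ) :+ ((h :- c) :* con 1ℤ :+ con 0ℤ) := two :* h) K.refl h c)
    (solve 2 (λ h c → let b = h :+ c in
      con 1ℤ :* (b :* (b :* con 1ℤ)) :+ ((h :- c) :* (b :* con 1ℤ) :+ (con 0ℤ :* con 1ℤ :+ con 0ℤ)) := two :* h :* b) K.refl h c)
    (solve 2 (λ h c → let b = h :+ c in
      con 1ℤ :* (b :* (b :* (b :* con 1ℤ))) :+ ((h :- c) :* (b :* (b :* con 1ℤ)) :+ (con 0ℤ :* (b :* con 1ℤ) :+ (con 0ℤ :* con 1ℤ :+ con 0ℤ)))
      := two :* h :* (b :* b)) K.refl h c)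
    (solve 2 (λ h c → let b = h :+ c in
      con 1ℤ :* (b :* (b :* (b :* (b :* con 1ℤ)))) :+ ((h :- c) :* (b :* (b :* (b :* con 1ℤ))) :+
        (con 0ℤ :* (b :* (b :* con 1ℤ)) :+ (con 0ℤ :* (b :* con 1ℤ) :+ (con 0ℤ :* con 1ℤ :+ con 0ℤ))))
      := two :* h :* (b :* b :* b)) K.refl h c)

  private
    -- fᵢ, mᵢ, kᵢ: the coefficients of a factor, of a product of two series,
    -- and of the product of the factors for h₁ = a and h₂ = −1.
    f₁ f₂ f₃ f₄ : ∀ {n} → Polynomial n → Polynomial n → Polynomial n
    f₁ h c = two :* h
    f₂ h c = two :* h :* (h :+ c)
    f₃ h c = two :* h :* ((h :+ c) :* (h :+ c))
    f₄ h c = two :* h :* ((h :+ c) :* (h :+ c) :* (h :+ c))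

    m₀ : ∀ {n} → (a₀ b₀ : Polynomial n) → Polynomial n
    m₀ a₀ b₀ = a₀ :* b₀ :+ con 0ℤ
    m₁ : ∀ {n} → (a₀ a₁ b₀ b₁ : Polynomial n) → Polynomial n
    m₁ a₀ a₁ b₀ b₁ = a₀ :* b₁ :+ (a₁ :* b₀ :+ con 0ℤ)
    m₂ : ∀ {n} → (a₀ a₁ a₂ b₀ b₁ b₂ : Polynomial n) → Polynomial n
    m₂ a₀ a₁ a₂ b₀ b₁ b₂ = a₀ :* b₂ :+ (a₁ :* b₁ :+ (a₂ :* b₀ :+ con 0ℤ))
    m₃ : ∀ {n} → (a₀ a₁ a₂ a₃ b₀ b₁ b₂ b₃ : Polynomial n) → Polynomial n
    m₃ a₀ a₁ a₂ a₃ b₀ b₁ b₂ b₃ = a₀ :* b₃ :+ (a₁ :* b₂ :+ (a₂ :* b₁ :+ (a₃ :* b₀ :+ con 0ℤ)))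
    m₄ : ∀ {n} → (a₀ a₁ a₂ a₃ a₄ b₀ b₁ b₂ b₃ b₄ : Polynomial n) → Polynomial n
    m₄ a₀ a₁ a₂ a₃ a₄ b₀ b₁ b₂ b₃ b₄ = a₀ :* b₄ :+ (a₁ :* b₃ :+ (a₂ :* b₂ :+ (a₃ :* b₁ :+ (a₄ :* b₀ :+ con 0ℤ))))

    one : ∀ {n} → Polynomial n
    one = con 1ℤ

    σ : ∀ {n} → Polynomial n → Polynomial n
    σ a = a :* (:- one) :* (one :- a)

    k₀ : ∀ {n} → Polynomial n
    k₀ = m₀ one one
    k₁ k₂ k₃ k₄ : ∀ {n} → Polynomial n → Polynomial n → Polynomial n
    k₁ a c = m₁ one (f₁ a c) one (f₁ (:- one) c)
    k₂ a c = m₂ one (f₁ a c) (f₂ a c) one (f₁ (:- one) c) (f₂ (:- one) c)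
    k₃ a c = m₃ one (f₁ a c) (f₂ a c) (f₃ a c) one (f₁ (:- one) c) (f₂ (:- one) c) (f₃ (:- one) c)
    k₄ a c = m₄ one (f₁ a c) (f₂ a c) (f₃ a c) (f₄ a c) one (f₁ (:- one) c) (f₂ (:- one) c) (f₃ (:- one) c) (f₄ (:- one) c)

  -- As h₁ + h₂ + h₃ = 0, φ(z) = 1 + 2σ₃/(z³ + σ₂ z - σ₃), which is 1 + 2σ₃ z⁻³ with no z⁻⁴ term.
  -- Replacing z by z - c multiplies z⁻³ by 1 + 3c/z + ⋯, hence 6σ₃c.
  φ-expansion : ∀ c → Expansion (φ-shifted c) 1# 0# 0# (fromℕ 2 * σ₃) (fromℕ 6 * σ₃ * c)
  φ-expansion c = ≈-expansion
    (⊛-expansion (⊛-expansion (factor-expansion h₁ c) (factor-expansion h₂ c)) (factor-expansion h₃ c))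
    (solve 0 (m₀ k₀ one := one) K.refl)
    (solve 2 (λ a c → let t = one :- a in m₁ k₀ (k₁ a c) one (f₁ t c) := con 0ℤ) K.refl α c)
    (solve 2 (λ a c → let t = one :- a in m₂ k₀ (k₁ a c) (k₂ a c) one (f₁ t c) (f₂ t c) := con 0ℤ) K.refl α c)
    (solve 2 (λ a c → let t = one :- a in m₃ k₀ (k₁ a c) (k₂ a c) (k₃ a c) one (f₁ t c) (f₂ t c) (f₃ t c) := two :* σ a) K.refl α c)
    (solve 2 (λ a c → let t = one :- a in m₄ k₀ (k₁ a c) (k₂ a c) (k₃ a c) (k₄ a c) one (f₁ t c) (f₂ t c) (f₃ t c) (f₄ t c) := six :* σ a :* c) K.refl α c)

  -- The factors have no z⁻¹ and z⁻² terms, so up to z⁻⁴ their coefficients add over the boxes.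
  product-expansion : ∀ bs → Expansion (foldr _⊛_ 1ˢ (map (φ-shifted ∘ content) bs))
    1# 0# 0# (fromℕ 2 * σ₃ * fromℕ (length bs)) (fromℕ 6 * σ₃ * Σᴷ (map content bs))
  product-expansion [] = expansion K.refl K.refl K.refl
    (solve 1 (λ s → con 0ℤ := two :* s :* con 0ℤ) K.refl σ₃) (solve 1 (λ s → con 0ℤ := six :* s :* con 0ℤ) K.refl σ₃)
  product-expansion (b ∷ bs) = ≈-expansion (⊛-expansion (φ-expansion (content b)) (product-expansion bs))
    (solve 0 (m₀ one one := one) K.refl)
    (solve 0 (m₁ one (con 0ℤ) one (con 0ℤ) := con 0ℤ) K.refl)
    (solve 0 (m₂ one (con 0ℤ) (con 0ℤ) one (con 0ℤ) (con 0ℤ) := con 0ℤ) K.refl)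
    (K.trans (solve 2 (λ s n → m₃ one (con 0ℤ) (con 0ℤ) (two :* s) one (con 0ℤ) (con 0ℤ) (two :* s :* n) := two :* s :* (one :+ n)) K.refl σ₃ (fromℕ (length bs)))
             (K.*-congˡ (K.sym (fromℕ-+ 1 (length bs)))))
    (solve 4 (λ s n c t → m₄ one (con 0ℤ) (con 0ℤ) (two :* s) (six :* s :* c) one (con 0ℤ) (con 0ℤ) (two :* s :* n) (six :* s :* t) := six :* s :* (c :+ t)) K.refl
      σ₃ (fromℕ (length bs)) (content b) (Σᴷ (map content bs)))

  -- The factor σ₃ is displayed because ψ(z) contains σ₃ψ_r. The extra term at z⁻⁴ is the σ₃ψ₀/z of
  -- the prefactor times the z⁻³ term of the product.
  ψ-eigenvalue-expansion : ∀ lam → Expansion (ψ-eigenvalue lam)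
    1# (σ₃ * vacuumCharge) (σ₃ * 0#) (σ₃ * (fromℕ 2 * fromℕ ∣ lam ∣))
    (σ₃ * (fromℕ 6 * C₁ lam + fromℕ 2 * (σ₃ * vacuumCharge) * fromℕ ∣ lam ∣))
  ψ-eigenvalue-expansion lam = ≈-expansion
    (⊛-expansion (expansion K.refl K.refl K.refl K.refl K.refl) (product-expansion (boxes lam)))
    (solve 0 (m₀ one one := one) K.refl)
    (solve 1 (λ q → m₁ one q one (con 0ℤ) := q) K.refl q)
    (solve 2 (λ q s → m₂ one q (con 0ℤ) one (con 0ℤ) (con 0ℤ) := s :* con 0ℤ) K.refl q σ₃)
    (K.trans (solve 3 (λ q s n → m₃ one q (con 0ℤ) (con 0ℤ) one (con 0ℤ) (con 0ℤ) (two :* s :* n) := s :* (two :* n)) K.refl q σ₃ (fromℕ (length (boxes lam))))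
             (K.*-congˡ (K.*-congˡ size)))
    (K.trans (solve 4 (λ q s n t → m₄ one q (con 0ℤ) (con 0ℤ) (con 0ℤ) one (con 0ℤ) (con 0ℤ) (two :* s :* n) (six :* s :* t) := s :* (six :* t :+ two :* q :* n)) K.refl
                q σ₃ (fromℕ (length (boxes lam))) (C₁ lam))
             (K.*-congˡ (K.+-congˡ (K.*-congˡ size))))
    where
    q = σ₃ * vacuumCharge
    size = K.reflexive (cong fromℕ (length-boxes lam))

1-α≉0 : ¬ 1# - α ≈ 0#
1-α≉0 e with num-zero {polynomial (1ℤ ∷ -1ℤ ∷ [])} (K.trans 1-α e)
  where
  opaque
    unfolding _+_
    1-α : polynomial (1ℤ ∷ -1ℤ ∷ []) ≈ 1# - α
    1-α = cross-multiplied (≡.refl ∷ ≡.refl ∷ [])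
... | () ∷ _

σ₃≉0 : ¬ σ₃ ≈ 0#
σ₃≉0 = *≉0 (*≉0 α≉0 -1≉0) 1-α≉0
  where
  -1≉0 : ¬ - 1# ≈ 0#
  -1≉0 e = fromℕ-suc≉0 0 (K.trans (solve 1 (λ x → x := :- (:- x)) K.refl 1#) (K.trans (K.-‿cong e) (solve 0 (:- con 0ℤ := con 0ℤ) K.refl)))

vacuumCharge≈α⁻¹ : vacuumCharge ≈ α⁻¹
vacuumCharge≈α⁻¹ = negated-inverse _
  where
  -- Quantified over the proof that the denominator is nonzero, since the one inside `vacuumCharge`
  -- is private.
  negated-inverse : ∀ nonzero → - inverse (α * - 1#) nonzero ≈ α⁻¹
  negated-inverse nonzero = *-cancelˡ α α≉0 (K.trans
    (solve 2 (λ a y → a :* (:- y) := y :* (a :* (:- con 1ℤ))) K.refl α y)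
    (K.trans (inverse-*ˡ (α * - 1#) nonzero) (K.sym (K.trans (K.*-comm α α⁻¹) α⁻¹-*ˡ))))
    where y = inverse (α * - 1#) nonzero

σ₃α⁻¹ : σ₃ * α⁻¹ ≈ α - 1#
σ₃α⁻¹ = K.trans (solve 2 (λ a b → a :* (:- con 1ℤ) :* (con 1ℤ :- a) :* b := (b :* a) :* (a :- con 1ℤ)) K.refl α α⁻¹)
  (K.trans (K.*-congʳ α⁻¹-*ˡ) (K.*-identityˡ _))

-- Commutators with p₁ and D₁

·-cancel : ∀ {c f g} → ¬ c ≈ 0# → c ·ᴸ f ≋ c ·ᴸ g → f ≋ g
·-cancel {c} {f} {g} c≉0 e = fromᴸ λ u → K.trans (coefficient≈total u f)
  (K.trans (*-cancelˡ c c≉0 (K.trans (K.sym (eval-scale _ c f)) (K.trans (≋⇒eval e (indicator-invariant u)) (eval-scale _ c g))))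
           (K.sym (coefficient≈total u g)))

raising lowering : Operator
raising  = ∑ λ j → p (suc j) ∘ D j
lowering = ∑ λ j → p j ∘ D (suc j)

raising-locallyFinite : LocallyFinite (λ j → p (suc j) ∘ D j)
raising-locallyFinite = ∘D-locallyFinite (p ∘ suc) (p-linear ∘ suc)

lowering-locallyFinite : LocallyFinite (λ j → p j ∘ D (suc j))
lowering-locallyFinite = record
  { linear = λ k → ∘-linear (p-linear k) (D-linear (suc k))
  ; finite = λ k u d<k → Linear.vanishes (p-linear k) (D-vanishes (suc k) u (ℕ.m≤n⇒m≤1+n d<k))
  }

raising≋ : ∀ f {N} → bound f ≤ N → raising f ≋ sumᴸ N (λ j → P (suc (suc j)) *ᴸ D (suc j) f)
raising≋ f {N} b≤N = L.trans (∑-truncate raising-locallyFinite f b≤N) (sumᴸ-cong N (λ j → p≋* (suc (suc j)) (D (suc j) f)))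

lowering≋ : ∀ f {N} → bound f ≤ N → lowering f ≋ sumᴸ N (λ j → P (suc j) *ᴸ D (suc (suc j)) f)
lowering≋ f {N} b≤N = L.trans (∑-truncate lowering-locallyFinite f b≤N) (sumᴸ-cong N (λ j → p≋* (suc j) (D (suc (suc j)) f)))

h1≋P1 : h 1 ≋ P 1
h1≋P1 = L.trans (·-cong {d = 1#} (K.trans (K.sym (K.*-identityʳ (1/suc 0))) (1/suc-* 0)) (L.trans (L.+-identityʳ _) (L.*-identityʳ (P 1)))) (1· (P 1))

Γ-h1 : ∀ {N} → 1 ≤ N → ∀ f → Γ N (h 1) f ≋ sumᴸ N (λ j → P (suc (suc j)) *ᴸ D (suc j) f)
Γ-h1 {N} 1≤N f = begin
  Γ N (h 1) f
    ≈⟨ sumᴸ-extend 1≤N rows₁ (λ { (suc i) _ → L.trans (sumᴸ-cong N (λ j →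
         L.trans (L.*-congʳ (L.trans (L.*-congˡ (D-h (suc i) 1)) (L.zeroʳ (P (suc (suc i) ℕ.+ suc j))))) (L.zeroˡ (D (suc j) f)))) (sumᴸ-0 N) }) ⟩
  rows₁ 0 +ᴸ 0ᴸ
    ≈⟨ L.+-identityʳ (rows₁ 0) ⟩
  rows₁ 0
    ≈⟨ sumᴸ-cong N (λ j → L.*-congʳ (L.trans (L.*-congˡ (D-h 0 1)) (L.*-identityʳ (P (suc (suc j)))))) ⟩
  sumᴸ N (λ j → P (suc (suc j)) *ᴸ D (suc j) f) ∎
  where
  open L-Reasoning
  rows₁ : ℕ → Λ
  rows₁ i = sumᴸ N (λ j → P (suc i ℕ.+ suc j) *ᴸ D (suc i) (h 1) *ᴸ D (suc j) f)

-- As p₁ = h₁, the product rule applies: Δ₂ p₁ = 0 because its eigenvalue α · 1 · 0 vanishes, and Γ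
-- (p₁ , -) reduces to its row i = 1, which is `raising`. The successor in the level ensures 1 ≤ N.
Δ₂-P1 : ∀ f → Δ₂ (P 1 *ᴸ f) ≋ P 1 *ᴸ Δ₂ f +ᴸ κ 2 *ᴸ raising f
Δ₂-P1 f = go (suc (bound (h 1 *ᴸ f) ℕ.+ bound f)) (s≤s z≤n)
  (ℕ.m≤n⇒m≤1+n (ℕ.m≤m+n (bound (h 1 *ᴸ f)) (bound f))) (ℕ.m≤n⇒m≤1+n (ℕ.m≤n+m (bound f) (bound (h 1 *ᴸ f))))
  where
  open L-Reasoning
  go : ∀ N → 1 ≤ N → bound (h 1 *ᴸ f) ≤ N → bound f ≤ N → Δ₂ (P 1 *ᴸ f) ≋ P 1 *ᴸ Δ₂ f +ᴸ κ 2 *ᴸ raising f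
  go N 1≤N hf≤N f≤N = begin
    Δ₂ (P 1 *ᴸ f)                                     ≈⟨ Linear.≋-cong Δ₂-linear (L.*-congʳ (L.sym h1≋P1)) ⟩
    Δ₂ (h 1 *ᴸ f)                                     ≈⟨ Δ₂≋Δₙ (h 1 *ᴸ f) hf≤N ⟩
    Δₙ N (h 1 *ᴸ f)                                   ≈⟨ Δₙ-* N (h 1) f ⟩
    Δₙ N (h 1) *ᴸ f +ᴸ h 1 *ᴸ Δₙ N f +ᴸ κ 2 *ᴸ Γ N (h 1) f
      ≈⟨ L.+-cong (L.+-cong (L.trans (L.*-congʳ (Δₙ-h 1≤N))
                     (solveᴸ 3 (λ a x f → a :*ᴸ (conᴸ 1ℤ :*ᴸ conᴸ 1ℤ :-ᴸ conᴸ 1ℤ) :*ᴸ x :*ᴸ f :=ᴸ conᴸ 0ℤ) L.refl (const α) (h 1) f))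
                     (L.*-cong h1≋P1 (L.sym (Δ₂≋Δₙ f f≤N))))
           (L.*-congˡ {κ 2} (L.trans (Γ-h1 1≤N f) (L.sym (raising≋ f f≤N)))) ⟩
    κ 0 +ᴸ P 1 *ᴸ Δ₂ f +ᴸ κ 2 *ᴸ raising f            ≈⟨ L.+-congʳ {κ 2 *ᴸ raising f} (L.trans (L.+-congʳ {P 1 *ᴸ Δ₂ f} const-0) (L.+-identityˡ (P 1 *ᴸ Δ₂ f))) ⟩
    P 1 *ᴸ Δ₂ f +ᴸ κ 2 *ᴸ raising f                   ∎

E-P1 : ∀ f → E (P 1 *ᴸ f) ≋ P 1 *ᴸ E f +ᴸ P 1 *ᴸ f
E-P1 f = go (suc (bound (h 1 *ᴸ f) ℕ.+ bound f)) (s≤s z≤n)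
  (ℕ.m≤n⇒m≤1+n (ℕ.m≤m+n (bound (h 1 *ᴸ f)) (bound f))) (ℕ.m≤n⇒m≤1+n (ℕ.m≤n+m (bound f) (bound (h 1 *ᴸ f))))
  where
  open L-Reasoning
  go : ∀ N → 1 ≤ N → bound (h 1 *ᴸ f) ≤ N → bound f ≤ N → E (P 1 *ᴸ f) ≋ P 1 *ᴸ E f +ᴸ P 1 *ᴸ f
  go N 1≤N hf≤N f≤N = begin
    E (P 1 *ᴸ f)                            ≈⟨ Linear.≋-cong E-linear (L.*-congʳ (L.sym h1≋P1)) ⟩
    E (h 1 *ᴸ f)                            ≈⟨ E≋Eₙ (h 1 *ᴸ f) hf≤N ⟩
    Eₙ N (h 1 *ᴸ f)                         ≈⟨ Eₙ-derivation N (h 1) f ⟩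
    Eₙ N (h 1) *ᴸ f +ᴸ h 1 *ᴸ Eₙ N f        ≈⟨ L.+-cong (L.*-congʳ (L.trans (Eₙ-h 1≤N) (L.trans (L.*-identityˡ (h 1)) h1≋P1)))
                                                 (L.*-cong h1≋P1 (L.sym (E≋Eₙ f f≤N))) ⟩
    P 1 *ᴸ f +ᴸ P 1 *ᴸ E f                  ≈⟨ L.+-comm (P 1 *ᴸ f) (P 1 *ᴸ E f) ⟩
    P 1 *ᴸ E f +ᴸ P 1 *ᴸ f                  ∎

D₁-P*-other : ∀ i x → D 1 (P (suc (suc i)) *ᴸ x) ≋ P (suc (suc i)) *ᴸ D 1 x
D₁-P*-other i x = L.trans (D-* 1 (P (suc (suc i))) x)
  (L.trans (L.+-congʳ (L.trans (L.*-congʳ (D-P-≢ {1} {suc (suc i)} λ ())) (L.zeroˡ x))) (L.+-identityˡ _))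

D₁-P*-1 : ∀ x → D 1 (P 1 *ᴸ x) ≋ x +ᴸ P 1 *ᴸ D 1 x
D₁-P*-1 x = L.trans (D-* 1 (P 1) x) (L.+-congʳ (L.trans (L.*-congʳ (D-P-≡ 1)) (L.*-identityˡ x)))

D₁-ΣP : ∀ {N} → 1 ≤ N → ∀ (F : ℕ → Λ) →
  D 1 (sumᴸ N (λ i → P (suc i) *ᴸ F i)) ≋ F 0 +ᴸ sumᴸ N (λ i → P (suc i) *ᴸ D 1 (F i))
D₁-ΣP {suc N} _ F = begin
  D 1 (P 1 *ᴸ F 0 +ᴸ rest)
    ≈⟨ Linear.+-homo (D-linear 1) (P 1 *ᴸ F 0) rest ⟩
  D 1 (P 1 *ᴸ F 0) +ᴸ D 1 rest
    ≈⟨ L.+-cong (D₁-P*-1 (F 0)) (L.trans (linear-sumᴸ (D-linear 1) N (λ i → P (suc (suc i)) *ᴸ F (suc i))) (sumᴸ-cong N (λ i → D₁-P*-other i (F (suc i))))) ⟩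
  (F 0 +ᴸ P 1 *ᴸ D 1 (F 0)) +ᴸ rest′
    ≈⟨ L.+-assoc (F 0) (P 1 *ᴸ D 1 (F 0)) rest′ ⟩
  F 0 +ᴸ (P 1 *ᴸ D 1 (F 0) +ᴸ rest′) ∎
  where
  open L-Reasoning
  rest rest′ : Λ
  rest = sumᴸ N (λ i → P (suc (suc i)) *ᴸ F (suc i))
  rest′ = sumᴸ N (λ i → P (suc (suc i)) *ᴸ D 1 (F (suc i)))

D₁-Eₙ : ∀ {N} → 1 ≤ N → ∀ f → D 1 (Eₙ N f) ≋ D 1 f +ᴸ Eₙ N (D 1 f)
D₁-Eₙ {N} 1≤N f = L.trans (D₁-ΣP 1≤N (λ i → D (suc i) f))
  (L.+-congˡ {D 1 f} (sumᴸ-cong N (λ i → L.*-congˡ (D-comm 1 (suc i) f))))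

-- D₁ hits p_i p_j at i = 1 or at j = 1, and each case gives Σ p_j D_{j+1}.
D₁-R : ∀ {N} → 1 ≤ N → ∀ f → D 1 (R N f) ≋ R N (D 1 f) +ᴸ κ 2 *ᴸ sumᴸ N (λ j → P (suc j) *ᴸ D (suc (suc j)) f)
D₁-R {N} 1≤N f = begin
  D 1 (R N f)
    ≈⟨ Linear.≋-cong (D-linear 1) (sumᴸ-cong N (λ i → pull i (λ j → D (suc i ℕ.+ suc j) f))) ⟩
  D 1 (sumᴸ N (λ i → P (suc i) *ᴸ inner-sum i))
    ≈⟨ D₁-ΣP 1≤N inner-sum ⟩
  s +ᴸ sumᴸ N (λ i → P (suc i) *ᴸ D 1 (inner-sum i))
    ≈⟨ L.+-congˡ {s} (sumᴸ-cong N (λ i → L.trans (L.*-congˡ (D₁-ΣP 1≤N (λ j → D (suc i ℕ.+ suc j) f)))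
         (L.distribˡ (P (suc i)) (D (suc i ℕ.+ 1) f) (inner-sum′ i)))) ⟩
  s +ᴸ sumᴸ N (λ i → P (suc i) *ᴸ D (suc i ℕ.+ 1) f +ᴸ P (suc i) *ᴸ inner-sum′ i)
    ≈⟨ L.+-congˡ {s} (sumᴸ-+ N (λ i → P (suc i) *ᴸ D (suc i ℕ.+ 1) f) (λ i → P (suc i) *ᴸ inner-sum′ i)) ⟩
  s +ᴸ (sumᴸ N (λ i → P (suc i) *ᴸ D (suc i ℕ.+ 1) f) +ᴸ sumᴸ N (λ i → P (suc i) *ᴸ inner-sum′ i))
    ≈⟨ L.+-congˡ {s} (L.+-cong
         (sumᴸ-cong N (λ i → L.*-congˡ (L.reflexive (cong (λ k → D k f) (ℕ.+-comm (suc i) 1)))))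
         (sumᴸ-cong N (λ i → L.trans (L.*-congˡ (sumᴸ-cong N (λ j → L.*-congˡ (D-comm 1 (suc i ℕ.+ suc j) f)))) (L.sym (pull i (λ j → D (suc i ℕ.+ suc j) (D 1 f))))))) ⟩
  s +ᴸ (s +ᴸ R N (D 1 f))
    ≈⟨ solveᴸ 2 (λ s r → s :+ᴸ (s :+ᴸ r) :=ᴸ r :+ᴸ conᴸ (ℤ.+ 2) :*ᴸ s) L.refl s (R N (D 1 f)) ⟩
  R N (D 1 f) +ᴸ κ 2 *ᴸ s ∎
  where
  open L-Reasoning
  s = sumᴸ N (λ j → P (suc j) *ᴸ D (suc (suc j)) f)
  inner-sum inner-sum′ : ℕ → Λ
  inner-sum i = sumᴸ N (λ j → P (suc j) *ᴸ D (suc i ℕ.+ suc j) f)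
  inner-sum′ i = sumᴸ N (λ j → P (suc j) *ᴸ D 1 (D (suc i ℕ.+ suc j) f))
  pull : ∀ i (F : ℕ → Λ) → sumᴸ N (λ j → P (suc i) *ᴸ P (suc j) *ᴸ F j) ≋ P (suc i) *ᴸ sumᴸ N (λ j → P (suc j) *ᴸ F j)
  pull i F = L.trans (sumᴸ-cong N (λ j → L.*-assoc (P (suc i)) (P (suc j)) (F j)))
    (L.sym (linear-sumᴸ (*-linearˡ (P (suc i))) N (λ j → P (suc j) *ᴸ F j)))

-- The index i + j is at least 2, so D₁ passes every p_{i+j}.
D₁-Q : ∀ N f → D 1 (Q N f) ≋ Q N (D 1 f)
D₁-Q N f = L.trans (linear-sumᴸ (D-linear 1) N (λ i → sumᴸ N (q i))) (sumᴸ-cong N (λ i → L.trans (linear-sumᴸ (D-linear 1) N (q i)) (sumᴸ-cong N (term i))))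
  where
  q : ℕ → ℕ → Λ
  q i j = P (suc i ℕ.+ suc j) *ᴸ D (suc i) (D (suc j) f)
  term : ∀ i j → D 1 (P (suc i ℕ.+ suc j) *ᴸ D (suc i) (D (suc j) f)) ≋ P (suc i ℕ.+ suc j) *ᴸ D (suc i) (D (suc j) (D 1 f))
  term i j = L.trans (L.reflexive (cong (λ k → D 1 (P k *ᴸ D (suc i) (D (suc j) f))) (ℕ.+-suc (suc i) j)))
    (L.trans (D₁-P*-other (i ℕ.+ j) (D (suc i) (D (suc j) f)))
    (L.trans (L.*-congˡ (L.trans (D-comm 1 (suc i) (D (suc j) f)) (Linear.≋-cong (D-linear (suc i)) (D-comm 1 (suc j) f))))
             (L.reflexive (cong (λ k → P k *ᴸ D (suc i) (D (suc j) (D 1 f))) (≡.sym (ℕ.+-suc (suc i) j))))))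

-- The weight k - 1 removes the one term that contains p₁.
D₁-U : ∀ N f → D 1 (U N f) ≋ U N (D 1 f)
D₁-U N f = L.trans (linear-sumᴸ (D-linear 1) N (λ i → κ i *ᴸ P (suc i) *ᴸ D (suc i) f)) (sumᴸ-cong N (λ i → L.trans (term i) (L.*-congˡ (D-comm 1 (suc i) f))))
  where
  term : ∀ i → D 1 (κ i *ᴸ P (suc i) *ᴸ D (suc i) f) ≋ κ i *ᴸ P (suc i) *ᴸ D 1 (D (suc i) f)
  term zero = L.trans (Linear.vanishes (D-linear 1) (null (D 1 f))) (L.sym (null (D 1 (D 1 f))))
    where
    null : ∀ x → κ 0 *ᴸ P 1 *ᴸ x ≋ 0ᴸ
    null x = L.trans (L.*-congʳ (L.trans (L.*-congʳ const-0) (L.zeroˡ (P 1)))) (L.zeroˡ x)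
  term (suc i) = L.trans (Linear.≋-cong (D-linear 1) (L.*-assoc (κ (suc i)) (P (suc (suc i))) (D (suc (suc i)) f)))
    (L.trans (linear-const (D-linear 1) (fromℕ (suc i)) (P (suc (suc i)) *ᴸ D (suc (suc i)) f))
    (L.trans (L.*-congˡ (D₁-P*-other i (D (suc (suc i)) f))) (L.sym (L.*-assoc (κ (suc i)) (P (suc (suc i))) (D 1 (D (suc (suc i)) f))))))

E-D₁ : ∀ f → D 1 (E f) ≋ D 1 f +ᴸ E (D 1 f)
E-D₁ f = go (suc (bound f ℕ.+ bound (D 1 f))) (s≤s z≤n)
  (ℕ.m≤n⇒m≤1+n (ℕ.m≤m+n (bound f) (bound (D 1 f)))) (ℕ.m≤n⇒m≤1+n (ℕ.m≤n+m (bound (D 1 f)) (bound f)))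
  where
  go : ∀ N → 1 ≤ N → bound f ≤ N → bound (D 1 f) ≤ N → D 1 (E f) ≋ D 1 f +ᴸ E (D 1 f)
  go N 1≤N f≤N Df≤N = L.trans (Linear.≋-cong (D-linear 1) (E≋Eₙ f f≤N))
    (L.trans (D₁-Eₙ 1≤N f) (L.+-congˡ {D 1 f} (L.sym (E≋Eₙ (D 1 f) Df≤N))))

Δ₂-D₁ : ∀ f → D 1 (Δ₂ f) ≋ Δ₂ (D 1 f) +ᴸ const α *ᴸ (κ 2 *ᴸ lowering f)
Δ₂-D₁ f = go (suc (bound f ℕ.+ bound (D 1 f))) (s≤s z≤n)
  (ℕ.m≤n⇒m≤1+n (ℕ.m≤m+n (bound f) (bound (D 1 f)))) (ℕ.m≤n⇒m≤1+n (ℕ.m≤n+m (bound (D 1 f)) (bound f)))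
  where
  open L-Reasoning
  module D₁ = Linear (D-linear 1)
  go : ∀ N → 1 ≤ N → bound f ≤ N → bound (D 1 f) ≤ N → D 1 (Δ₂ f) ≋ Δ₂ (D 1 f) +ᴸ const α *ᴸ (κ 2 *ᴸ lowering f)
  go N 1≤N f≤N Df≤N = begin
    D 1 (Δ₂ f)
      ≈⟨ D₁.≋-cong (Δ₂≋Δₙ f f≤N) ⟩
    D 1 (const α *ᴸ R N f +ᴸ Q N f +ᴸ const (α - 1#) *ᴸ U N f)
      ≈⟨ L.trans (D₁.+-homo (const α *ᴸ R N f +ᴸ Q N f) (const (α - 1#) *ᴸ U N f)) (L.+-congʳ {D 1 (const (α - 1#) *ᴸ U N f)} (D₁.+-homo (const α *ᴸ R N f) (Q N f))) ⟩
    D 1 (const α *ᴸ R N f) +ᴸ D 1 (Q N f) +ᴸ D 1 (const (α - 1#) *ᴸ U N f)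
      ≈⟨ L.+-cong (L.+-cong (L.trans (linear-const (D-linear 1) α (R N f)) (L.*-congˡ (D₁-R 1≤N f))) (D₁-Q N f))
           (L.trans (linear-const (D-linear 1) (α - 1#) (U N f)) (L.*-congˡ (D₁-U N f))) ⟩
    const α *ᴸ (R N (D 1 f) +ᴸ κ 2 *ᴸ s) +ᴸ Q N (D 1 f) +ᴸ const (α - 1#) *ᴸ U N (D 1 f)
      ≈⟨ solveᴸ 5 (λ a r s q u → a :*ᴸ (r :+ᴸ s) :+ᴸ q :+ᴸ u :=ᴸ (a :*ᴸ r :+ᴸ q :+ᴸ u) :+ᴸ a :*ᴸ s) L.refl
           (const α) (R N (D 1 f)) (κ 2 *ᴸ s) (Q N (D 1 f)) (const (α - 1#) *ᴸ U N (D 1 f)) ⟩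
    Δₙ N (D 1 f) +ᴸ const α *ᴸ (κ 2 *ᴸ s)
      ≈⟨ L.+-cong (L.sym (Δ₂≋Δₙ (D 1 f) Df≤N)) (L.*-congˡ {const α} (L.*-congˡ {κ 2} (L.sym (lowering≋ f f≤N)))) ⟩
    Δ₂ (D 1 f) +ᴸ const α *ᴸ (κ 2 *ᴸ lowering f) ∎
    where s = sumᴸ N (λ j → P (suc j) *ᴸ D (suc (suc j)) f)

E-adjoint : ∀ f g → ⟪ E f , g ⟫ ≈ ⟪ f , E g ⟫
E-adjoint f g = K.trans (Functional.resp (pairing-functionalˡ g) (E≋Eₙ f (ℕ.m≤m+n (bound f) (bound g))))
  (K.trans (functional-sumᴸ (pairing-functionalˡ g) (pairing-functionalʳ f) N
    (λ i → K.trans (P-adjointˡ (suc i) (D (suc i) f) g) (K.sym (P-adjointʳ (suc i) f (D (suc i) g)))))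
  (Functional.resp (pairing-functionalʳ f) (L.sym (E≋Eₙ g (ℕ.m≤n+m (bound g) (bound f))))))
  where N = bound f ℕ.+ bound g

-- The modes in the Fock representation

module _ {P′ Q′ : Partition → Λ} (jack : IsMonicJack P′) (dual : IsHallDualBasis P′ Q′)
         {e f ψ : ℕ → Operator} (fock : IsFockRepresentation Q′ e f ψ) where
  open IsFockRepresentation fock
  open IsYangianRepresentation isRepresentation

  private
    e′ : ∀ r → Linear (e r)
    e′ r = isLinear⇒linear (e-linear r)
    f′ : ∀ r → Linear (f r)
    f′ r = isLinear⇒linear (f-linear r)
    ψ′ : ∀ r → Linear (ψ r)
    ψ′ r = isLinear⇒linear (ψ-linear r)

    -- The value of 2σ₃ψ₀, by `σ₃α⁻¹`.
    c₂ : ℚ⟨α⟩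
    c₂ = fromℕ 2 * (α - 1#)

  -- `ψ-action` determines only σ₃ψ_r; the factor is cancelled using `σ₃≉0`.
  ψ-eigenvectors : ∀ r {c : Partition → ℚ⟨α⟩} → (∀ lam → ψ-eigenvalue lam (suc r) ≈ σ₃ * c lam) → ∀ lam → ψ r (Q′ lam) ≋ const (c lam) *ᴸ Q′ lam
  ψ-eigenvectors r {c} eig lam = ·-cancel σ₃≉0 (begin
    σ₃ ·ᴸ ψ r (Q′ lam)                        ≈⟨ fromᴸ (ψ-action lam (suc r)) ⟩
    ψ-eigenvalue lam (suc r) ·ᴸ Q′ lam        ≈⟨ ·-cong (eig lam) L.refl ⟩
    (σ₃ * c lam) ·ᴸ Q′ lam                    ≈⟨ ·-· σ₃ (c lam) (Q′ lam) ⟨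
    σ₃ ·ᴸ c lam ·ᴸ Q′ lam                     ≈⟨ ·-cong K.refl (·≋const (c lam) (Q′ lam)) ⟩
    σ₃ ·ᴸ (const (c lam) *ᴸ Q′ lam)           ∎)
    where open L-Reasoning

  e₀≋ : ∀ x → e 0 x ≋ P 1 *ᴸ x
  e₀≋ x = L.trans (fromᴸ (e₀-action x)) (p≋* 1 x)

  f₀≋ : ∀ x → f 0 x ≋ const (- α⁻¹) *ᴸ D 1 x
  f₀≋ x = begin
    f 0 x                        ≈⟨ fromᴸ (f₀-action x) ⟩
    (- 1#) ·ᴸ α⁻¹ ·ᴸ D 1 x       ≈⟨ ·-· (- 1#) α⁻¹ (D 1 x) ⟩
    (- 1# * α⁻¹) ·ᴸ D 1 x        ≈⟨ ·≋const (- 1# * α⁻¹) (D 1 x) ⟩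
    const (- 1# * α⁻¹) *ᴸ D 1 x  ≈⟨ L.*-congʳ (const-cong (solve 1 (λ a → :- con 1ℤ :* a := :- a) K.refl α⁻¹)) ⟩
    const (- α⁻¹) *ᴸ D 1 x       ∎
    where open L-Reasoning

  ψ₀≋ : ∀ x → ψ 0 x ≋ const α⁻¹ *ᴸ x
  ψ₀≋ = linear-agree jack dual (ψ′ 0) (*-linearˡ (const α⁻¹))
    (ψ-eigenvectors 0 (λ lam → K.trans (Expansion.at₁ (ψ-eigenvalue-expansion lam)) (K.*-congˡ vacuumCharge≈α⁻¹)))

  ψ₁≋ : ∀ x → ψ 1 x ≋ 0ᴸ
  ψ₁≋ x = L.trans (linear-agree jack dual (ψ′ 1) (*-linearˡ (const 0#))
      (ψ-eigenvectors 1 (λ lam → Expansion.at₂ (ψ-eigenvalue-expansion lam))) x)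
    (L.trans (L.*-congʳ const-0) (L.zeroˡ x))

  ψ₂≋ : ∀ x → ψ 2 x ≋ fromℕ 2 ·ᴸ E x
  ψ₂≋ = linear-agree jack dual (ψ′ 2) (⊙-linear (fromℕ 2) E-linear) λ lam → begin
    ψ 2 (Q′ lam)                                 ≈⟨ ψ-eigenvectors 2 (λ lam → Expansion.at₃ (ψ-eigenvalue-expansion lam)) lam ⟩
    const (fromℕ 2 * fromℕ ∣ lam ∣) *ᴸ Q′ lam    ≈⟨ L.trans (L.*-congʳ (const-* (fromℕ 2) (fromℕ ∣ lam ∣))) (L.*-assoc (κ 2) (κ ∣ lam ∣) (Q′ lam)) ⟩
    κ 2 *ᴸ (κ ∣ lam ∣ *ᴸ Q′ lam)                 ≈⟨ L.*-congˡ (E-eigenvectors jack dual lam) ⟨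
    κ 2 *ᴸ E (Q′ lam)                            ≈⟨ ·≋const (fromℕ 2) (E (Q′ lam)) ⟨
    fromℕ 2 ·ᴸ E (Q′ lam)                        ∎
    where open L-Reasoning

  ψ₃-eigenvectors : ∀ lam → ψ 3 (Q′ lam) ≋ const (fromℕ 6 * C₁ lam + c₂ * fromℕ ∣ lam ∣) *ᴸ Q′ lam
  ψ₃-eigenvectors = ψ-eigenvectors 3 λ lam → K.trans (Expansion.at₄ (ψ-eigenvalue-expansion lam))
    (K.*-congˡ (K.+-congˡ (K.*-congʳ (K.*-congˡ (K.trans (K.*-congˡ vacuumCharge≈α⁻¹) σ₃α⁻¹)))))

  -- Both sides are linear and agree on the spanning family Q′, where 6C₁ = 3 · 2C₁ comes from Δ₂
  -- and the multiple of |λ| from E.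
  ψ₃≋ : ∀ x → ψ 3 x ≋ fromℕ 3 ·ᴸ Δ₂ x +ᴸ c₂ ·ᴸ E x
  ψ₃≋ = linear-agree jack dual (ψ′ 3) (⊕-linear (⊙-linear (fromℕ 3) Δ₂-linear) (⊙-linear c₂ E-linear)) λ lam → begin
    ψ 3 (Q′ lam)
      ≈⟨ ψ₃-eigenvectors lam ⟩
    const (fromℕ 6 * C₁ lam + c₂ * fromℕ ∣ lam ∣) *ᴸ Q′ lam
      ≈⟨ L.*-congʳ (L.trans (const-+ (fromℕ 6 * C₁ lam) (c₂ * fromℕ ∣ lam ∣)) (L.+-cong
           (L.trans (const-cong (solve 1 (λ c → con (ℤ.+ 6) :* c := con (ℤ.+ 3) :* (con (ℤ.+ 2) :* c)) K.refl (C₁ lam))) (const-* (fromℕ 3) (fromℕ 2 * C₁ lam)))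
           (const-* c₂ (fromℕ ∣ lam ∣)))) ⟩
    (κ 3 *ᴸ const (fromℕ 2 * C₁ lam) +ᴸ const c₂ *ᴸ κ ∣ lam ∣) *ᴸ Q′ lam
      ≈⟨ solveᴸ 5 (λ a b c d q → (a :*ᴸ b :+ᴸ c :*ᴸ d) :*ᴸ q :=ᴸ a :*ᴸ (b :*ᴸ q) :+ᴸ c :*ᴸ (d :*ᴸ q)) L.refl
           (κ 3) (const (fromℕ 2 * C₁ lam)) (const c₂) (κ ∣ lam ∣) (Q′ lam) ⟩
    κ 3 *ᴸ (const (fromℕ 2 * C₁ lam) *ᴸ Q′ lam) +ᴸ const c₂ *ᴸ (κ ∣ lam ∣ *ᴸ Q′ lam)
      ≈⟨ L.+-cong (L.*-congˡ (Δ₂-eigenvectors jack dual lam)) (L.*-congˡ (E-eigenvectors jack dual lam)) ⟨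
    κ 3 *ᴸ Δ₂ (Q′ lam) +ᴸ const c₂ *ᴸ E (Q′ lam)
      ≈⟨ L.+-cong (·≋const (fromℕ 3) (Δ₂ (Q′ lam))) (·≋const c₂ (E (Q′ lam))) ⟨
    fromℕ 3 ·ᴸ Δ₂ (Q′ lam) +ᴸ c₂ ·ᴸ E (Q′ lam) ∎
    where open L-Reasoning

  private
    ψ₃≋const : ∀ x → ψ 3 x ≋ κ 3 *ᴸ Δ₂ x +ᴸ const c₂ *ᴸ E x
    ψ₃≋const x = L.trans (ψ₃≋ x) (L.+-cong (·≋const (fromℕ 3) (Δ₂ x)) (·≋const c₂ (E x)))

    -- ψ₀ and ψ₁ commute with all y_j, so of the left side only [ψ₃ , y₀] - 3 [ψ₂ , y₁] survives.
    -- The scalars s and σ cover both signs, for e and for f.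
    cubic-at-0 : ∀ (y : ℕ → Operator) {s σ : ℚ⟨α⟩} →
      (∀ j → ⟦ ψ 0 , y j ⟧ ≗ 𝟘) → (∀ j → ⟦ ψ 1 , y j ⟧ ≗ 𝟘) → (∀ j → ⟦ ψ 2 , y j ⟧ ≗ s ⊙ y j) →
      cubic σ₂ ψ y 0 0 ≗ σ ⊙ anticommutator ψ y 0 0 →
      ∀ x → ⟦ ψ 3 , y 0 ⟧ x ≋ κ 3 *ᴸ (const s *ᴸ y 1 x) +ᴸ const σ *ᴸ anticommutator ψ y 0 0 x
    cubic-at-0 y {s} {σ} ψ₀y ψ₁y ψ₂y rel x = begin
      b₃
        -- The inserted zeros stand for the brackets with ψ₁ and ψ₀ and for the σ₂ term, giving the
        -- exact shape of `cubic`.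
        ≈⟨ solveᴸ 2 (λ a b → a :=ᴸ b :+ᴸ (a :-ᴸ b :+ᴸ conᴸ 0ℤ :-ᴸ conᴸ 0ℤ :+ᴸ conᴸ 0ℤ)) L.refl b₃ (κ 3 *ᴸ b₂) ⟩
      κ 3 *ᴸ b₂ +ᴸ (b₃ +ᴸ -ᴸ (κ 3 *ᴸ b₂) +ᴸ κ 0 +ᴸ -ᴸ κ 0 +ᴸ κ 0)
        ≈⟨ L.+-cong (L.*-congˡ (L.trans (fromᴸ (ψ₂y 1 x)) (·≋const s (y 1 x)))) (L.trans
             (L.+-cong (L.+-cong (L.+-cong (L.+-congˡ {b₃} (L.-‿cong (L.sym (·≋const (fromℕ 3) b₂)))) (zero-is (·-zeroʳ (fromℕ 3) (zero₁ 2))))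
                       (L.-‿cong (zero-is (zero₀ 3))))
                       (zero-is (·-zeroʳ σ₂ (L.+-cong (zero₁ 0) (L.-‿cong (zero₀ 1))))))
             (L.trans (fromᴸ (rel x)) (·≋const σ (anticommutator ψ y 0 0 x)))) ⟩
      κ 3 *ᴸ (const s *ᴸ y 1 x) +ᴸ const σ *ᴸ anticommutator ψ y 0 0 x ∎
      where
      open L-Reasoning
      b₃ = ⟦ ψ 3 , y 0 ⟧ x
      b₂ = ⟦ ψ 2 , y 1 ⟧ x
      zero₀ : ∀ j → ⟦ ψ 0 , y j ⟧ x ≋ 0ᴸ
      zero₀ j = fromᴸ (ψ₀y j x)
      zero₁ : ∀ j → ⟦ ψ 1 , y j ⟧ x ≋ 0ᴸ
      zero₁ j = fromᴸ (ψ₁y j x)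
      zero-is : ∀ {z} → z ≋ 0ᴸ → κ 0 ≋ z
      zero-is e = L.trans const-0 (L.sym e)

  -- [ψ₃ , p₁] is 6 `raising` from 3Δ₂ plus c₂ p₁ from E. The last term equals the anticommutator
  -- term 2σ₃ψ₀ p₁ of the cubic relation, which leaves 6 e₁ = 6 `raising`.
  e₁≋ : ∀ x → e 1 x ≋ raising x
  e₁≋ x = ·-cancel {fromℕ 6} (fromℕ-suc≉0 5) (L.trans (·≋const (fromℕ 6) (e 1 x)) (L.trans (begin
    κ 6 *ᴸ e 1 x
      ≈⟨ solveᴸ 2 (λ e s → conᴸ (ℤ.+ 6) :*ᴸ e :=ᴸ (conᴸ (ℤ.+ 3) :*ᴸ (conᴸ (ℤ.+ 2) :*ᴸ e) :+ᴸ s) :-ᴸ s) L.refl (e 1 x) anti ⟩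
    (κ 3 *ᴸ (κ 2 *ᴸ e 1 x) +ᴸ anti) +ᴸ -ᴸ anti
      ≈⟨ L.+-cong (L.sym relation) (L.-‿cong anti≋) ⟩
    (ψ 3 (e 0 x) +ᴸ -ᴸ e 0 (ψ 3 x)) +ᴸ -ᴸ (const c₂ *ᴸ (P 1 *ᴸ x))
      ≈⟨ L.+-congʳ { -ᴸ (const c₂ *ᴸ (P 1 *ᴸ x)) } (L.+-cong (begin
           ψ 3 (e 0 x)                                            ≈⟨ ψ₃.≋-cong (e₀≋ x) ⟩
           ψ 3 (P 1 *ᴸ x)                                         ≈⟨ ψ₃≋const (P 1 *ᴸ x) ⟩
           κ 3 *ᴸ Δ₂ (P 1 *ᴸ x) +ᴸ const c₂ *ᴸ E (P 1 *ᴸ x)       ≈⟨ L.+-cong (L.*-congˡ (Δ₂-P1 x)) (L.*-congˡ (E-P1 x)) ⟩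
           κ 3 *ᴸ (P 1 *ᴸ Δ₂ x +ᴸ κ 2 *ᴸ raising x) +ᴸ const c₂ *ᴸ (P 1 *ᴸ E x +ᴸ P 1 *ᴸ x) ∎)
         (L.-‿cong (L.trans (e₀≋ (ψ 3 x)) (L.*-congˡ (ψ₃≋const x))))) ⟩
    ((κ 3 *ᴸ (P 1 *ᴸ Δ₂ x +ᴸ κ 2 *ᴸ raising x) +ᴸ const c₂ *ᴸ (P 1 *ᴸ E x +ᴸ P 1 *ᴸ x)) +ᴸ -ᴸ (P 1 *ᴸ (κ 3 *ᴸ Δ₂ x +ᴸ const c₂ *ᴸ E x))) +ᴸ -ᴸ (const c₂ *ᴸ (P 1 *ᴸ x))
      ≈⟨ solveᴸ 6 (λ p d r c e x → ((conᴸ (ℤ.+ 3) :*ᴸ (p :*ᴸ d :+ᴸ conᴸ (ℤ.+ 2) :*ᴸ r) :+ᴸ c :*ᴸ (p :*ᴸ e :+ᴸ p :*ᴸ x)) :-ᴸ p :*ᴸ (conᴸ (ℤ.+ 3) :*ᴸ d :+ᴸ c :*ᴸ e)) :-ᴸ c :*ᴸ (p :*ᴸ x)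
           :=ᴸ conᴸ (ℤ.+ 6) :*ᴸ r) L.refl (P 1) (Δ₂ x) (raising x) (const c₂) (E x) x ⟩
    κ 6 *ᴸ raising x ∎) (L.sym (·≋const (fromℕ 6) (raising x)))))
    where
    open L-Reasoning
    module ψ₃ = Linear (ψ′ 3)
    anti : Λ
    anti = const σ₃ *ᴸ (ψ 0 (e 0 x) +ᴸ e 0 (ψ 0 x))
    relation : ψ 3 (e 0 x) +ᴸ -ᴸ e 0 (ψ 3 x) ≋ κ 3 *ᴸ (κ 2 *ᴸ e 1 x) +ᴸ anti
    relation = cubic-at-0 e ψ₀e ψ₁e ψ₂e (cubic-ψe 0 0) x
    anti≋ : anti ≋ const c₂ *ᴸ (P 1 *ᴸ x)
    anti≋ = begin
      const σ₃ *ᴸ (ψ 0 (e 0 x) +ᴸ e 0 (ψ 0 x))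
        ≈⟨ L.*-congˡ (L.+-cong (L.trans (ψ₀≋ (e 0 x)) (L.*-congˡ (e₀≋ x))) (L.trans (e₀≋ (ψ 0 x)) (L.*-congˡ (ψ₀≋ x)))) ⟩
      const σ₃ *ᴸ (const α⁻¹ *ᴸ (P 1 *ᴸ x) +ᴸ P 1 *ᴸ (const α⁻¹ *ᴸ x))
        ≈⟨ solveᴸ 4 (λ s a p x → s :*ᴸ (a :*ᴸ (p :*ᴸ x) :+ᴸ p :*ᴸ (a :*ᴸ x)) :=ᴸ conᴸ (ℤ.+ 2) :*ᴸ (s :*ᴸ a) :*ᴸ (p :*ᴸ x)) L.refl
             (const σ₃) (const α⁻¹) (P 1) x ⟩
      κ 2 *ᴸ (const σ₃ *ᴸ const α⁻¹) *ᴸ (P 1 *ᴸ x)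
        ≈⟨ L.*-congʳ (L.trans (L.*-congˡ (L.trans (L.sym (const-* σ₃ α⁻¹)) (const-cong σ₃α⁻¹))) (L.sym (const-* (fromℕ 2) (α - 1#)))) ⟩
      const c₂ *ᴸ (P 1 *ᴸ x) ∎

  -- The same cancellation with D₁ for p₁. The commutator of D₁ with Δ₂ carries a factor α, which
  -- the α⁻¹ in f₀ removes.
  f₁≋ : ∀ x → f 1 x ≋ -ᴸ lowering x
  f₁≋ x = ·-cancel {fromℕ 6} (fromℕ-suc≉0 5) (L.trans (·≋const (fromℕ 6) (f 1 x)) (L.trans (begin
    κ 6 *ᴸ f 1 x
      ≈⟨ solveᴸ 2 (λ f s → conᴸ (ℤ.+ 6) :*ᴸ f :=ᴸ :-ᴸ (conᴸ (ℤ.+ 3) :*ᴸ (:-ᴸ conᴸ (ℤ.+ 2) :*ᴸ f) :+ᴸ s) :+ᴸ s) L.refl (f 1 x) anti ⟩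
    -ᴸ (κ 3 *ᴸ (const (- fromℕ 2) *ᴸ f 1 x) +ᴸ anti) +ᴸ anti
      ≈⟨ L.+-cong (L.-‿cong (L.sym relation)) anti≋ ⟩
    -ᴸ (ψ 3 (f 0 x) +ᴸ -ᴸ f 0 (ψ 3 x)) +ᴸ const c₂ *ᴸ (a⁻¹ *ᴸ D 1 x)
      ≈⟨ L.+-congʳ {const c₂ *ᴸ (a⁻¹ *ᴸ D 1 x)} (L.-‿cong (L.+-cong (begin
           ψ 3 (f 0 x)                  ≈⟨ ψ₃.≋-cong (f₀≋ x) ⟩
           ψ 3 (const (- α⁻¹) *ᴸ D 1 x) ≈⟨ linear-const (ψ′ 3) (- α⁻¹) (D 1 x) ⟩
           const (- α⁻¹) *ᴸ ψ 3 (D 1 x) ≈⟨ L.*-congˡ (ψ₃≋const (D 1 x)) ⟩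
           -ᴸ a⁻¹ *ᴸ (κ 3 *ᴸ Δ₂ (D 1 x) +ᴸ const c₂ *ᴸ E (D 1 x)) ∎)
         (L.-‿cong (begin
           f 0 (ψ 3 x)                  ≈⟨ f₀≋ (ψ 3 x) ⟩
           const (- α⁻¹) *ᴸ D 1 (ψ 3 x)
             ≈⟨ L.*-congˡ (L.trans (D₁.≋-cong (ψ₃≋const x)) (L.trans (D₁.+-homo (κ 3 *ᴸ Δ₂ x) (const c₂ *ᴸ E x))
                  (L.+-cong (linear-const (D-linear 1) (fromℕ 3) (Δ₂ x)) (linear-const (D-linear 1) c₂ (E x))))) ⟩
           -ᴸ a⁻¹ *ᴸ (κ 3 *ᴸ D 1 (Δ₂ x) +ᴸ const c₂ *ᴸ D 1 (E x))
             ≈⟨ L.*-congˡ (L.+-cong (L.*-congˡ (Δ₂-D₁ x)) (L.*-congˡ (E-D₁ x))) ⟩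
           -ᴸ a⁻¹ *ᴸ (κ 3 *ᴸ (Δ₂ (D 1 x) +ᴸ const α *ᴸ (κ 2 *ᴸ lowering x)) +ᴸ const c₂ *ᴸ (D 1 x +ᴸ E (D 1 x))) ∎)))) ⟩
    -ᴸ (-ᴸ a⁻¹ *ᴸ (κ 3 *ᴸ Δ₂ (D 1 x) +ᴸ const c₂ *ᴸ E (D 1 x)) +ᴸ
        -ᴸ (-ᴸ a⁻¹ *ᴸ (κ 3 *ᴸ (Δ₂ (D 1 x) +ᴸ const α *ᴸ (κ 2 *ᴸ lowering x)) +ᴸ const c₂ *ᴸ (D 1 x +ᴸ E (D 1 x))))) +ᴸ const c₂ *ᴸ (a⁻¹ *ᴸ D 1 x)
      ≈⟨ solveᴸ 7 (λ i a d l c x e → (:-ᴸ (:-ᴸ i :*ᴸ (conᴸ (ℤ.+ 3) :*ᴸ d :+ᴸ c :*ᴸ e) :+ᴸ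
             :-ᴸ (:-ᴸ i :*ᴸ (conᴸ (ℤ.+ 3) :*ᴸ (d :+ᴸ a :*ᴸ (conᴸ (ℤ.+ 2) :*ᴸ l)) :+ᴸ c :*ᴸ (x :+ᴸ e))))) :+ᴸ c :*ᴸ (i :*ᴸ x)
           :=ᴸ conᴸ (ℤ.+ 6) :*ᴸ (:-ᴸ (i :*ᴸ a :*ᴸ l))) L.refl
           a⁻¹ (const α) (Δ₂ (D 1 x)) (lowering x) (const c₂) (D 1 x) (E (D 1 x)) ⟩
    κ 6 *ᴸ (-ᴸ (a⁻¹ *ᴸ const α *ᴸ lowering x))
      ≈⟨ L.*-congˡ (L.-‿cong (L.trans (L.*-congʳ (L.trans (L.sym (const-* α⁻¹ α)) (const-cong α⁻¹-*ˡ))) (L.*-identityˡ (lowering x)))) ⟩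
    κ 6 *ᴸ (-ᴸ lowering x) ∎) (L.sym (·≋const (fromℕ 6) (-ᴸ lowering x)))))
    where
    open L-Reasoning
    module ψ₃ = Linear (ψ′ 3)
    module D₁ = Linear (D-linear 1)
    a⁻¹ : Λ
    a⁻¹ = const α⁻¹
    anti : Λ
    anti = const (- σ₃) *ᴸ (ψ 0 (f 0 x) +ᴸ f 0 (ψ 0 x))
    relation : ψ 3 (f 0 x) +ᴸ -ᴸ f 0 (ψ 3 x) ≋ κ 3 *ᴸ (const (- fromℕ 2) *ᴸ f 1 x) +ᴸ anti
    relation = cubic-at-0 f ψ₀f ψ₁f ψ₂f (cubic-ψf 0 0) x
    anti≋ : anti ≋ const c₂ *ᴸ (a⁻¹ *ᴸ D 1 x)
    anti≋ = begin
      const (- σ₃) *ᴸ (ψ 0 (f 0 x) +ᴸ f 0 (ψ 0 x))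
        ≈⟨ L.*-congˡ (L.+-cong (L.trans (ψ₀≋ (f 0 x)) (L.*-congˡ (f₀≋ x)))
             (L.trans (f₀≋ (ψ 0 x)) (L.*-congˡ (L.trans (D₁.≋-cong (ψ₀≋ x)) (linear-const (D-linear 1) α⁻¹ x))))) ⟩
      -ᴸ const σ₃ *ᴸ (a⁻¹ *ᴸ (-ᴸ a⁻¹ *ᴸ D 1 x) +ᴸ -ᴸ a⁻¹ *ᴸ (a⁻¹ *ᴸ D 1 x))
        ≈⟨ solveᴸ 3 (λ s a x → (:-ᴸ s) :*ᴸ (a :*ᴸ ((:-ᴸ a) :*ᴸ x) :+ᴸ (:-ᴸ a) :*ᴸ (a :*ᴸ x)) :=ᴸ conᴸ (ℤ.+ 2) :*ᴸ (s :*ᴸ a) :*ᴸ (a :*ᴸ x)) L.refl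
             (const σ₃) a⁻¹ (D 1 x) ⟩
      κ 2 *ᴸ (const σ₃ *ᴸ const α⁻¹) *ᴸ (a⁻¹ *ᴸ D 1 x)
        ≈⟨ L.*-congʳ (L.trans (L.*-congˡ (L.trans (L.sym (const-* σ₃ α⁻¹)) (const-cong σ₃α⁻¹))) (L.sym (const-* (fromℕ 2) (α - 1#)))) ⟩
      const c₂ *ᴸ (a⁻¹ *ᴸ D 1 x) ∎

  ψ₃-adjoint : ∀ H₂ → IsHallAdjoint Δ₂ H₂ → IsHallAdjoint (ψ 3) (fromℕ 3 ⊙ H₂ ⊕ c₂ ⊙ E)
  ψ₃-adjoint H₂ adj x y = begin
    ⟨ ψ 3 x , y ⟩Hall
      ≈⟨ Hall≈ (ψ 3 x) y ⟩
    ⟪ ψ 3 x , y ⟫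
      ≈⟨ Fˡ.resp (ψ₃≋const x) ⟩
    ⟪ κ 3 *ᴸ Δ₂ x +ᴸ const c₂ *ᴸ E x , y ⟫
      ≈⟨ K.trans (Fˡ.+-homo (κ 3 *ᴸ Δ₂ x) (const c₂ *ᴸ E x)) (K.+-cong (Fˡ.c-homo (fromℕ 3) (Δ₂ x)) (Fˡ.c-homo c₂ (E x))) ⟩
    fromℕ 3 * ⟪ Δ₂ x , y ⟫ + c₂ * ⟪ E x , y ⟫
      ≈⟨ K.+-cong (K.*-congˡ (K.trans (K.sym (Hall≈ (Δ₂ x) y)) (K.trans (adj x y) (Hall≈ x (H₂ y))))) (K.*-congˡ (E-adjoint x y)) ⟩
    fromℕ 3 * ⟪ x , H₂ y ⟫ + c₂ * ⟪ x , E y ⟫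
      ≈⟨ K.trans (Fʳ.+-homo (κ 3 *ᴸ H₂ y) (const c₂ *ᴸ E y)) (K.+-cong (Fʳ.c-homo (fromℕ 3) (H₂ y)) (Fʳ.c-homo c₂ (E y))) ⟨
    ⟪ x , κ 3 *ᴸ H₂ y +ᴸ const c₂ *ᴸ E y ⟫
      ≈⟨ Fʳ.resp (L.+-cong (·≋const (fromℕ 3) (H₂ y)) (·≋const c₂ (E y))) ⟨
    ⟪ x , fromℕ 3 ·ᴸ H₂ y +ᴸ c₂ ·ᴸ E y ⟫
      ≈⟨ Hall≈ x (fromℕ 3 ·ᴸ H₂ y +ᴸ c₂ ·ᴸ E y) ⟨
    ⟨ x , fromℕ 3 ·ᴸ H₂ y +ᴸ c₂ ·ᴸ E y ⟩Hall ∎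
    where
    open K-Reasoning
    module Fˡ = Functional (pairing-functionalˡ y)
    module Fʳ = Functional (pairing-functionalʳ x)

proposition10p1 : (P Q′ : Partition → Λ) → IsMonicJack P → IsHallDualBasis P Q′ →
    (e f ψ : ℕ → Operator) → IsFockRepresentation Q′ e f ψ →
    (e 0 ≗ p 1)
    × (f 0 ≗ - α⁻¹ ⊙ D 1)
    × (ψ 0 ≗ α⁻¹ ⊙ id)
    × (ψ 1 ≗ 𝟘)
    × (ψ 2 ≗ fromℕ 2 ⊙ E)
    × (ψ 3 ≗ fromℕ 3 ⊙ Δ₂ ⊕ (fromℕ 2 * (α - 1#)) ⊙ E)
    × (e 1 ≗ (∑ λ j → p (suc j) ∘ D j))
    × (f 1 ≗ - 1# ⊙ (∑ λ j → p j ∘ D (suc j)))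
    × (∀ lam → ψ 3 (Q′ lam) ≈ᴸ (fromℕ 6 * C₁ lam + fromℕ 2 * (α - 1#) * fromℕ ∣ lam ∣) ·ᴸ Q′ lam)
    × (∀ H₂ → IsHallAdjoint Δ₂ H₂ → IsHallAdjoint (ψ 3) (fromℕ 3 ⊙ H₂ ⊕ (fromℕ 2 * (α - 1#)) ⊙ E))
proposition10p1 P′ Q′ jack dual e f ψ fock =
    IsFockRepresentation.e₀-action fock
  , (λ x → toᴸ (L.trans (f₀≋ jack dual fock x) (L.sym (·≋const (- α⁻¹) (D 1 x)))))
  , (λ x → toᴸ (L.trans (ψ₀≋ jack dual fock x) (L.sym (·≋const α⁻¹ x))))
  , (λ x → toᴸ (ψ₁≋ jack dual fock x))
  , (λ x → toᴸ (ψ₂≋ jack dual fock x))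
  , (λ x → toᴸ (ψ₃≋ jack dual fock x))
  , (λ x → toᴸ (e₁≋ jack dual fock x))
  , (λ x → toᴸ (L.trans (f₁≋ jack dual fock x) (L.trans
      (solveᴸ 1 (λ l → :-ᴸ l :=ᴸ :-ᴸ conᴸ 1ℤ :*ᴸ l) L.refl (lowering x)) (L.sym (·≋const (- 1#) (lowering x))))))
  , (λ lam → toᴸ (L.trans (ψ₃-eigenvectors jack dual fock lam) (L.sym (·≋const (fromℕ 6 * C₁ lam + fromℕ 2 * (α - 1#) * fromℕ ∣ lam ∣) (Q′ lam)))))
  , ψ₃-adjoint jack dual fock
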